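{- There exists an absolute constant $C>0$ such that for every $d\ge1$, every function $f\colon\{0,1\}^d\to\mathbb{R}$ and every coloring $\mathtt{col}\colon\mathcal{S}_f^-\to\{\mathrm{red},\mathrm{blue}\}$, \[ \mathbb{E}_{\boldsymbol{x}\sim\{0,1\}^d}\Big[\sqrt{I^-_{f,\mathrm{red}}(\boldsymbol{x})}\Big]+\mathbb{E}_{\boldsymbol{y}\sim\{0,1\}^d}\Big[\sqrt{I^-_{f,\mathrm{blue}}(\boldsymbol{y})}\Big]\ \ge\ C\cdot\varepsilon(f), \] where $\boldsymbol{x},\boldsymbol{y}$ are uniform on $\{0,1\}^d$.
   Context: The directed $d$-dimensional hypercube has vertex set $\{0,1\}^d$ and edges the ordered pairs $(x,y)$ such that there is a unique $i\in[d]$ with $x_i=0$, $y_i=1$, and $x_j=y_j$ for all $j\neq i$. The partial order is $x\preceq y$ iff $x_i\le y_i$ for all $i$. A function $g$ is monotone if $g(x)\le g(y)$ whenever $x\preceq y$. The distance to monotonicity $\varepsilon(f)$ is the minimum of $\Pr_{\boldsymbol{x}}[f(\boldsymbol{x})\ne g(\boldsymbol{x})]$ over monotone $g\colon\{0,1\}^d\to\mathbb{R}$. An edge $(x,y)$ is violated by $f$ if $f(x)>f(y)$; $\mathcal{S}_f^-$ is the set of violated edges. For a coloring $\mathtt{col}$ of $\mathcal{S}_f^-$: $I^-_{f,\mathrm{red}}(x)=|\{y:(x,y)\in\mathcal{S}_f^-,\ \mathtt{col}(x,y)=\mathrm{red}\}|$ (outgoing red violated edges at $x$) and $I^-_{f,\mathrm{blue}}(y)=|\{x:(x,y)\in\mathcal{S}_f^-,\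 \mathtt{col}(x,y)=\mathrm{blue}\}|$ (incoming blue violated edges at $y$).
   Formalization: The function f and the monotone functions g defining the distance to monotonicity take rational instead of real values; the expected square roots are expressed by requiring the inequality for all rational upper bounds of the roots, which is equivalent. -}

module Defs where

open import Data.Bool using (Bool; true; false; _∧_; not) renaming (_≤_ to _≤ᵇ_)
open import Data.Nat using (ℕ; zero; suc; _^_)
open import Data.Nat.Properties using (m^n≢0)
open import Data.Integer using (+_)
open import Data.Fin using (Fin)
open import Data.Vec using (Vec; []; _∷_; lookup; _[_]≔_)
open import Data.Vec.Relation.Binary.Pointwise.Inductive using (Pointwise)
open import Data.List using (List; []; _∷_; _++_; map; filter; filterᵇ; length; allFin)
open import Data.Rational using (ℚ; 0ℚ; _+_; _*_; _≤_; _<_; _/_)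
open import Data.Rational.Properties using (_<?_; _≟_)
open import Data.Product using (Σ; _×_; _,_)
open import Relation.Binary.PropositionalEquality using (_≡_; _≢_)
open import Relation.Nullary using (¬_; ¬?; does)

Cube : ℕ → Set
Cube d = Vec Bool d

allCube : (d : ℕ) → List (Cube d)
allCube zero = [] ∷ []
allCube (suc d) = map (false ∷_) (allCube d) ++ map (true ∷_) (allCube d)

sumℚ : {A : Set} → List A → (A → ℚ) → ℚ
sumℚ [] h = 0ℚ
sumℚ (a ∷ as) h = h a + sumℚ as h

E : (d : ℕ) → (Cube d → ℚ) → ℚ
E d h = ((+ 1) / (2 ^ d)) {{m^n≢0 2 d}} * sumℚ (allCube d) h

_⪯_ : {d : ℕ} → Cube d → Cube d → Set
x ⪯ y = Pointwise _≤ᵇ_ x y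

Monotone : {d : ℕ} → (Cube d → ℚ) → Set
Monotone {d} g = (x y : Cube d) → x ⪯ y → g x ≤ g y

disagree : {d : ℕ} → (Cube d → ℚ) → (Cube d → ℚ) → ℕ
disagree {d} f g = length (filter (λ x → ¬? (f x ≟ g x)) (allCube d))

distFrac : {d : ℕ} → (Cube d → ℚ) → (Cube d → ℚ) → ℚ
distFrac {d} f g = ((+ disagree f g) / (2 ^ d)) {{m^n≢0 2 d}}

IsDistToMono : {d : ℕ} → (Cube d → ℚ) → ℚ → Set
IsDistToMono {d} f e =
  Σ (Cube d → ℚ) (λ g → Monotone g × distFrac f g ≡ e)
  × ((g : Cube d → ℚ) → Monotone g → e ≤ distFrac f g)

data Color : Set where
  red blue : Color

isRed : Color → Bool
isRed red = true
isRed blue = false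

isBlue : Color → Bool
isBlue c = not (isRed c)

-- Directed edges of the hypercube: (x , y) is an edge iff y = x with one
-- coordinate i flipped from 0 to 1.  The edges leaving x are in bijection
-- with the coordinates i with x_i = 0 (y = x[i]≔1); the edges entering y are
-- in bijection with coordinates i with y_i = 1 (x = y[i]≔0).

Ired : {d : ℕ} → (Cube d → ℚ) → (Cube d → Cube d → Color) → Cube d → ℕ
Ired {d} f col x = length (filterᵇ p (allFin d))
  where
  p : Fin d → Bool
  p i = not (lookup x i) ∧ does (f (x [ i ]≔ true) <? f x)
        ∧ isRed (col x (x [ i ]≔ true))

Iblue : {d : ℕ} → (Cube d → ℚ) → (Cube d → Cube d → Color) → Cube d → ℕ
Iblue {d} f col y = length (filterᵇ p (allFin d))
  where
  p : Fin d → Bool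
  p i = lookup y i ∧ does (f y <? f (y [ i ]≔ false))
        ∧ isBlue (col (y [ i ]≔ false) y)

-- s is an upper bound for the (real) square root of the natural number a:
-- s ≥ 0 and s² ≥ a.  A real inequality  Σ √a_x ≥ T  holds iff every choice of
-- such rational upper bounds s_x satisfies  Σ s_x ≥ T.
SqrtUpper : ℕ → ℚ → Set
SqrtUpper a s = 0ℚ ≤ s × (+ a) / 1 ≤ s * s

{-# OPTIONS --safe #-}
-- Boolean case.  Sort F along a random set S of directions and follow the value at a fixed point x as a function of S.
-- Red violated edges are counted at their 1-end, blue ones at their 0-end; for any concave potential in place of the root,
-- sorting does not increase the total potential, while violated edges turn into sensitive edges of the functions of S.
-- Talagrand's inequality for these functions bounds the probability that independent S, S' give different values at x.
-- Its proof here smooths g by resampling coordinates with probability p = 4^-j: at scale p the variance released is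
-- p times the energy of the smoothed gradient, hence at most 2^-j times the expected root of the sensitivity.
-- Splitting the directions at random into 16 parts S, sorting along one part is, up to that probability, as good as sorting
-- along all of them, so the distance to the sorted function obeys D(R) ≤ 2 E D(R ∩ S) + O(Φ(R)).  Since Φ(R ∩ S) is on
-- average at most Φ(R) / 4, iteration gives D = O(Φ).
--
-- General case.  Replace f by its rank ρ and let h be a monotone integer function minimising Σ |ρ - h|.  For each t the two
-- Boolean functions that threshold ρ strictly or weakly at t on the level {h = t}, and are constant above and below it, have
-- all their violated edges inside that level, where they are violated by f as well.  By minimality their distances to
-- monotonicity, added over t, are at least the number of points with ρ ≠ h.
module Submission where

open import Defs
open import Data.Nat using (ℕ; _≤_)
open import Data.Rational using (ℚ; 0ℚ; _<_; _+_; _*_) renaming (_≤_ to _≤ℚ_)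
open import Data.Product using (Σ; _×_)

open import Data.Bool using (Bool; true; false; _∧_; _∨_; not; _xor_; f≤t; b≤b; if_then_else_) renaming (_≤_ to _≤ᵇ_)
import Data.Bool.Properties as Boolₚ
open import Data.Empty using (⊥; ⊥-elim)
open import Data.Fin using (Fin; zero; suc; toℕ; fromℕ<)
import Data.Fin.Properties as Finₚ
open import Data.Fin.Subset using (_∩_)
import Data.Integer as ℤ
import Data.Integer.Properties as ℤₚ
open import Data.List as List using (List; []; _∷_; filterᵇ; length; tabulate)
open import Data.Nat as ℕ using (zero; suc; ∣_-_∣)
import Data.Nat.Induction as ℕᵢ
import Data.Nat.Properties as ℕₚ
open import Algebra.Properties.CommutativeSemigroup ℕₚ.+-commutativeSemigroup using (interchange)
open import Data.Product using (_,_; proj₁; proj₂)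
open import Data.Rational using (1ℚ; ½; _-_; -_; _/_; _⊔_; 1/_; Positive; nonNegative; ≢-nonZero)
open import Data.Rational.Properties
open import Data.Rational.Solver
import Data.Rational.Unnormalised as ℚᵘ
import Data.Rational.Unnormalised.Properties as ℚᵘₚ
open import Data.Sum using (_⊎_; inj₁; inj₂)
open import Data.Unit using (⊤; tt)
open import Data.Vec using (Vec; []; _∷_; _[_]≔_; lookup; map; replicate)
open import Data.Vec.Properties using ([]≔-lookup; []≔-idempotent; lookup∘update)
open import Data.Vec.Relation.Binary.Pointwise.Inductive using ([]; _∷_)
open import Function using (_∘_)
open import Relation.Binary.PropositionalEquality
open import Relation.Nullary using (¬_; ¬?; Dec; yes; no; does)
open import Relation.Nullary.Decidable using (True; toWitness; _×-dec_; dec-true; dec-false; decidable-stable)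
open +-*-Solver using (solve; _:=_; _:+_; _:*_; _:-_; :-_; con)

-- Rational arithmetic and sums over the cube

-- No square root is ever taken. A root is represented by any nonnegative `u` whose square is at
-- least the count, and roots are compared by squaring (`sq-cancel-≤`). Only sorting needs an honest
-- concave function; there `ψ` stands in and costs a factor 2. The obstacle for Talagrand's
-- inequality is that a sensitive edge may be visible at one end only, the end that its colour
-- selects. The derivative is therefore loaded onto that end before Cauchy-Schwarz is applied, which
-- costs a constant because the bias is fixed. With m parts a root shrinks by the root of m while
-- the recursion doubles the distance, so m must exceed 4; moreover 16 has a rational root. The
-- iteration starts from the trivial bound by the number of violated edges, which decays faster than
-- the root and is absorbed after d rounds. The integer minimiser is not searched for. It exists up
-- to double negation, which is enough because the final inequality between rationals is decidable.

2ℚ 3ℚ 4ℚ : ℚ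
2ℚ = (ℤ.+ 2) / 1
3ℚ = (ℤ.+ 3) / 1
4ℚ = (ℤ.+ 4) / 1

dec≤ : ∀ {p q} → {True (p ≤? q)} → p ≤ℚ q
dec≤ {p} {q} {h} = toWitness h

≤-by : ∀ {p q r} → 0ℚ ≤ℚ r → p + r ≡ q → p ≤ℚ q
≤-by {p} {q} {r} 0≤r eq = subst₂ _≤ℚ_ (+-identityʳ p) eq (+-monoʳ-≤ p 0≤r)

≤⇒0≤- : ∀ {p q} → p ≤ℚ q → 0ℚ ≤ℚ q - p
≤⇒0≤- {p} {q} p≤q = subst (_≤ℚ q - p) (+-inverseʳ p) (+-monoˡ-≤ (- p) p≤q)

0≤-⇒≤ : ∀ {p q} → 0ℚ ≤ℚ q - p → p ≤ℚ q
0≤-⇒≤ {p} {q} h = ≤-by h (solve 2 (λ p q → p :+ (q :- p) := q) refl p q)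

+-nonneg : ∀ {p q} → 0ℚ ≤ℚ p → 0ℚ ≤ℚ q → 0ℚ ≤ℚ p + q
+-nonneg = +-mono-≤

*-monoˡ-nn : ∀ {a b c} → 0ℚ ≤ℚ a → b ≤ℚ c → a * b ≤ℚ a * c
*-monoˡ-nn {a} 0≤a = *-monoˡ-≤-nonNeg a {{nonNegative 0≤a}}

*-monoʳ-nn : ∀ {a b c} → 0ℚ ≤ℚ a → b ≤ℚ c → b * a ≤ℚ c * a
*-monoʳ-nn {a} 0≤a = *-monoʳ-≤-nonNeg a {{nonNegative 0≤a}}

*-nonneg : ∀ {p q} → 0ℚ ≤ℚ p → 0ℚ ≤ℚ q → 0ℚ ≤ℚ p * q
*-nonneg {p} {q} 0≤p 0≤q = subst (_≤ℚ p * q) (*-zeroʳ p) (*-monoˡ-nn 0≤p 0≤q)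

*-mono-nn : ∀ {a b c d} → 0ℚ ≤ℚ a → 0ℚ ≤ℚ d → a ≤ℚ b → c ≤ℚ d → a * c ≤ℚ b * d
*-mono-nn 0≤a 0≤d a≤b c≤d = ≤-trans (*-monoˡ-nn 0≤a c≤d) (*-monoʳ-nn 0≤d a≤b)

sq-nonneg : ∀ p → 0ℚ ≤ℚ p * p
sq-nonneg p with ≤-total 0ℚ p
... | inj₁ 0≤p = *-nonneg 0≤p 0≤p
... | inj₂ p≤0 = subst (0ℚ ≤ℚ_) (solve 1 (λ p → (:- p) :* (:- p) := p :* p) refl p)
                   (*-nonneg (neg-antimono-≤ p≤0) (neg-antimono-≤ p≤0))

sq-cancel-≤ : ∀ {x y} → 0ℚ ≤ℚ y → x * x ≤ℚ y * y → x ≤ℚ y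
sq-cancel-≤ {x} {y} 0≤y h with ≤-total x y
... | inj₁ x≤y = x≤y
... | inj₂ y≤x with ≤-total 0ℚ (x - y)
...   | inj₂ x-y≤0 = 0≤-⇒≤ (subst (0ℚ ≤ℚ_) (solve 2 (λ x y → :- (x :- y) := y :- x) refl x y) (neg-antimono-≤ x-y≤0))
...   | inj₁ 0≤x-y with x - y ≟ 0ℚ
...     | yes e = ≤-reflexive (trans (solve 2 (λ x y → x := (x :- y) :+ y) refl x y) (trans (cong (_+ y) e) (+-identityˡ y)))
...     | no ne = ⊥-elim (<-irrefl refl (<-≤-trans 0<d (≤-trans d≤ h')))
  where
  instance
    d-pos : Positive (x - y)
    d-pos = nonNeg∧nonZero⇒pos (x - y) {{nonNegative 0≤x-y}} {{≢-nonZero ne}}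
  d = x - y
  0<d : 0ℚ < d * d
  0<d = positive⁻¹ (d * d) {{pos*pos⇒pos d d}}
  d≤ : d * d ≤ℚ x * x - y * y
  d≤ = ≤-by (*-nonneg (*-nonneg 0≤2 0≤y) 0≤x-y)
    (solve 2 (λ x y → (x :- y) :* (x :- y) :+ con 2ℚ :* y :* (x :- y) := x :* x :- y :* y) refl x y)
    where
    0≤2 : 0ℚ ≤ℚ 2ℚ
    0≤2 = dec≤
  h' : x * x - y * y ≤ℚ 0ℚ
  h' = subst (x * x - y * y ≤ℚ_) (+-inverseʳ (y * y)) (+-monoˡ-≤ (- (y * y)) h)

ι : ℕ → ℚ
ι n = (ℤ.+ n) / 1

-- Weights 1, 1 give the sum over the cube, weights `1ℚ - q`, `q` the expectation under independent
-- biased bits. Sharing one construction makes `W-swap` the Fubini rule between points and sets of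
-- directions.
module WeightedSum (a b : ℚ) where

  W : ∀ {n} → (Cube n → ℚ) → ℚ
  W {zero} φ = φ []
  W {suc n} φ = a * W (φ ∘ (false ∷_)) + b * W (φ ∘ (true ∷_))

  W-cong : ∀ {n} {φ χ : Cube n → ℚ} → (∀ x → φ x ≡ χ x) → W φ ≡ W χ
  W-cong {zero} h = h []
  W-cong {suc n} h = cong₂ (λ u v → a * u + b * v) (W-cong (h ∘ (false ∷_))) (W-cong (h ∘ (true ∷_)))

  W-lin : ∀ {n} k l (φ χ : Cube n → ℚ) → W (λ x → k * φ x + l * χ x) ≡ k * W φ + l * W χ
  W-lin {zero} k l φ χ = refl
  W-lin {suc n} k l φ χ = trans
    (cong₂ (λ u v → a * u + b * v) (W-lin k l (φ ∘ (false ∷_)) (χ ∘ (false ∷_))) (W-lin k l (φ ∘ (true ∷_)) (χ ∘ (true ∷_))))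
    (solve 8 (λ a b k l u v u' v' → a :* (k :* u :+ l :* v) :+ b :* (k :* u' :+ l :* v') := k :* (a :* u :+ b :* u') :+ l :* (a :* v :+ b :* v')) refl
      a b k l (W (φ ∘ (false ∷_))) (W (χ ∘ (false ∷_))) (W (φ ∘ (true ∷_))) (W (χ ∘ (true ∷_))))

  W-+ : ∀ {n} (φ χ : Cube n → ℚ) → W (λ x → φ x + χ x) ≡ W φ + W χ
  W-+ φ χ = trans (W-cong (λ x → sym (cong₂ _+_ (*-identityˡ (φ x)) (*-identityˡ (χ x)))))
    (trans (W-lin 1ℚ 1ℚ φ χ) (cong₂ _+_ (*-identityˡ (W φ)) (*-identityˡ (W χ))))

  W-scale : ∀ {n} k (φ : Cube n → ℚ) → W (λ x → k * φ x) ≡ k * W φ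
  W-scale k φ = trans (W-cong (λ x → solve 2 (λ k u → k :* u := k :* u :+ con 0ℚ :* u) refl k (φ x)))
    (trans (W-lin k 0ℚ φ φ) (solve 2 (λ k u → k :* u :+ con 0ℚ :* u := k :* u) refl k (W φ)))

  module _ (0≤a : 0ℚ ≤ℚ a) (0≤b : 0ℚ ≤ℚ b) where
    W-mono : ∀ {n} {φ χ : Cube n → ℚ} → (∀ x → φ x ≤ℚ χ x) → W φ ≤ℚ W χ
    W-mono {zero} h = h []
    W-mono {suc n} h = +-mono-≤ (*-monoˡ-nn 0≤a (W-mono (h ∘ (false ∷_)))) (*-monoˡ-nn 0≤b (W-mono (h ∘ (true ∷_))))

    W-nonneg : ∀ {n} {φ : Cube n → ℚ} → (∀ x → 0ℚ ≤ℚ φ x) → 0ℚ ≤ℚ W φ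
    W-nonneg {zero} h = h []
    W-nonneg {suc n} h = +-nonneg (*-nonneg 0≤a (W-nonneg (h ∘ (false ∷_)))) (*-nonneg 0≤b (W-nonneg (h ∘ (true ∷_))))

W-swap : ∀ a b a' b' {m n} (φ : Cube m → Cube n → ℚ) → let open WeightedSum in
  W a b (λ x → W a' b' (φ x)) ≡ W a' b' (λ y → W a b (λ x → φ x y))
W-swap a b a' b' {zero} φ = refl
W-swap a b a' b' {suc m} φ = trans
  (cong₂ (λ u v → a * u + b * v) (W-swap a b a' b' (φ ∘ (false ∷_))) (W-swap a b a' b' (φ ∘ (true ∷_))))
  (sym (WeightedSum.W-lin a' b' a b (λ y → WeightedSum.W a b (λ x → φ (false ∷ x) y)) (λ y → WeightedSum.W a b (λ x → φ (true ∷ x) y))))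

ΣF : ∀ {n} → (Fin n → ℚ) → ℚ
ΣF {zero} f = 0ℚ
ΣF {suc n} f = f zero + ΣF (f ∘ suc)

ΣF-cong : ∀ {n} {f g : Fin n → ℚ} → (∀ i → f i ≡ g i) → ΣF f ≡ ΣF g
ΣF-cong {zero} h = refl
ΣF-cong {suc n} h = cong₂ _+_ (h zero) (ΣF-cong (h ∘ suc))

ΣF-mono : ∀ {n} {f g : Fin n → ℚ} → (∀ i → f i ≤ℚ g i) → ΣF f ≤ℚ ΣF g
ΣF-mono {zero} h = ≤-refl
ΣF-mono {suc n} h = +-mono-≤ (h zero) (ΣF-mono (h ∘ suc))

ΣF-nonneg : ∀ {n} {f : Fin n → ℚ} → (∀ i → 0ℚ ≤ℚ f i) → 0ℚ ≤ℚ ΣF f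
ΣF-nonneg {zero} h = ≤-refl
ΣF-nonneg {suc n} h = +-nonneg (h zero) (ΣF-nonneg (h ∘ suc))

ΣF-lin : ∀ {n} k l (f g : Fin n → ℚ) → ΣF (λ i → k * f i + l * g i) ≡ k * ΣF f + l * ΣF g
ΣF-lin {zero} k l f g = solve 2 (λ k l → con 0ℚ := k :* con 0ℚ :+ l :* con 0ℚ) refl k l
ΣF-lin {suc n} k l f g = trans (cong (k * f zero + l * g zero +_) (ΣF-lin k l (f ∘ suc) (g ∘ suc)))
  (solve 6 (λ k l u v s t → k :* u :+ l :* v :+ (k :* s :+ l :* t) := k :* (u :+ s) :+ l :* (v :+ t)) refl
    k l (f zero) (g zero) (ΣF (f ∘ suc)) (ΣF (g ∘ suc)))

ΣF-scale : ∀ {n} k (f : Fin n → ℚ) → ΣF (λ i → k * f i) ≡ k * ΣF f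
ΣF-scale {zero} k f = sym (*-zeroʳ k)
ΣF-scale {suc n} k f = trans (cong (k * f zero +_) (ΣF-scale k (f ∘ suc))) (sym (*-distribˡ-+ k (f zero) _))

W-ΣF : ∀ a b {m n} (φ : Fin m → Cube n → ℚ) → let open WeightedSum a b in
  ΣF (λ i → W (φ i)) ≡ W (λ x → ΣF (λ i → φ i x))
W-ΣF a b {zero} {zero} φ = refl
W-ΣF a b {zero} {suc n} φ = trans (solve 2 (λ a b → con 0ℚ := a :* con 0ℚ :+ b :* con 0ℚ) refl a b)
  (cong₂ (λ u v → a * u + b * v) (W-ΣF a b {zero} {n} (λ ())) (W-ΣF a b {zero} {n} (λ ())))
W-ΣF a b {suc m} φ = trans (cong (W (φ zero) +_) (W-ΣF a b (φ ∘ suc))) (sym (W-+ (φ zero) _))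
  where open WeightedSum a b

cauchy-schwarz : ∀ {n} (f g : Fin n → ℚ) →
  ΣF (λ i → f i * g i) * ΣF (λ i → f i * g i) ≤ℚ ΣF (λ i → f i * f i) * ΣF (λ i → g i * g i)
cauchy-schwarz {zero} f g = ≤-refl
cauchy-schwarz {suc n} f g = ≤-by gap≥0 (solve 5 (λ a b S A B →
      (a :* b :+ S) :* (a :* b :+ S) :+ ((A :* B :- S :* S) :+ (A :* (b :* b) :+ B :* (a :* a) :- con 2ℚ :* (S :* a :* b)))
      := (a :* a :+ A) :* (b :* b :+ B)) refl a b S A B)
  where
  a = f zero
  b = g zero
  S = ΣF (λ i → f (suc i) * g (suc i))
  A = ΣF (λ i → f (suc i) * f (suc i))
  B = ΣF (λ i → g (suc i) * g (suc i))
  ih : S * S ≤ℚ A * B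
  ih = cauchy-schwarz (f ∘ suc) (g ∘ suc)
  0≤A : 0ℚ ≤ℚ A
  0≤A = ΣF-nonneg (λ i → sq-nonneg (f (suc i)))
  0≤B : 0ℚ ≤ℚ B
  0≤B = ΣF-nonneg (λ i → sq-nonneg (g (suc i)))
  0≤4 : 0ℚ ≤ℚ 4ℚ
  0≤4 = dec≤
  -- From S² ≤ AB: (2Sab)² ≤ 4 (Ab²)(Ba²) ≤ (Ab² + Ba²)², whatever the signs of a, b and S.
  am-gm : 2ℚ * (S * a * b) ≤ℚ A * (b * b) + B * (a * a)
  am-gm = sq-cancel-≤ (+-nonneg (*-nonneg 0≤A (sq-nonneg b)) (*-nonneg 0≤B (sq-nonneg a)))
    (≤-by (+-nonneg (*-nonneg (*-nonneg 0≤4 (*-nonneg (sq-nonneg a) (sq-nonneg b))) (≤⇒0≤- ih)) (sq-nonneg (A * (b * b) - B * (a * a))))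
      (solve 5 (λ a b S A B → (con 2ℚ :* (S :* a :* b)) :* (con 2ℚ :* (S :* a :* b)) :+
        (con 4ℚ :* ((a :* a) :* (b :* b)) :* (A :* B :- S :* S) :+ (A :* (b :* b) :- B :* (a :* a)) :* (A :* (b :* b) :- B :* (a :* a)))
        := (A :* (b :* b) :+ B :* (a :* a)) :* (A :* (b :* b) :+ B :* (a :* a))) refl a b S A B))
  gap≥0 = +-nonneg (≤⇒0≤- ih) (≤⇒0≤- am-gm)

half^ : ℕ → ℚ
half^ zero = 1ℚ
half^ (suc n) = ½ * half^ n

0≤½ : 0ℚ ≤ℚ ½
0≤½ = dec≤

0≤half^ : ∀ n → 0ℚ ≤ℚ half^ n
0≤half^ zero = dec≤
0≤half^ (suc n) = *-nonneg 0≤½ (0≤half^ n)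

half^≤1 : ∀ n → half^ n ≤ℚ 1ℚ
half^≤1 zero = ≤-refl
half^≤1 (suc n) = ≤-trans (*-monoˡ-nn 0≤½ (half^≤1 n)) dec≤

ι-+ : ∀ m n → ι (m ℕ.+ n) ≡ ι m + ι n
ι-+ m n = toℚᵘ-injective (ℚᵘₚ.≃-trans (toℚᵘ-fromℚᵘ (ℚᵘ.mkℚᵘ (ℤ.+ (m ℕ.+ n)) 0)) (ℚᵘₚ.≃-trans
    (ℚᵘ.*≡* (cong (ℤ._* ℤ.+ 1) (trans (ℤₚ.pos-+ m n) (cong₂ ℤ._+_ (sym (ℤₚ.*-identityʳ (ℤ.+ m))) (sym (ℤₚ.*-identityʳ (ℤ.+ n)))))))
    (ℚᵘₚ.≃-trans (ℚᵘₚ.+-cong (ℚᵘₚ.≃-sym (toℚᵘ-fromℚᵘ (ℚᵘ.mkℚᵘ (ℤ.+ m) 0))) (ℚᵘₚ.≃-sym (toℚᵘ-fromℚᵘ (ℚᵘ.mkℚᵘ (ℤ.+ n) 0))))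
      (ℚᵘₚ.≃-sym (toℚᵘ-homo-+ (ι m) (ι n))))))

ι-suc : ∀ n → ι (suc n) ≡ 1ℚ + ι n
ι-suc n = ι-+ 1 n

0≤ι : ∀ n → 0ℚ ≤ℚ ι n
0≤ι zero = ≤-refl
0≤ι (suc n) = subst (0ℚ ≤ℚ_) (sym (ι-suc n)) (+-nonneg (0≤half^ 0) (0≤ι n))

ι-mono : ∀ {m n} → m ≤ n → ι m ≤ℚ ι n
ι-mono {n = n} ℕ.z≤n = 0≤ι n
ι-mono {suc m} {suc n} (ℕ.s≤s h) = subst₂ _≤ℚ_ (sym (ι-suc m)) (sym (ι-suc n)) (+-monoʳ-≤ 1ℚ (ι-mono h))

half^*suc≤1 : ∀ n → half^ n * (1ℚ + ι n) ≤ℚ 1ℚ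
half^*suc≤1 zero = dec≤
half^*suc≤1 (suc n) = ≤-by (+-nonneg (*-nonneg 0≤½ (≤⇒0≤- (half^*suc≤1 n))) (*-nonneg 0≤½ (≤⇒0≤- (half^≤1 n))))
  (trans (cong (λ u → ½ * half^ n * (1ℚ + u) + (½ * (1ℚ - half^ n * (1ℚ + ι n)) + ½ * (1ℚ - half^ n))) (ι-suc n))
    (solve 2 (λ h k → con ½ :* h :* (con 1ℚ :+ (con 1ℚ :+ k)) :+ (con ½ :* (con 1ℚ :- h :* (con 1ℚ :+ k)) :+ con ½ :* (con 1ℚ :- h)) := con 1ℚ) refl (half^ n) (ι n)))

-- Noise and Talagrand's inequality

∂ : ∀ {n} → Fin n → (Cube n → ℚ) → Cube n → ℚ
∂ i φ x = φ (x [ i ]≔ true) - φ (x [ i ]≔ false)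

module Biased (q : ℚ) (0≤q : 0ℚ ≤ℚ q) (0≤1-q : 0ℚ ≤ℚ 1ℚ - q) where

  open WeightedSum (1ℚ - q) q public renaming (W to 𝔼; W-cong to 𝔼-cong; W-lin to 𝔼-lin; W-+ to 𝔼-+; W-scale to 𝔼-scale)

  vq : ℚ
  vq = (1ℚ - q) * q

  0≤vq : 0ℚ ≤ℚ vq
  0≤vq = *-nonneg 0≤1-q 0≤q

  𝔼-mono : ∀ {n} {φ χ : Cube n → ℚ} → (∀ x → φ x ≤ℚ χ x) → 𝔼 φ ≤ℚ 𝔼 χ
  𝔼-mono = W-mono 0≤1-q 0≤q

  mean diff : ∀ {n} → (Cube (suc n) → ℚ) → Cube n → ℚ
  mean φ y = (1ℚ - q) * φ (false ∷ y) + q * φ (true ∷ y)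
  diff φ y = φ (true ∷ y) - φ (false ∷ y)

  𝔼-mean : ∀ {n} (φ : Cube (suc n) → ℚ) → 𝔼 (mean φ) ≡ 𝔼 φ
  𝔼-mean φ = 𝔼-lin (1ℚ - q) q (φ ∘ (false ∷_)) (φ ∘ (true ∷_))

  𝔼-const : ∀ {n} k → 𝔼 {n} (λ _ → k) ≡ k
  𝔼-const {zero} k = refl
  𝔼-const {suc n} k = trans (cong (λ u → (1ℚ - q) * u + q * u) (𝔼-const {n} k))
    (solve 2 (λ q k → (con 1ℚ :- q) :* k :+ q :* k := k) refl q k)

  𝔼-split : ∀ {n} (i : Fin n) (φ : Cube n → ℚ) →
    𝔼 φ ≡ 𝔼 (λ x → (1ℚ - q) * φ (x [ i ]≔ false) + q * φ (x [ i ]≔ true))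
  𝔼-split zero φ = trans (sym (𝔼-mean φ))
    (solve 2 (λ q k → k := (con 1ℚ :- q) :* k :+ q :* k) refl q (𝔼 (mean φ)))
  𝔼-split (suc i) φ = cong₂ (λ u v → (1ℚ - q) * u + q * v) (𝔼-split i (φ ∘ (false ∷_))) (𝔼-split i (φ ∘ (true ∷_)))

  mix : ∀ {n} → ℚ → Bool → (Cube (suc n) → ℚ) → Cube n → ℚ
  mix p c φ y = (1ℚ - p) * φ (c ∷ y) + p * mean φ y

  -- Each coordinate is kept with probability 1 - p and resampled with probability p.
  noise : ∀ {n} → ℚ → (Cube n → ℚ) → Cube n → ℚ
  noise {zero} p φ [] = φ []
  noise {suc n} p φ (c ∷ x) = noise p (mix p c φ) x

  mix-cong : ∀ {n} p c {φ χ : Cube (suc n) → ℚ} → (∀ x → φ x ≡ χ x) → ∀ y → mix p c φ y ≡ mix p c χ y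
  mix-cong p c h y = cong₂ (λ u v → (1ℚ - p) * u + p * v) (h (c ∷ y))
    (cong₂ (λ u v → (1ℚ - q) * u + q * v) (h (false ∷ y)) (h (true ∷ y)))

  noise-cong : ∀ {n} p {φ χ : Cube n → ℚ} → (∀ x → φ x ≡ χ x) → ∀ x → noise p φ x ≡ noise p χ x
  noise-cong p h [] = h []
  noise-cong p h (c ∷ x) = noise-cong p (mix-cong p c h) x

  noise-lin : ∀ {n} p k l (φ χ : Cube n → ℚ) x → noise p (λ y → k * φ y + l * χ y) x ≡ k * noise p φ x + l * noise p χ x
  noise-lin p k l φ χ [] = refl
  noise-lin p k l φ χ (c ∷ x) = trans (noise-cong p mix-lin x) (noise-lin p k l (mix p c φ) (mix p c χ) x)
    where
    mix-lin : ∀ y → mix p c (λ z → k * φ z + l * χ z) y ≡ k * mix p c φ y + l * mix p c χ y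
    mix-lin y = solve 10 (λ q p k l u v u0 v0 u1 v1 →
      (con 1ℚ :- p) :* (k :* u :+ l :* v) :+ p :* ((con 1ℚ :- q) :* (k :* u0 :+ l :* v0) :+ q :* (k :* u1 :+ l :* v1))
      := k :* ((con 1ℚ :- p) :* u :+ p :* ((con 1ℚ :- q) :* u0 :+ q :* u1)) :+ l :* ((con 1ℚ :- p) :* v :+ p :* ((con 1ℚ :- q) :* v0 :+ q :* v1))) refl
      q p k l (φ (c ∷ y)) (χ (c ∷ y)) (φ (false ∷ y)) (χ (false ∷ y)) (φ (true ∷ y)) (χ (true ∷ y))

  noise-const : ∀ {n} p k (x : Cube n) → noise p (λ _ → k) x ≡ k
  noise-const p k [] = refl
  noise-const p k (c ∷ x) = trans (noise-cong p (λ y → solve 3 (λ q p k → (con 1ℚ :- p) :* k :+ p :* ((con 1ℚ :- q) :* k :+ q :* k) := k) refl q p k) x)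
    (noise-const p k x)

  noise-mono : ∀ {n} {p} → 0ℚ ≤ℚ p → 0ℚ ≤ℚ 1ℚ - p → {φ χ : Cube n → ℚ} → (∀ x → φ x ≤ℚ χ x) → ∀ x → noise p φ x ≤ℚ noise p χ x
  noise-mono 0≤p 0≤1-p h [] = h []
  noise-mono 0≤p 0≤1-p h (c ∷ x) = noise-mono 0≤p 0≤1-p (λ y →
    +-mono-≤ (*-monoˡ-nn 0≤1-p (h (c ∷ y)))
      (*-monoˡ-nn 0≤p (+-mono-≤ (*-monoˡ-nn 0≤1-q (h (false ∷ y))) (*-monoˡ-nn 0≤q (h (true ∷ y)))))) x

  noise-0 : ∀ {n} (φ : Cube n → ℚ) x → noise 0ℚ φ x ≡ φ x
  noise-0 φ [] = refl
  noise-0 φ (c ∷ x) = trans (noise-0 (mix 0ℚ c φ) x)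
    (solve 2 (λ u m → (con 1ℚ :- con 0ℚ) :* u :+ con 0ℚ :* m := u) refl (φ (c ∷ x)) (mean φ x))

  noise-1 : ∀ {n} (φ : Cube n → ℚ) x → noise 1ℚ φ x ≡ 𝔼 φ
  noise-1 φ [] = refl
  noise-1 φ (c ∷ x) = trans (noise-cong 1ℚ (λ y → solve 2 (λ u m → (con 1ℚ :- con 1ℚ) :* u :+ con 1ℚ :* m := m) refl (φ (c ∷ y)) (mean φ y)) x)
    (trans (noise-1 (mean φ) x) (𝔼-mean φ))

  noise-∂-zero : ∀ {n} p (φ : Cube (suc n) → ℚ) c x → noise p (∂ zero φ) (c ∷ x) ≡ noise p (diff φ) x
  noise-∂-zero p φ c x = noise-cong p (λ y → solve 3 (λ q p k → (con 1ℚ :- p) :* k :+ p :* ((con 1ℚ :- q) :* k :+ q :* k) := k) refl q p (diff φ y)) x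

  noise-∂-suc : ∀ {n} p (φ : Cube (suc n) → ℚ) i c x → noise p (∂ (suc i) φ) (c ∷ x) ≡ noise p (∂ i (mix p c φ)) x
  noise-∂-suc p φ i c x = noise-cong p (λ y → solve 8 (λ q p u u0 u1 v v0 v1 →
      (con 1ℚ :- p) :* (u :- v) :+ p :* ((con 1ℚ :- q) :* (u0 :- v0) :+ q :* (u1 :- v1))
      := (con 1ℚ :- p) :* u :+ p :* ((con 1ℚ :- q) :* u0 :+ q :* u1) :- ((con 1ℚ :- p) :* v :+ p :* ((con 1ℚ :- q) :* v0 :+ q :* v1))) refl
      q p (φ (c ∷ y [ i ]≔ true)) (φ (false ∷ y [ i ]≔ true)) (φ (true ∷ y [ i ]≔ true))
          (φ (c ∷ y [ i ]≔ false)) (φ (false ∷ y [ i ]≔ false)) (φ (true ∷ y [ i ]≔ false))) x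

  noise-∂-indep : ∀ {n} p (φ : Cube n → ℚ) i b x → noise p (∂ i φ) (x [ i ]≔ b) ≡ noise p (∂ i φ) x
  noise-∂-indep p φ zero b (c ∷ x) = trans (noise-∂-zero p φ b x) (sym (noise-∂-zero p φ c x))
  noise-∂-indep p φ (suc i) b (c ∷ x) = trans (noise-∂-suc p φ i c (x [ i ]≔ b))
    (trans (noise-∂-indep p (mix p c φ) i b x) (sym (noise-∂-suc p φ i c x)))

  -- Noise started at `x` draws a point with independent coordinates, each of variance at least
  -- `p * vq`, and `noise p (∂ i φ) x` is the coefficient of `φ` on the centred coordinate i under
  -- that law. So this is Bessel's inequality for the constant and linear terms.
  noise-level-one : ∀ {n} {p} → 0ℚ ≤ℚ p → 0ℚ ≤ℚ 1ℚ - p → (φ : Cube n → ℚ) → ∀ x →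
    p * vq * ΣF (λ i → noise p (∂ i φ) x * noise p (∂ i φ) x) + noise p φ x * noise p φ x ≤ℚ noise p (λ y → φ y * φ y) x
  noise-level-one {p = p} 0≤p 0≤1-p φ [] = ≤-reflexive (solve 2 (λ a b → a :* con 0ℚ :+ b := b) refl (p * vq) (φ [] * φ []))
  noise-level-one {suc n} {p} 0≤p 0≤1-p φ (c ∷ x) = begin
    p * vq * ΣF (λ i → noise p (∂ i φ) (c ∷ x) * noise p (∂ i φ) (c ∷ x)) + noise p φ (c ∷ x) * noise p φ (c ∷ x)
      ≡⟨ cong (λ s → p * vq * s + noise p k x * noise p k x)
           (cong₂ _+_ (cong (λ u → u * u) (noise-∂-zero p φ c x)) (ΣF-cong (λ i → cong (λ u → u * u) (noise-∂-suc p φ i c x)))) ⟩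
    p * vq * (noise p d x * noise p d x + S) + noise p k x * noise p k x
      ≡⟨ solve 4 (λ a u s v → a :* (u :+ s) :+ v := a :* u :+ (a :* s :+ v)) refl (p * vq) (noise p d x * noise p d x) S (noise p k x * noise p k x) ⟩
    p * vq * (noise p d x * noise p d x) + (p * vq * S + noise p k x * noise p k x)
      ≤⟨ +-mono-≤ (*-monoˡ-nn 0≤pvq jensen) (noise-level-one 0≤p 0≤1-p k x) ⟩
    p * vq * noise p (λ y → d y * d y) x + noise p (λ y → k y * k y) x
      ≡⟨ solve 2 (λ u v → u :+ v := u :+ con 1ℚ :* v) refl (p * vq * noise p (λ y → d y * d y) x) (noise p (λ y → k y * k y) x) ⟩
    p * vq * noise p (λ y → d y * d y) x + 1ℚ * noise p (λ y → k y * k y) x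
      ≡⟨ noise-lin p (p * vq) 1ℚ (λ y → d y * d y) (λ y → k y * k y) x ⟨
    noise p (λ y → p * vq * (d y * d y) + 1ℚ * (k y * k y)) x
      ≤⟨ noise-mono 0≤p 0≤1-p (pointwise c) x ⟩
    noise p (λ y → φ y * φ y) (c ∷ x) ∎
    where
    open ≤-Reasoning
    k d : Cube n → ℚ
    k = mix p c φ
    d = diff φ
    S = ΣF (λ i → noise p (∂ i k) x * noise p (∂ i k) x)
    0≤pvq : 0ℚ ≤ℚ p * vq
    0≤pvq = *-nonneg 0≤p 0≤vq
    -- Jensen comes for free: drop the nonnegative sum from the induction hypothesis for `d`.
    jensen : noise p d x * noise p d x ≤ℚ noise p (λ y → d y * d y) x
    jensen = ≤-trans (≤-by (*-nonneg 0≤pvq (ΣF-nonneg (λ i → sq-nonneg (noise p (∂ i d) x)))) (+-comm (noise p d x * noise p d x) (p * vq * ΣF (λ i → noise p (∂ i d) x * noise p (∂ i d) x)))) (noise-level-one 0≤p 0≤1-p d x)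
    pointwise : ∀ c y → p * vq * (d y * d y) + 1ℚ * (mix p c φ y * mix p c φ y) ≤ℚ mix p c (λ z → φ z * φ z) y
    pointwise false y = ≤-by (*-nonneg (*-nonneg 0≤p 0≤1-p) (sq-nonneg (φ (false ∷ y) - mean φ y)))
      (solve 4 (λ q p a b → let m = (con 1ℚ :- q) :* a :+ q :* b ; k = (con 1ℚ :- p) :* a :+ p :* m in
        p :* ((con 1ℚ :- q) :* q) :* ((b :- a) :* (b :- a)) :+ con 1ℚ :* (k :* k) :+ p :* (con 1ℚ :- p) :* ((a :- m) :* (a :- m))
        := (con 1ℚ :- p) :* (a :* a) :+ p :* ((con 1ℚ :- q) :* (a :* a) :+ q :* (b :* b))) refl
        q p (φ (false ∷ y)) (φ (true ∷ y)))
    pointwise true y = ≤-by (*-nonneg (*-nonneg 0≤p 0≤1-p) (sq-nonneg (φ (true ∷ y) - mean φ y)))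
      (solve 4 (λ q p a b → let m = (con 1ℚ :- q) :* a :+ q :* b ; k = (con 1ℚ :- p) :* b :+ p :* m in
        p :* ((con 1ℚ :- q) :* q) :* ((b :- a) :* (b :- a)) :+ con 1ℚ :* (k :* k) :+ p :* (con 1ℚ :- p) :* ((b :- m) :* (b :- m))
        := (con 1ℚ :- p) :* (b :* b) :+ p :* ((con 1ℚ :- q) :* (a :* a) :+ q :* (b :* b))) refl
        q p (φ (false ∷ y)) (φ (true ∷ y)))

  stability : ∀ {n} → ℚ → (Cube n → ℚ) → ℚ
  stability p φ = 𝔼 (λ x → φ x * noise p φ x)

  influence : ∀ {n} → ℚ → (Cube n → ℚ) → ℚ
  influence p φ = ΣF (λ i → stability p (∂ i φ))

  stability-cong : ∀ {n} p {φ χ : Cube n → ℚ} → (∀ x → φ x ≡ χ x) → stability p φ ≡ stability p χ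
  stability-cong p h = 𝔼-cong (λ x → cong₂ _*_ (h x) (noise-cong p h x))

  -- With z the head bit, `φ` is `mean φ` plus (z - q) times `diff φ`. The two terms are orthogonal,
  -- z - q has variance `vq`, and noise multiplies the second term by 1 - p.
  stability-suc : ∀ {n} p (φ : Cube (suc n) → ℚ) → stability p φ ≡ stability p (mean φ) + (1ℚ - p) * vq * stability p (diff φ)
  stability-suc {n} p φ = begin
    (1ℚ - q) * 𝔼 (λ x → φ (false ∷ x) * noise p (mix p false φ) x) + q * 𝔼 (λ x → φ (true ∷ x) * noise p (mix p true φ) x)
      ≡⟨ 𝔼-lin (1ℚ - q) q (λ x → φ (false ∷ x) * noise p (mix p false φ) x) (λ x → φ (true ∷ x) * noise p (mix p true φ) x) ⟨
    𝔼 (λ x → (1ℚ - q) * (φ (false ∷ x) * noise p (mix p false φ) x) + q * (φ (true ∷ x) * noise p (mix p true φ) x))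
      ≡⟨ 𝔼-cong pointwise ⟩
    𝔼 (λ x → 1ℚ * (m x * noise p m x) + (1ℚ - p) * vq * (d x * noise p d x))
      ≡⟨ 𝔼-lin 1ℚ ((1ℚ - p) * vq) (λ x → m x * noise p m x) (λ x → d x * noise p d x) ⟩
    1ℚ * stability p m + (1ℚ - p) * vq * stability p d
      ≡⟨ cong (_+ (1ℚ - p) * vq * stability p d) (*-identityˡ (stability p m)) ⟩
    stability p m + (1ℚ - p) * vq * stability p d ∎
    where
    open ≡-Reasoning
    m d : Cube n → ℚ
    m = mean φ
    d = diff φ
    noise-mix-false : ∀ x → noise p (mix p false φ) x ≡ 1ℚ * noise p m x + - ((1ℚ - p) * q) * noise p d x
    noise-mix-false x = trans (noise-cong p (λ y → solve 4 (λ q p a b → let m = (con 1ℚ :- q) :* a :+ q :* b in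
      (con 1ℚ :- p) :* a :+ p :* m := con 1ℚ :* m :+ :- ((con 1ℚ :- p) :* q) :* (b :- a)) refl q p (φ (false ∷ y)) (φ (true ∷ y))) x)
      (noise-lin p 1ℚ (- ((1ℚ - p) * q)) m d x)
    noise-mix-true : ∀ x → noise p (mix p true φ) x ≡ 1ℚ * noise p m x + (1ℚ - p) * (1ℚ - q) * noise p d x
    noise-mix-true x = trans (noise-cong p (λ y → solve 4 (λ q p a b → let m = (con 1ℚ :- q) :* a :+ q :* b in
      (con 1ℚ :- p) :* b :+ p :* m := con 1ℚ :* m :+ (con 1ℚ :- p) :* (con 1ℚ :- q) :* (b :- a)) refl q p (φ (false ∷ y)) (φ (true ∷ y))) x)
      (noise-lin p 1ℚ ((1ℚ - p) * (1ℚ - q)) m d x)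
    pointwise : ∀ x → (1ℚ - q) * (φ (false ∷ x) * noise p (mix p false φ) x) + q * (φ (true ∷ x) * noise p (mix p true φ) x)
      ≡ 1ℚ * (m x * noise p m x) + (1ℚ - p) * vq * (d x * noise p d x)
    pointwise x = trans
      (cong₂ (λ u v → (1ℚ - q) * (φ (false ∷ x) * u) + q * (φ (true ∷ x) * v)) (noise-mix-false x) (noise-mix-true x))
      (solve 6 (λ q p a b Nm Nd → let m = (con 1ℚ :- q) :* a :+ q :* b in
        (con 1ℚ :- q) :* (a :* (con 1ℚ :* Nm :+ :- ((con 1ℚ :- p) :* q) :* Nd)) :+ q :* (b :* (con 1ℚ :* Nm :+ (con 1ℚ :- p) :* (con 1ℚ :- q) :* Nd))
        := con 1ℚ :* (m :* Nm) :+ (con 1ℚ :- p) :* ((con 1ℚ :- q) :* q) :* ((b :- a) :* Nd)) refl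
        q p (φ (false ∷ x)) (φ (true ∷ x)) (noise p m x) (noise p d x))

  influence-suc : ∀ {n} p (φ : Cube (suc n) → ℚ) → influence p φ ≡ stability p (diff φ) + (influence p (mean φ) + (1ℚ - p) * vq * influence p (diff φ))
  influence-suc p φ = cong₂ _+_ head tail
    where
    head : stability p (∂ zero φ) ≡ stability p (diff φ)
    head = trans (cong₂ (λ u v → (1ℚ - q) * u + q * v)
        (𝔼-cong (λ x → cong (diff φ x *_) (noise-∂-zero p φ false x))) (𝔼-cong (λ x → cong (diff φ x *_) (noise-∂-zero p φ true x))))
      (solve 2 (λ q k → (con 1ℚ :- q) :* k :+ q :* k := k) refl q (stability p (diff φ)))
    mean-∂ : ∀ i y → mean (∂ (suc i) φ) y ≡ ∂ i (mean φ) y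
    mean-∂ i y = solve 5 (λ q a b a' b' → (con 1ℚ :- q) :* (a :- a') :+ q :* (b :- b')
      := (con 1ℚ :- q) :* a :+ q :* b :- ((con 1ℚ :- q) :* a' :+ q :* b')) refl
      q (φ (false ∷ y [ i ]≔ true)) (φ (true ∷ y [ i ]≔ true)) (φ (false ∷ y [ i ]≔ false)) (φ (true ∷ y [ i ]≔ false))
    diff-∂ : ∀ i y → diff (∂ (suc i) φ) y ≡ ∂ i (diff φ) y
    diff-∂ i y = solve 4 (λ a b a' b' → (b :- b') :- (a :- a') := (b :- a) :- (b' :- a')) refl
      (φ (false ∷ y [ i ]≔ true)) (φ (true ∷ y [ i ]≔ true)) (φ (false ∷ y [ i ]≔ false)) (φ (true ∷ y [ i ]≔ false))
    tail : ΣF (λ i → stability p (∂ (suc i) φ)) ≡ influence p (mean φ) + (1ℚ - p) * vq * influence p (diff φ)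
    tail = trans (ΣF-cong (λ i → trans (stability-suc p (∂ (suc i) φ))
        (cong₂ _+_ (trans (stability-cong p (mean-∂ i)) (sym (*-identityˡ (stability p (∂ i (mean φ))))))
                   (cong ((1ℚ - p) * vq *_) (stability-cong p (diff-∂ i))))))
      (trans (ΣF-lin 1ℚ ((1ℚ - p) * vq) (λ i → stability p (∂ i (mean φ))) (λ i → stability p (∂ i (diff φ))))
        (cong (_+ (1ℚ - p) * vq * influence p (diff φ)) (*-identityˡ (influence p (mean φ)))))

  stability-nonneg : ∀ {n} {p} → 0ℚ ≤ℚ 1ℚ - p → (φ : Cube n → ℚ) → 0ℚ ≤ℚ stability p φ
  stability-nonneg {zero} 0≤1-p φ = sq-nonneg (φ [])
  stability-nonneg {suc n} {p} 0≤1-p φ = subst (0ℚ ≤ℚ_) (sym (stability-suc p φ))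
    (+-nonneg (stability-nonneg 0≤1-p (mean φ)) (*-nonneg (*-nonneg 0≤1-p 0≤vq) (stability-nonneg 0≤1-p (diff φ))))

  -- ρ ↦ stability (1 - ρ) φ is a polynomial with nonnegative coefficients, hence convex; vq * influence is its derivative.
  stability-step : ∀ {n} {p p'} → p' ≤ℚ p → 0ℚ ≤ℚ 1ℚ - p → (φ : Cube n → ℚ) → stability p' φ ≤ℚ stability p φ + (p - p') * vq * influence p' φ
  stability-step {zero} {p} {p'} p'≤p 0≤1-p φ = ≤-reflexive (solve 2 (λ a b → a := a :+ b :* con 0ℚ) refl (φ [] * φ []) ((p - p') * vq))
  stability-step {suc n} {p} {p'} p'≤p 0≤1-p φ = subst₂ (λ u v → u ≤ℚ v + (p - p') * vq * influence p' φ) (sym (stability-suc p' φ)) (sym (stability-suc p φ))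
    (subst (λ t → stability p' m + (1ℚ - p') * vq * stability p' d ≤ℚ stability p m + (1ℚ - p) * vq * stability p d + (p - p') * vq * t) (sym (influence-suc p' φ))
      (≤-by (+-nonneg (≤⇒0≤- (stability-step p'≤p 0≤1-p m))
              (+-nonneg (*-nonneg (*-nonneg 0≤1-p 0≤vq) (≤⇒0≤- (stability-step p'≤p 0≤1-p d)))
                (*-nonneg (*-nonneg (*-nonneg gap gap) (*-nonneg 0≤vq 0≤vq)) (ΣF-nonneg (λ i → stability-nonneg 0≤1-p' (∂ i d))))))
        (solve 9 (λ p p' w Mm' Mm Md' Md Tm Td →
          Mm' :+ (con 1ℚ :- p') :* w :* Md' :+
          ((Mm :+ (p :- p') :* w :* Tm :- Mm') :+ ((con 1ℚ :- p) :* w :* (Md :+ (p :- p') :* w :* Td :- Md') :+ (p :- p') :* (p :- p') :* (w :* w) :* Td))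
          := Mm :+ (con 1ℚ :- p) :* w :* Md :+ (p :- p') :* w :* (Md' :+ (Tm :+ (con 1ℚ :- p') :* w :* Td))) refl
          p p' vq (stability p' m) (stability p m) (stability p' d) (stability p d) (influence p' m) (influence p' d))))
    where
    m d : Cube n → ℚ
    m = mean φ
    d = diff φ
    gap : 0ℚ ≤ℚ p - p'
    gap = ≤⇒0≤- p'≤p
    0≤1-p' : 0ℚ ≤ℚ 1ℚ - p'
    0≤1-p' = subst (0ℚ ≤ℚ_) (solve 2 (λ p p' → (con 1ℚ :- p) :+ (p :- p') := con 1ℚ :- p') refl p p') (+-nonneg 0≤1-p gap)

  vq≤1 : vq ≤ℚ 1ℚ
  vq≤1 = ≤-by (+-nonneg (*-nonneg 0≤q 0≤q) 0≤1-q) (solve 1 (λ q → (con 1ℚ :- q) :* q :+ (q :* q :+ (con 1ℚ :- q)) := con 1ℚ) refl q)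

  -- `v` distributes each derivative over the two ends of its edge, keeping the biased average; an
  -- edge can thus be paid for at one end. `y` bounds the Euclidean length of the vector `v` at each
  -- point.
  module _ {n} (φ : Cube n → ℚ) (0≤φ : ∀ x → 0ℚ ≤ℚ φ x) (φ≤1 : ∀ x → φ x ≤ℚ 1ℚ)
    (v : Fin n → Cube n → ℚ)
    (v-avg : ∀ i x → (1ℚ - q) * v i (x [ i ]≔ false) + q * v i (x [ i ]≔ true) ≡ ∂ i φ x)
    (y : Cube n → ℚ) (0≤y : ∀ x → 0ℚ ≤ℚ y x)
    (v≤y : ∀ x → ΣF (λ i → v i x * v i x) ≤ℚ y x * y x) where

    private
      ∂-indep : ∀ {n} (φ : Cube n → ℚ) i b x → ∂ i φ (x [ i ]≔ b) ≡ ∂ i φ x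
      ∂-indep φ zero b (c ∷ x) = refl
      ∂-indep φ (suc i) b (c ∷ x) = ∂-indep (φ ∘ (c ∷_)) i b x

    -- `noise p (∂ i φ)` does not depend on coordinate i, so the factor paired with it matters only
    -- through its average in direction i, and there `v i` and `∂ i φ` agree.
    influence-dual : ∀ p → influence p φ ≡ 𝔼 (λ x → ΣF (λ i → v i x * noise p (∂ i φ) x))
    influence-dual p = trans (ΣF-cong stability-dual) (W-ΣF (1ℚ - q) q (λ i x → v i x * noise p (∂ i φ) x))
      where
      stability-dual : ∀ i → stability p (∂ i φ) ≡ 𝔼 (λ x → v i x * noise p (∂ i φ) x)
      stability-dual i = sym (trans (𝔼-split i (λ x → v i x * noise p (∂ i φ) x)) (𝔼-cong (λ x → trans
        (cong₂ (λ s t → (1ℚ - q) * (v i (x [ i ]≔ false) * s) + q * (v i (x [ i ]≔ true) * t)) (noise-∂-indep p φ i false x) (noise-∂-indep p φ i true x))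
        (trans (solve 4 (λ q s t u → (con 1ℚ :- q) :* (s :* u) :+ q :* (t :* u) := ((con 1ℚ :- q) :* s :+ q :* t) :* u) refl
            q (v i (x [ i ]≔ false)) (v i (x [ i ]≔ true)) (noise p (∂ i φ) x))
          (cong (_* noise p (∂ i φ) x) (v-avg i x))))))

    influence-bound : ∀ p a c → 0ℚ ≤ℚ a → 0ℚ ≤ℚ c →
      (∀ x → a * (a * ΣF (λ i → noise p (∂ i φ) x * noise p (∂ i φ) x)) ≤ℚ c * c) →
      a * influence p φ ≤ℚ c * 𝔼 y
    influence-bound p a c 0≤a 0≤c h = subst₂ _≤ℚ_
      (trans (𝔼-scale a (λ x → ΣF (λ i → v i x * noise p (∂ i φ) x))) (cong (a *_) (sym (influence-dual p)))) (𝔼-scale c y) (𝔼-mono pointwise)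
      where
      pointwise : ∀ x → a * ΣF (λ i → v i x * noise p (∂ i φ) x) ≤ℚ c * y x
      pointwise x = sq-cancel-≤ (*-nonneg 0≤c (0≤y x)) (begin
        a * S * (a * S) ≡⟨ solve 2 (λ a S → a :* S :* (a :* S) := a :* a :* (S :* S)) refl a S ⟩
        a * a * (S * S) ≤⟨ *-monoˡ-nn (sq-nonneg a) (cauchy-schwarz (λ i → v i x) (λ i → noise p (∂ i φ) x)) ⟩
        a * a * (V * B) ≡⟨ solve 3 (λ a V B → a :* a :* (V :* B) := V :* (a :* (a :* B))) refl a V B ⟩
        V * (a * (a * B)) ≤⟨ *-mono-nn (ΣF-nonneg (λ i → sq-nonneg (v i x))) (sq-nonneg c) (v≤y x) (h x) ⟩
        y x * y x * (c * c) ≡⟨ solve 2 (λ y c → y :* y :* (c :* c) := c :* y :* (c :* y)) refl (y x) c ⟩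
        c * y x * (c * y x) ∎)
        where
        open ≤-Reasoning
        S V B : ℚ
        S = ΣF (λ i → v i x * noise p (∂ i φ) x)
        V = ΣF (λ i → v i x * v i x)
        B = ΣF (λ i → noise p (∂ i φ) x * noise p (∂ i φ) x)

    private
      0≤1 : 0ℚ ≤ℚ 1ℚ
      0≤1 = 0≤half^ 0
      p^ : ℕ → ℚ
      p^ j = half^ j * half^ j
      0≤p^ : ∀ j → 0ℚ ≤ℚ p^ j
      0≤p^ j = sq-nonneg (half^ j)
      p^≤1 : ∀ j → p^ j ≤ℚ 1ℚ
      p^≤1 j = *-mono-nn (0≤half^ j) 0≤1 (half^≤1 j) (half^≤1 j)

      φ²≤1 : ∀ x → φ x * φ x ≤ℚ 1ℚ
      φ²≤1 x = *-mono-nn (0≤φ x) 0≤1 (φ≤1 x) (φ≤1 x)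

    -- By `noise-level-one` and φ² ≤ 1, `p^ j * vq` times the squared length of the smoothed
    -- gradient is at most 1. The second factor `p^ j * vq` leaves at most `p^ j`, a square of the
    -- rational `half^ j`; hence powers of 4 as scales.
    influence-scale : ∀ j → p^ j * vq * influence (p^ j) φ ≤ℚ half^ j * 𝔼 y
    influence-scale j = influence-bound (p^ j) (p^ j * vq) (half^ j) 0≤a (0≤half^ j) (λ x → begin
        p^ j * vq * (p^ j * vq * B x) ≤⟨ *-monoˡ-nn 0≤a (≤-trans (≤-by (sq-nonneg (noise (p^ j) φ x)) refl)
           (≤-trans (noise-level-one (0≤p^ j) (≤⇒0≤- (p^≤1 j)) φ x)
             (≤-trans (noise-mono (0≤p^ j) (≤⇒0≤- (p^≤1 j)) φ²≤1 x) (≤-reflexive (noise-const (p^ j) 1ℚ x))))) ⟩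
        p^ j * vq * 1ℚ ≤⟨ *-monoʳ-nn 0≤1 (*-monoˡ-nn (0≤p^ j) vq≤1) ⟩
        p^ j * 1ℚ * 1ℚ ≡⟨ solve 1 (λ p → p :* con 1ℚ :* con 1ℚ := p) refl (p^ j) ⟩
        p^ j ∎)
      where
      open ≤-Reasoning
      B : Cube n → ℚ
      B x = ΣF (λ i → noise (p^ j) (∂ i φ) x * noise (p^ j) (∂ i φ) x)
      0≤a : 0ℚ ≤ℚ p^ j * vq
      0≤a = *-nonneg (0≤p^ j) 0≤vq

    private
      -- The step from 4^-j to 4^-(j+1) has length 3 · 4^-(j+1), so it releases at most 3 · 2^-(j+1)
      -- times `𝔼 y`; these terms sum to 3 (1 - 2^-j).
      stability-telescope : ∀ j → stability (p^ j) φ ≤ℚ stability 1ℚ φ + 3ℚ * (1ℚ - half^ j) * 𝔼 y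
      stability-telescope zero = ≤-reflexive (solve 2 (λ m e → m := m :+ con 3ℚ :* (con 1ℚ :- con 1ℚ) :* e) refl (stability 1ℚ φ) (𝔼 y))
      stability-telescope (suc j) = ≤-trans (stability-step {p = p^ j} {p' = p^ (suc j)} p'≤p (≤⇒0≤- (p^≤1 j)) φ)
        (≤-by (+-nonneg (≤⇒0≤- (stability-telescope j)) (*-nonneg 0≤3 (≤⇒0≤- (influence-scale (suc j)))))
          (solve 6 (λ h w t m m1 e → let p' = con ½ :* h :* (con ½ :* h) in
            m :+ (h :* h :- p') :* w :* t :+ ((m1 :+ con 3ℚ :* (con 1ℚ :- h) :* e :- m) :+ con 3ℚ :* (con ½ :* h :* e :- p' :* w :* t))
            := m1 :+ con 3ℚ :* (con 1ℚ :- con ½ :* h) :* e) refl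
            (half^ j) vq (influence (p^ (suc j)) φ) (stability (p^ j) φ) (stability 1ℚ φ) (𝔼 y)))
        where
        0≤3 : 0ℚ ≤ℚ 3ℚ
        0≤3 = dec≤
        h≤ : ½ * half^ j ≤ℚ half^ j
        h≤ = ≤-by (*-nonneg 0≤½ (0≤half^ j)) (solve 1 (λ h → con ½ :* h :+ con ½ :* h := h) refl (half^ j))
        p'≤p : p^ (suc j) ≤ℚ p^ j
        p'≤p = *-mono-nn (0≤half^ (suc j)) (0≤half^ j) h≤ h≤

      ∂²≤1 : ∀ i x → ∂ i φ x * ∂ i φ x ≤ℚ 1ℚ
      ∂²≤1 i x = ≤-by (*-nonneg (+-nonneg 0≤a' 0≤b) (+-nonneg 0≤b' 0≤a))
          (solve 2 (λ a b → (a :- b) :* (a :- b) :+ ((con 1ℚ :- a) :+ b) :* ((con 1ℚ :- b) :+ a) := con 1ℚ) refl a b)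
        where
        a b : ℚ
        a = φ (x [ i ]≔ true)
        b = φ (x [ i ]≔ false)
        0≤a = 0≤φ (x [ i ]≔ true)
        0≤b = 0≤φ (x [ i ]≔ false)
        0≤a' = ≤⇒0≤- (φ≤1 (x [ i ]≔ true))
        0≤b' = ≤⇒0≤- (φ≤1 (x [ i ]≔ false))

      ΣF-ones : ∀ m (f : Fin m → ℚ) → (∀ i → f i ≤ℚ 1ℚ) → ΣF f ≤ℚ ι m
      ΣF-ones zero f h = ≤-refl
      ΣF-ones (suc m) f h = subst (ΣF f ≤ℚ_) (sym (ι-suc m)) (+-mono-≤ (h zero) (ΣF-ones m (f ∘ suc) (h ∘ suc)))

      -- The geometric scales never reach p = 0. Below 4^-n the trivial bound n for the squared
      -- gradient suffices, because 4^-n · n ≤ 1. This last step adds 1 to the 3 of the telescope,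
      -- whence the 4 in `variance-bound`.
      influence-tail : p^ n * vq * influence 0ℚ φ ≤ℚ 1ℚ * 𝔼 y
      influence-tail = influence-bound 0ℚ a 1ℚ 0≤a 0≤1 (λ x → *-mono-nn 0≤a 0≤1 a≤1 (≤-trans (*-monoˡ-nn 0≤a (B≤n x)) an≤1))
        where
        open ≤-Reasoning
        a : ℚ
        a = p^ n * vq
        0≤a : 0ℚ ≤ℚ a
        0≤a = *-nonneg (0≤p^ n) 0≤vq
        a≤p : a ≤ℚ p^ n
        a≤p = subst (a ≤ℚ_) (*-identityʳ (p^ n)) (*-monoˡ-nn (0≤p^ n) vq≤1)
        a≤1 : a ≤ℚ 1ℚ
        a≤1 = ≤-trans a≤p (p^≤1 n)
        B≤n : ∀ x → ΣF (λ i → noise 0ℚ (∂ i φ) x * noise 0ℚ (∂ i φ) x) ≤ℚ ι n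
        B≤n x = ΣF-ones n (λ i → noise 0ℚ (∂ i φ) x * noise 0ℚ (∂ i φ) x)
          (λ i → subst (λ u → u * u ≤ℚ 1ℚ) (sym (noise-0 (∂ i φ) x)) (∂²≤1 i x))
        an≤1 : a * ι n ≤ℚ 1ℚ
        an≤1 = begin
          a * ι n ≤⟨ *-monoʳ-nn (0≤ι n) a≤p ⟩
          p^ n * ι n ≡⟨ *-assoc (half^ n) (half^ n) (ι n) ⟩
          half^ n * (half^ n * ι n) ≤⟨ *-mono-nn (0≤half^ n) 0≤1 (half^≤1 n)
             (≤-trans (*-monoˡ-nn (0≤half^ n) (≤-by 0≤1 (+-comm (ι n) 1ℚ))) (half^*suc≤1 n)) ⟩
          1ℚ * 1ℚ ∎

    variance-bound : 𝔼 (λ x → φ x * φ x) ≤ℚ 𝔼 φ * 𝔼 φ + 4ℚ * 𝔼 y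
    variance-bound = subst₂ _≤ℚ_ stability-0 (cong (_+ 4ℚ * 𝔼 y) stability-1)
      (≤-trans (stability-step {p = p^ n} {p' = 0ℚ} (0≤p^ n) (≤⇒0≤- (p^≤1 n)) φ)
        (≤-by (+-nonneg (+-nonneg (≤⇒0≤- (stability-telescope n)) (≤⇒0≤- influence-tail))
                 (*-nonneg (*-nonneg {3ℚ} dec≤ (0≤half^ n)) (W-nonneg 0≤1-q 0≤q 0≤y)))
          (solve 6 (λ h w t m m1 e → let p = h :* h in
            m :+ (p :- con 0ℚ) :* w :* t :+ ((m1 :+ con 3ℚ :* (con 1ℚ :- h) :* e :- m) :+ (con 1ℚ :* e :- p :* w :* t) :+ con 3ℚ :* h :* e)
            := m1 :+ con 4ℚ :* e) refl (half^ n) vq (influence 0ℚ φ) (stability (p^ n) φ) (stability 1ℚ φ) (𝔼 y))))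
      where
      stability-0 : stability 0ℚ φ ≡ 𝔼 (λ x → φ x * φ x)
      stability-0 = 𝔼-cong (λ x → cong (φ x *_) (noise-0 φ x))
      stability-1 : stability 1ℚ φ ≡ 𝔼 φ * 𝔼 φ
      stability-1 = trans (𝔼-cong (λ x → trans (cong (φ x *_) (noise-1 φ x)) (*-comm (φ x) (𝔼 φ)))) (𝔼-scale (𝔼 φ) φ)

-- Talagrand's inequality for Boolean functions

⟦_⟧ : Bool → ℚ
⟦ true ⟧ = 1ℚ
⟦ false ⟧ = 0ℚ

0≤⟦_⟧ : ∀ b → 0ℚ ≤ℚ ⟦ b ⟧
0≤⟦ true ⟧ = dec≤
0≤⟦ false ⟧ = ≤-refl

⟦_⟧≤1 : ∀ b → ⟦ b ⟧ ≤ℚ 1ℚ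
⟦ true ⟧≤1 = ≤-refl
⟦ false ⟧≤1 = dec≤

1/16 : ℚ
1/16 = (ℤ.+ 1) / 16

0≤1/16 : 0ℚ ≤ℚ 1/16
0≤1/16 = dec≤

0≤15/16 : 0ℚ ≤ℚ 1ℚ - 1/16
0≤15/16 = dec≤

open Biased 1/16 0≤1/16 0≤15/16

disagreement : ∀ {n} (g : Cube n → Bool) →
  𝔼 (λ S → 𝔼 (λ S' → ⟦ g S xor g S' ⟧)) ≡ 2ℚ * (𝔼 (λ S → ⟦ g S ⟧ * ⟦ g S ⟧) - 𝔼 (λ S → ⟦ g S ⟧) * 𝔼 (λ S → ⟦ g S ⟧))
disagreement {n} g = begin
  𝔼 (λ S → 𝔼 (λ S' → ⟦ g S xor g S' ⟧)) ≡⟨ 𝔼-cong (λ S → trans (𝔼-cong (λ S' → xor-poly (g S) (g S')))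
      (trans (𝔼-lin (1ℚ - 2ℚ * φ S) 1ℚ φ (λ _ → φ S)) (cong (λ u → (1ℚ - 2ℚ * φ S) * m + 1ℚ * u) (𝔼-const {n} (φ S))))) ⟩
  𝔼 (λ S → (1ℚ - 2ℚ * φ S) * m + 1ℚ * φ S) ≡⟨ 𝔼-cong (λ S → solve 2 (λ f m → (con 1ℚ :- con 2ℚ :* f) :* m :+ con 1ℚ :* f := (con 1ℚ :- con 2ℚ :* m) :* f :+ con 1ℚ :* m) refl (φ S) m) ⟩
  𝔼 (λ S → (1ℚ - 2ℚ * m) * φ S + 1ℚ * m) ≡⟨ 𝔼-lin (1ℚ - 2ℚ * m) 1ℚ φ (λ _ → m) ⟩
  (1ℚ - 2ℚ * m) * m + 1ℚ * 𝔼 {n} (λ _ → m) ≡⟨ cong (λ u → (1ℚ - 2ℚ * m) * m + 1ℚ * u) (𝔼-const {n} m) ⟩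
  (1ℚ - 2ℚ * m) * m + 1ℚ * m ≡⟨ solve 1 (λ m → (con 1ℚ :- con 2ℚ :* m) :* m :+ con 1ℚ :* m := con 2ℚ :* (m :- m :* m)) refl m ⟩
  2ℚ * (m - m * m) ≡⟨ cong (λ u → 2ℚ * (u - m * m)) (𝔼-cong (λ S → sym (idem (g S)))) ⟩
  2ℚ * (𝔼 (λ S → φ S * φ S) - m * m) ∎
  where
  open ≡-Reasoning
  φ : Cube n → ℚ
  φ S = ⟦ g S ⟧
  m : ℚ
  m = 𝔼 φ
  xor-poly : ∀ a b → ⟦ a xor b ⟧ ≡ (1ℚ - 2ℚ * ⟦ a ⟧) * ⟦ b ⟧ + 1ℚ * ⟦ a ⟧
  xor-poly false false = refl
  xor-poly false true = refl
  xor-poly true false = refl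
  xor-poly true true = refl
  idem : ∀ a → ⟦ a ⟧ * ⟦ a ⟧ ≡ ⟦ a ⟧
  idem false = refl
  idem true = refl

16ℚ 128ℚ 256ℚ 16/15 : ℚ
16ℚ = (ℤ.+ 16) / 1
128ℚ = (ℤ.+ 128) / 1
256ℚ = (ℤ.+ 256) / 1
16/15 = (ℤ.+ 16) / 15

-- Robust form of Talagrand's inequality: it suffices to count each sensitive edge at one of its ends.
talagrand : ∀ {n} (g : Cube n → Bool) (c : Fin n → Cube n → Bool) →
  (∀ i x → g (x [ i ]≔ false) ≢ g (x [ i ]≔ true) → c i (x [ i ]≔ false) ≡ true ⊎ c i (x [ i ]≔ true) ≡ true) →
  (y : Cube n → ℚ) → (∀ x → 0ℚ ≤ℚ y x) → (∀ x → ΣF (λ i → ⟦ c i x ⟧) ≤ℚ y x * y x) →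
  𝔼 (λ S → 𝔼 (λ S' → ⟦ g S xor g S' ⟧)) ≤ℚ 128ℚ * 𝔼 y
-- 128 = 2 · 4 · 16: disagreement is twice the variance, 4 comes from `variance-bound`, and 16 is
-- the largest weight in `share`.
talagrand {n} g c charged y 0≤y c≤y = subst (_≤ℚ 128ℚ * 𝔼 y) (sym (disagreement g))
  (≤-by (*-nonneg {2ℚ} dec≤ (≤⇒0≤- var))
    (solve 3 (λ s m e → con 2ℚ :* (s :- m :* m) :+ con 2ℚ :* (m :* m :+ con 4ℚ :* (con 16ℚ :* e) :- s) := con 128ℚ :* e) refl
      (𝔼 (λ S → φ S * φ S)) (𝔼 φ) (𝔼 y)))
  where
  φ : Cube n → ℚ
  φ S = ⟦ g S ⟧
  -- The whole derivative goes to one end, divided by the probability of that end, 15/16 or 1/16.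
  -- The second Boolean says whether the end false is charged; if not, the end true pays.
  share : Bool → Bool → ℚ → ℚ
  share false true d = 16/15 * d
  share false false d = 0ℚ
  share true true d = 0ℚ
  share true false d = 16ℚ * d
  v : Fin n → Cube n → ℚ
  v i x = share (lookup x i) (c i (x [ i ]≔ false)) (∂ i φ x)
  share-avg : ∀ b d → (1ℚ - 1/16) * share false b d + 1/16 * share true b d ≡ d
  share-avg true d = solve 1 (λ d → con (1ℚ - 1/16) :* (con 16/15 :* d) :+ con 1/16 :* con 0ℚ := d) refl d
  share-avg false d = solve 1 (λ d → con (1ℚ - 1/16) :* con 0ℚ :+ con 1/16 :* (con 16ℚ :* d) := d) refl d
  v-at : ∀ i b x → v i (x [ i ]≔ b) ≡ share b (c i (x [ i ]≔ false)) (∂ i φ x)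
  v-at i b x rewrite lookup∘update i x b | []≔-idempotent {x = b} {y = false} x i | []≔-idempotent {x = b} {y = true} x i = refl
  v-avg : ∀ i x → (1ℚ - 1/16) * v i (x [ i ]≔ false) + 1/16 * v i (x [ i ]≔ true) ≡ ∂ i φ x
  v-avg i x = trans (cong₂ (λ s t → (1ℚ - 1/16) * s + 1/16 * t) (v-at i false x) (v-at i true x)) (share-avg (c i (x [ i ]≔ false)) (∂ i φ x))
  bit-sq : ∀ a b k → k * k ≤ℚ 256ℚ → 0ℚ ≤ℚ k * k → k * (⟦ a ⟧ - ⟦ b ⟧) * (k * (⟦ a ⟧ - ⟦ b ⟧)) ≤ℚ 256ℚ * 1ℚ
  bit-sq a b k hk 0≤kk = subst (_≤ℚ 256ℚ * 1ℚ) (solve 2 (λ k d → k :* k :* (d :* d) := k :* d :* (k :* d)) refl k (⟦ a ⟧ - ⟦ b ⟧))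
    (*-mono-nn 0≤kk dec≤ hk (cases a b))
    where
    cases : ∀ a b → (⟦ a ⟧ - ⟦ b ⟧) * (⟦ a ⟧ - ⟦ b ⟧) ≤ℚ 1ℚ
    cases true true = dec≤
    cases true false = dec≤
    cases false true = dec≤
    cases false false = dec≤
  v≤c : ∀ i x → v i x * v i x ≤ℚ 256ℚ * ⟦ c i x ⟧
  v≤c i x with lookup x i in eq
  ... | false rewrite trans (cong (x [ i ]≔_) (sym eq)) ([]≔-lookup x i) with c i x
  ...   | true = bit-sq (g (x [ i ]≔ true)) (g x) 16/15 dec≤ (sq-nonneg 16/15)
  ...   | false = dec≤
  v≤c i x | true with c i (x [ i ]≔ false) in eqc
  ...   | true = *-nonneg {256ℚ} dec≤ 0≤⟦ c i x ⟧
  ...   | false with g (x [ i ]≔ false) Boolₚ.≟ g (x [ i ]≔ true)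
  ...     | yes e rewrite e = ≤-trans (≤-reflexive (solve 1 (λ a → con 16ℚ :* (a :- a) :* (con 16ℚ :* (a :- a)) := con 0ℚ) refl ⟦ g (x [ i ]≔ true) ⟧))
                                (*-nonneg {256ℚ} dec≤ 0≤⟦ c i x ⟧)
  ...     | no ne with charged i x ne
  ...       | inj₁ h with trans (sym eqc) h
  ...         | ()
  v≤c i x | true | false | no ne | inj₂ h = subst (λ b → 16ℚ * ∂ i φ x * (16ℚ * ∂ i φ x) ≤ℚ 256ℚ * ⟦ b ⟧)
      (trans (sym h) (cong (c i) (trans (cong (x [ i ]≔_) (sym eq)) ([]≔-lookup x i))))
      (bit-sq (g (x [ i ]≔ true)) (g (x [ i ]≔ false)) 16ℚ dec≤ (sq-nonneg 16ℚ))
  var : 𝔼 (λ S → φ S * φ S) ≤ℚ 𝔼 φ * 𝔼 φ + 4ℚ * (16ℚ * 𝔼 y)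
  var = subst (λ e → 𝔼 (λ S → φ S * φ S) ≤ℚ 𝔼 φ * 𝔼 φ + 4ℚ * e) (𝔼-scale 16ℚ y)
    (variance-bound φ (λ x → 0≤⟦ g x ⟧) (λ x → ⟦ g x ⟧≤1) v v-avg (λ x → 16ℚ * y x) (λ x → *-nonneg {16ℚ} dec≤ (0≤y x))
      (λ x → ≤-trans (ΣF-mono (λ i → v≤c i x)) (subst₂ _≤ℚ_ (sym (ΣF-scale 256ℚ (λ i → ⟦ c i x ⟧)))
        (solve 1 (λ y → con 256ℚ :* (y :* y) := con 16ℚ :* y :* (con 16ℚ :* y)) refl (y x))
        (*-monoˡ-nn {256ℚ} dec≤ (c≤y x)))))

-- Sorting and the potential

-- Junk value: inv 0ℚ ≡ 0ℚ.
inv : ℚ → ℚ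
inv x with x ≟ 0ℚ
... | yes _ = 0ℚ
... | no ne = (1/ x) {{≢-nonZero ne}}

*-inv : ∀ {x} → x ≢ 0ℚ → x * inv x ≡ 1ℚ
*-inv {x} ne with x ≟ 0ℚ
... | yes e = ⊥-elim (ne e)
... | no ne' = *-inverseʳ x {{≢-nonZero ne'}}

inv-nonneg : ∀ {x} → 0ℚ ≤ℚ x → 0ℚ ≤ℚ inv x
inv-nonneg {x} 0≤x with x ≟ 0ℚ
... | yes _ = ≤-refl
... | no ne = <⇒≤ (positive⁻¹ _ {{1/pos⇒pos x {{x-pos}}}})
  where
  x-pos : Positive x
  x-pos = nonNeg∧nonZero⇒pos x {{nonNegative 0≤x}} {{≢-nonZero ne}}

-- A concave rational substitute for the square root: n ≤ ψ n * ψ n ≤ 2 n.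
ψ ψ′ : ℕ → ℚ
ψ zero = 0ℚ
ψ (suc n) = ψ n + ψ′ n
ψ′ n = inv (1ℚ + ψ n)

0≤ψ : ∀ n → 0ℚ ≤ℚ ψ n
0≤ψ′ : ∀ n → 0ℚ ≤ℚ ψ′ n
0≤ψ zero = ≤-refl
0≤ψ (suc n) = +-nonneg (0≤ψ n) (0≤ψ′ n)
0≤ψ′ n = inv-nonneg (+-nonneg {1ℚ} dec≤ (0≤ψ n))

ψ′-eq : ∀ n → (1ℚ + ψ n) * ψ′ n ≡ 1ℚ
ψ′-eq n = *-inv {1ℚ + ψ n} (λ e → <-irrefl (sym e) (<-≤-trans (positive⁻¹ 1ℚ) (≤-by (0≤ψ n) refl)))

ψ′≤1 : ∀ n → 0ℚ ≤ℚ 1ℚ - ψ′ n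
ψ′≤1 n = subst (0ℚ ≤ℚ_) (trans (solve 2 (λ s t → s :* t := (con 1ℚ :+ s) :* t :- t) refl (ψ n) (ψ′ n)) (cong (_- ψ′ n) (ψ′-eq n)))
  (*-nonneg (0≤ψ n) (0≤ψ′ n))

-- The increment 1/(1 + ψ n) is chosen so that the square grows by 1 plus a square in [0, 1]; both
-- `n≤ψ²` and `ψ²≤2n` are read off from this.
ψ-suc-sq : ∀ n → ψ (suc n) * ψ (suc n) ≡ 1ℚ + ψ n * ψ n + (1ℚ - ψ′ n) * (1ℚ - ψ′ n)
ψ-suc-sq n = trans (solve 2 (λ s t → (s :+ t) :* (s :+ t) := (s :* s :+ t :* t :- con 2ℚ :* t) :+ con 2ℚ :* ((con 1ℚ :+ s) :* t)) refl (ψ n) (ψ′ n))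
  (trans (cong (λ u → (ψ n * ψ n + ψ′ n * ψ′ n - 2ℚ * ψ′ n) + 2ℚ * u) (ψ′-eq n))
    (solve 2 (λ s t → (s :* s :+ t :* t :- con 2ℚ :* t) :+ con 2ℚ :* con 1ℚ := con 1ℚ :+ s :* s :+ (con 1ℚ :- t) :* (con 1ℚ :- t)) refl (ψ n) (ψ′ n)))

n≤ψ² : ∀ n → ι n ≤ℚ ψ n * ψ n
n≤ψ² zero = dec≤
n≤ψ² (suc n) = subst₂ _≤ℚ_ (sym (ι-suc n)) (sym (ψ-suc-sq n))
  (≤-trans (+-monoʳ-≤ 1ℚ (n≤ψ² n)) (≤-by (sq-nonneg (1ℚ - ψ′ n)) refl))

ψ²≤2n : ∀ n → ψ n * ψ n ≤ℚ 2ℚ * ι n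
ψ²≤2n zero = dec≤
ψ²≤2n (suc n) = subst₂ (λ a b → a ≤ℚ 2ℚ * b) (sym (ψ-suc-sq n)) (sym (ι-suc n))
  (≤-by (+-nonneg (≤⇒0≤- (ψ²≤2n n)) (*-nonneg (0≤ψ′ n) (+-nonneg {1ℚ} dec≤ (ψ′≤1 n))))
    (solve 3 (λ s t k → con 1ℚ :+ s :* s :+ (con 1ℚ :- t) :* (con 1ℚ :- t) :+ (con 2ℚ :* k :- s :* s :+ t :* (con 1ℚ :+ (con 1ℚ :- t)))
      := con 2ℚ :* (con 1ℚ :+ k)) refl (ψ n) (ψ′ n) (ι n)))

ψ≤2* : ∀ {n u} → 0ℚ ≤ℚ u → ι n ≤ℚ u * u → ψ n ≤ℚ 2ℚ * u
ψ≤2* {n} {u} 0≤u h = sq-cancel-≤ (*-nonneg {2ℚ} dec≤ 0≤u) (≤-trans (ψ²≤2n n) (≤-trans (*-monoˡ-nn {2ℚ} dec≤ h)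
  (≤-by (*-nonneg {2ℚ} dec≤ (sq-nonneg u)) (solve 1 (λ u → con 2ℚ :* (u :* u) :+ con 2ℚ :* (u :* u) := con 2ℚ :* u :* (con 2ℚ :* u)) refl u))))

ψ′-suc : ∀ n → ψ′ (suc n) ≤ℚ ψ′ n
ψ′-suc n = ≤-by (*-nonneg (*-nonneg d d') d) (begin
    t' + t * t' * t ≡⟨ cong (_+ t * t' * t) (*-identityʳ t') ⟨
    t' * 1ℚ + t * t' * t ≡⟨ cong (λ u → t' * u + t * t' * t) (ψ′-eq n) ⟨
    t' * ((1ℚ + s) * t) + t * t' * t ≡⟨ solve 3 (λ s t t' → t' :* ((con 1ℚ :+ s) :* t) :+ t :* t' :* t := t :* ((con 1ℚ :+ (s :+ t)) :* t')) refl s t t' ⟩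
    t * ((1ℚ + (s + t)) * t') ≡⟨ cong (t *_) (ψ′-eq (suc n)) ⟩
    t * 1ℚ ≡⟨ *-identityʳ t ⟩
    t ∎)
  where
  open ≡-Reasoning
  s t t' : ℚ
  s = ψ n
  t = ψ′ n
  t' = ψ′ (suc n)
  d : 0ℚ ≤ℚ t
  d = 0≤ψ′ n
  d' : 0ℚ ≤ℚ t'
  d' = 0≤ψ′ (suc n)

ψ′-anti : ∀ m n → ψ′ (n ℕ.+ m) ≤ℚ ψ′ m
ψ′-anti m zero = ≤-refl
ψ′-anti m (suc n) = ≤-trans (ψ′-suc (n ℕ.+ m)) (ψ′-anti m n)

ψ-mono+ : ∀ m n → ψ m ≤ℚ ψ (n ℕ.+ m)
ψ-mono+ m zero = ≤-refl
ψ-mono+ m (suc n) = ≤-trans (ψ-mono+ m n) (≤-by (0≤ψ′ (n ℕ.+ m)) refl)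

ψ-mono : ∀ {m n} → m ≤ n → ψ m ≤ℚ ψ n
ψ-mono {m} {n} h = subst (λ k → ψ m ≤ℚ ψ k) (ℕₚ.m∸n+n≡m h) (ψ-mono+ m (n ℕ.∸ m))

ψ-concave : ∀ a b m → ψ (a ℕ.+ (b ℕ.+ m)) + ψ m ≤ℚ ψ (a ℕ.+ m) + ψ (b ℕ.+ m)
ψ-concave zero b m = ≤-reflexive (+-comm (ψ (b ℕ.+ m)) (ψ m))
ψ-concave (suc a) b m = ≤-by (+-nonneg (≤⇒0≤- (ψ-concave a b m)) (≤⇒0≤- δ))
    (solve 6 (λ x d m y d' z → x :+ d :+ m :+ (y :+ z :- (x :+ m) :+ (d' :- d)) := y :+ d' :+ z) refl
      (ψ (a ℕ.+ (b ℕ.+ m))) (ψ′ (a ℕ.+ (b ℕ.+ m))) (ψ m) (ψ (a ℕ.+ m)) (ψ′ (a ℕ.+ m)) (ψ (b ℕ.+ m)))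
  where
  δ : ψ′ (a ℕ.+ (b ℕ.+ m)) ≤ℚ ψ′ (a ℕ.+ m)
  δ = subst (λ k → ψ′ k ≤ℚ ψ′ (a ℕ.+ m)) (trans (sym (ℕₚ.+-assoc b a m)) (trans (cong (ℕ._+ m) (ℕₚ.+-comm b a)) (ℕₚ.+-assoc a b m)))
    (ψ′-anti (a ℕ.+ m) b)

-- The new pair is more spread out than the old one: `n₁` lies below both old counts and the total
-- has not grown. Raising `n₀` to `o₀ + o₁ - n₁` reduces this to concavity.
ψ-majorize : ∀ {n₀ n₁ o₀ o₁} → n₀ ℕ.+ n₁ ≤ o₀ ℕ.+ o₁ → n₁ ≤ o₀ → n₁ ≤ o₁ → ψ n₀ + ψ n₁ ≤ℚ ψ o₀ + ψ o₁
ψ-majorize {n₀} {n₁} {o₀} {o₁} sum h₀ h₁ = ≤-trans (+-monoˡ-≤ (ψ n₁) (ψ-mono n₀≤))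
  (subst₂ (λ s t → ψ (a ℕ.+ (b ℕ.+ n₁)) + ψ n₁ ≤ℚ ψ s + ψ t) (ℕₚ.m∸n+n≡m h₀) (ℕₚ.m∸n+n≡m h₁) (ψ-concave a b n₁))
  where
  a b : ℕ
  a = o₀ ℕ.∸ n₁
  b = o₁ ℕ.∸ n₁
  n₀≤ : n₀ ≤ a ℕ.+ (b ℕ.+ n₁)
  n₀≤ = ℕₚ.+-cancelʳ-≤ n₁ n₀ (a ℕ.+ (b ℕ.+ n₁)) (ℕₚ.≤-trans sum (ℕₚ.≤-reflexive
    (trans (cong₂ ℕ._+_ (sym (ℕₚ.m∸n+n≡m h₀)) (sym (ℕₚ.m∸n+n≡m h₁)))
      (trans (ℕₚ.+-assoc a n₁ (b ℕ.+ n₁)) (trans (cong (a ℕ.+_) (ℕₚ.+-comm n₁ (b ℕ.+ n₁))) (sym (ℕₚ.+-assoc a (b ℕ.+ n₁) n₁)))))))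

-- The value at end c of an edge with end values p₀, p₁, after sorting the edge if b holds.
sort₂ : Bool → Bool → Bool → Bool → Bool
sort₂ false false p₀ p₁ = p₀
sort₂ false true p₀ p₁ = p₁
sort₂ true false p₀ p₁ = p₀ ∧ p₁
sort₂ true true p₀ p₁ = p₀ ∨ p₁

-- Directions are sorted one after another from the last coordinate to the head, so both halves are
-- completely sorted before the head direction acts.
srt : ∀ {d} → Cube d → (Cube d → Bool) → Cube d → Bool
srt [] F [] = F []
srt (b ∷ S) F (c ∷ x) = sort₂ b c (srt S (F ∘ (false ∷_)) x) (srt S (F ∘ (true ∷_)) x)

bit : Bool → ℕ
bit true = 1
bit false = 0

∑ℕ : ∀ {n} → (Fin n → ℕ) → ℕ
∑ℕ {zero} f = 0
∑ℕ {suc n} f = f zero ℕ.+ ∑ℕ (f ∘ suc)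

-- The token of an edge with values f and g sits at its upper value if it is red (k = true), at its lower value if it is blue.
-- The pair of Booleans restricts attention to endpoints of value true, resp. false.
Filter : Set
Filter = Bool × Bool

all : Filter
all = true , true

sel : Filter → Bool → Bool
sel (a , b) true = a
sel (a , b) false = b

tok : Filter → Bool → Bool → Bool → Bool
tok a true false true = sel a true
tok a false true false = sel a false
tok a _ _ _ = false

-- Colour of the edge at position c after sorting; if exactly one of the two edges was sensitive it keeps its colour,
-- and if both were, with different colours, the red one goes to position false and the blue one to position true.
recolour : Bool → Bool → (p₀ p₁ g₀ g₁ k₀ k₁ : Bool) → Bool
recolour false false p₀ p₁ g₀ g₁ k₀ k₁ = k₀
recolour false true p₀ p₁ g₀ g₁ k₀ k₁ = k₁
recolour true false p₀ p₁ g₀ g₁ k₀ k₁ = ((p₀ xor g₀) ∧ k₀) ∨ ((p₁ xor g₁) ∧ k₁)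
recolour true true p₀ p₁ g₀ g₁ k₀ k₁ = not (((p₀ xor g₀) ∧ not k₀) ∨ ((p₁ xor g₁) ∧ not k₁))

recolour-sym : ∀ b c p₀ p₁ g₀ g₁ k₀ k₁ → recolour b c p₀ p₁ g₀ g₁ k₀ k₁ ≡ recolour b c g₀ g₁ p₀ p₁ k₀ k₁
recolour-sym false false p₀ p₁ g₀ g₁ k₀ k₁ = refl
recolour-sym false true p₀ p₁ g₀ g₁ k₀ k₁ = refl
recolour-sym true false p₀ p₁ g₀ g₁ k₀ k₁ = cong₂ (λ s t → (s ∧ k₀) ∨ (t ∧ k₁)) (Boolₚ.xor-comm p₀ g₀) (Boolₚ.xor-comm p₁ g₁)
recolour-sym true true p₀ p₁ g₀ g₁ k₀ k₁ = cong₂ (λ s t → not ((s ∧ not k₀) ∨ (t ∧ not k₁))) (Boolₚ.xor-comm p₀ g₀) (Boolₚ.xor-comm p₁ g₁)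

-- How token counts n at the ends of a sorted edge (values p₀, p₁ before sorting) compare with the counts o before sorting.
Dom : Bool → (p₀ p₁ : Bool) → (n₀ n₁ o₀ o₁ : ℕ) → Set
Dom true true true n₀ n₁ o₀ o₁ = n₀ ℕ.+ n₁ ≤ o₀ ℕ.+ o₁ × n₁ ≤ o₀ × n₁ ≤ o₁
Dom true false false n₀ n₁ o₀ o₁ = n₁ ℕ.+ n₀ ≤ o₀ ℕ.+ o₁ × n₀ ≤ o₀ × n₀ ≤ o₁
Dom true true false n₀ n₁ o₀ o₁ = n₁ ≤ o₀ × n₀ ≤ o₁
Dom true false true n₀ n₁ o₀ o₁ = n₀ ≤ o₀ × n₁ ≤ o₁
Dom false p₀ p₁ n₀ n₁ o₀ o₁ = n₀ ≤ o₀ × n₁ ≤ o₁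

Dom? : ∀ b p₀ p₁ n₀ n₁ o₀ o₁ → Dec (Dom b p₀ p₁ n₀ n₁ o₀ o₁)
Dom? true true true n₀ n₁ o₀ o₁ = (_ ℕₚ.≤? _) ×-dec ((_ ℕₚ.≤? _) ×-dec (_ ℕₚ.≤? _))
Dom? true false false n₀ n₁ o₀ o₁ = (_ ℕₚ.≤? _) ×-dec ((_ ℕₚ.≤? _) ×-dec (_ ℕₚ.≤? _))
Dom? true true false n₀ n₁ o₀ o₁ = (_ ℕₚ.≤? _) ×-dec (_ ℕₚ.≤? _)
Dom? true false true n₀ n₁ o₀ o₁ = (_ ℕₚ.≤? _) ×-dec (_ ℕₚ.≤? _)
Dom? false p₀ p₁ n₀ n₁ o₀ o₁ = (_ ℕₚ.≤? _) ×-dec (_ ℕₚ.≤? _)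

Dom-0 : ∀ b p₀ p₁ → Dom b p₀ p₁ 0 0 0 0
Dom-0 true true true = ℕ.z≤n , ℕ.z≤n , ℕ.z≤n
Dom-0 true false false = ℕ.z≤n , ℕ.z≤n , ℕ.z≤n
Dom-0 true true false = ℕ.z≤n , ℕ.z≤n
Dom-0 true false true = ℕ.z≤n , ℕ.z≤n
Dom-0 false _ _ = ℕ.z≤n , ℕ.z≤n

-- Every clause of `Dom` is a system of linear inequalities, hence closed under addition. This
-- allows checking single tokens and applying `ψ` only to the total counts.
Dom-+ : ∀ b p₀ p₁ {n₀ n₁ o₀ o₁ m₀ m₁ u₀ u₁} → Dom b p₀ p₁ n₀ n₁ o₀ o₁ → Dom b p₀ p₁ m₀ m₁ u₀ u₁ →
  Dom b p₀ p₁ (n₀ ℕ.+ m₀) (n₁ ℕ.+ m₁) (o₀ ℕ.+ u₀) (o₁ ℕ.+ u₁)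
Dom-+ true true true {n₀} {n₁} {o₀} {o₁} {m₀} {m₁} {u₀} {u₁} (s , h , k) (s' , h' , k') =
  subst₂ _≤_ (interchange n₀ n₁ m₀ m₁) (interchange o₀ o₁ u₀ u₁) (ℕₚ.+-mono-≤ s s') , ℕₚ.+-mono-≤ h h' , ℕₚ.+-mono-≤ k k'
Dom-+ true false false {n₀} {n₁} {o₀} {o₁} {m₀} {m₁} {u₀} {u₁} (s , h , k) (s' , h' , k') =
  subst₂ _≤_ (interchange n₁ n₀ m₁ m₀) (interchange o₀ o₁ u₀ u₁) (ℕₚ.+-mono-≤ s s') , ℕₚ.+-mono-≤ h h' , ℕₚ.+-mono-≤ k k'
Dom-+ true true false (h , k) (h' , k') = ℕₚ.+-mono-≤ h h' , ℕₚ.+-mono-≤ k k'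
Dom-+ true false true (h , k) (h' , k') = ℕₚ.+-mono-≤ h h' , ℕₚ.+-mono-≤ k k'
Dom-+ false _ _ (h , k) (h' , k') = ℕₚ.+-mono-≤ h h' , ℕₚ.+-mono-≤ k k'

Dom⇒ψ : ∀ b p₀ p₁ {n₀ n₁ o₀ o₁} → Dom b p₀ p₁ n₀ n₁ o₀ o₁ → ψ n₀ + ψ n₁ ≤ℚ ψ o₀ + ψ o₁
Dom⇒ψ true true true (s , h , k) = ψ-majorize s h k
Dom⇒ψ true false false {n₀} {n₁} (s , h , k) = ≤-trans (≤-reflexive (+-comm (ψ n₀) (ψ n₁))) (ψ-majorize s h k)
Dom⇒ψ true true false {n₀} {n₁} (h , k) = ≤-trans (≤-reflexive (+-comm (ψ n₀) (ψ n₁))) (+-mono-≤ (ψ-mono h) (ψ-mono k))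
Dom⇒ψ true false true (h , k) = +-mono-≤ (ψ-mono h) (ψ-mono k)
Dom⇒ψ false _ _ (h , k) = +-mono-≤ (ψ-mono h) (ψ-mono k)

Dom-∑ : ∀ b p₀ p₁ {m} {n₀ n₁ o₀ o₁ : Fin m → ℕ} → (∀ i → Dom b p₀ p₁ (n₀ i) (n₁ i) (o₀ i) (o₁ i)) →
  Dom b p₀ p₁ (∑ℕ n₀) (∑ℕ n₁) (∑ℕ o₀) (∑ℕ o₁)
Dom-∑ b p₀ p₁ {zero} h = Dom-0 b p₀ p₁
Dom-∑ b p₀ p₁ {suc m} h = Dom-+ b p₀ p₁ (h zero) (Dom-∑ b p₀ p₁ (h ∘ suc))

bool? : {P : Bool → Set} → (∀ b → Dec (P b)) → Dec (∀ b → P b)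
bool? P? with P? false | P? true
... | yes p | yes q = yes λ { false → p ; true → q }
... | no ¬p | _ = no λ h → ¬p (h false)
... | yes _ | no ¬q = no λ h → ¬q (h true)

-- Between two true ends, sorting moves false neighbours, and with them red tokens, to the end
-- false; between two false ends it moves true neighbours and blue tokens to the end true.
-- `recolour` obeys the same rule, so tokens only concentrate. Evaluation checks the 512 cases.
Dom-tok : ∀ a a' b p₀ p₁ g₀ g₁ k₀ k₁ → Dom b p₀ p₁
  (bit (tok (a , a') (sort₂ b false p₀ p₁) (sort₂ b false g₀ g₁) (recolour b false p₀ p₁ g₀ g₁ k₀ k₁)))
  (bit (tok (a , a') (sort₂ b true p₀ p₁) (sort₂ b true g₀ g₁) (recolour b true p₀ p₁ g₀ g₁ k₀ k₁)))
  (bit (tok (a , a') p₀ g₀ k₀)) (bit (tok (a , a') p₁ g₁ k₁))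
Dom-tok = toWitness {a? = bool? λ a → bool? λ a' → bool? λ b → bool? λ p₀ → bool? λ p₁ → bool? λ g₀ → bool? λ g₁ → bool? λ k₀ → bool? λ k₁ → Dom? b p₀ p₁ _ _ _ _} tt

-- A violated edge leaving an end with coordinate c = false is counted at value true, one entering an end with c = true at value false.
violation : Bool → Bool → Filter
violation r false = r , false
violation r true = false , r

-- Here sensitivity arises from violation: for a direction in R, the values at the ends of an edge
-- depend on whether that direction is sorted exactly when the edge is violated after the inner
-- sorts.
Dom-new : ∀ r b p₀ p₁ k → Dom (r ∧ b) p₀ p₁
  (bit (tok all (sort₂ (r ∧ b) false p₀ p₁) (sort₂ (r ∧ not b) false p₀ p₁) k))
  (bit (tok all (sort₂ (r ∧ b) true p₀ p₁) (sort₂ (r ∧ not b) true p₀ p₁) k))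
  (bit (tok (violation r false) p₀ p₁ k)) (bit (tok (violation r true) p₁ p₀ k))
Dom-new = toWitness {a? = bool? λ r → bool? λ b → bool? λ p₀ → bool? λ p₁ → bool? λ k → Dom? (r ∧ b) p₀ p₁ _ _ _ _} tt

-- Nested like the cube: colours of the head-direction edges, indexed by their common tail, then one
-- colouring for each half. `true` is red.
EdgeColouring : ℕ → Set
EdgeColouring zero = ⊤
EdgeColouring (suc d) = (Cube d → Bool) × (Bool → EdgeColouring d)

-- A family of parallel edges in an outer direction, seen from one side after the recursion has
-- passed to that half. `other` holds the values across; the token waits while both sides are sorted
-- along the inner directions.
record Pending (d : ℕ) : Set where
  constructor pending
  field
    filter : Filter
    other colour : Cube d → Bool

restrict : ∀ {d} → Bool → Pending (suc d) → Pending d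
restrict c (pending a G k) = pending a (G ∘ (c ∷_)) (k ∘ (c ∷_))

final-colour : ∀ {d} → Cube d → Cube d → (F G k : Cube d → Bool) → Bool
final-colour [] [] F G k = k []
final-colour (b ∷ S) (c ∷ x) F G k = recolour b c
  (srt S (F ∘ (false ∷_)) x) (srt S (F ∘ (true ∷_)) x) (srt S (G ∘ (false ∷_)) x) (srt S (G ∘ (true ∷_)) x)
  (final-colour S x (F ∘ (false ∷_)) (G ∘ (false ∷_)) (k ∘ (false ∷_))) (final-colour S x (F ∘ (true ∷_)) (G ∘ (true ∷_)) (k ∘ (true ∷_)))

final-colour-sym : ∀ {d} (S x : Cube d) F G k → final-colour S x F G k ≡ final-colour S x G F k
final-colour-sym [] [] F G k = refl
final-colour-sym (b ∷ S) (c ∷ x) F G k = trans (recolour-sym b c _ _ _ _ _ _)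
  (cong₂ (recolour b c _ _ _ _) (final-colour-sym S x _ _ _) (final-colour-sym S x _ _ _))

flip : ∀ {d} → Fin d → Cube d → Cube d
flip zero (b ∷ S) = not b ∷ S
flip (suc i) (b ∷ S) = b ∷ flip i S

-- The edge between S and `flip i S` receives its colour when direction i is reached; the sorts
-- along the coordinates before i, performed later, recolour it.
tracker-colour : ∀ {d} → (R S x : Cube d) → (Cube d → Bool) → EdgeColouring d → Fin d → Bool
tracker-colour (r ∷ R) (b ∷ S) (c ∷ x) F (k , ks) zero = final-colour (R ∩ S) x (F ∘ (false ∷_)) (F ∘ (true ∷_)) k
tracker-colour (r ∷ R) (b ∷ S) (c ∷ x) F (k , ks) (suc i) = recolour (r ∧ b) c
  (srt (R ∩ S) (F ∘ (false ∷_)) x) (srt (R ∩ S) (F ∘ (true ∷_)) x)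
  (srt (R ∩ flip i S) (F ∘ (false ∷_)) x) (srt (R ∩ flip i S) (F ∘ (true ∷_)) x)
  (tracker-colour R S x (F ∘ (false ∷_)) (ks false) i) (tracker-colour R S x (F ∘ (true ∷_)) (ks true) i)

charge : ∀ {d} → (R S x : Cube d) → (Cube d → Bool) → EdgeColouring d → Fin d → Bool
charge R S x F k i = tok all (srt (R ∩ S) F x) (srt (R ∩ flip i S) F x) (tracker-colour R S x F k i)

violations : ∀ {d} → Cube d → (Cube d → Bool) → EdgeColouring d → Cube d → ℕ
violations [] F k [] = 0
violations (r ∷ R) F (k , ks) (c ∷ x) = bit (tok (violation r c) (F (c ∷ x)) (F (not c ∷ x)) (k x)) ℕ.+ violations R (F ∘ (c ∷_)) (ks c) x

pending-before : ∀ {d} → List (Pending d) → (Cube d → Bool) → Cube d → ℕ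
pending-before [] F x = 0
pending-before (pending a G k ∷ P) F x = bit (tok a (F x) (G x) (k x)) ℕ.+ pending-before P F x

pending-after : ∀ {d} → Cube d → List (Pending d) → (Cube d → Bool) → Cube d → ℕ
pending-after S [] F x = 0
pending-after S (pending a G k ∷ P) F x = bit (tok a (srt S F x) (srt S G x) (final-colour S x F G k)) ℕ.+ pending-after S P F x

pending-before-restrict : ∀ {d} c (P : List (Pending (suc d))) F x →
  pending-before (List.map (restrict c) P) (F ∘ (c ∷_)) x ≡ pending-before P F (c ∷ x)
pending-before-restrict c [] F x = refl
pending-before-restrict c (pending a G k ∷ P) F x = cong (bit (tok a (F (c ∷ x)) (G (c ∷ x)) (k (c ∷ x))) ℕ.+_) (pending-before-restrict c P F x)

Dom-pending : ∀ {d} b (S : Cube d) P (F : Cube (suc d) → Bool) x →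
  Dom b (srt S (F ∘ (false ∷_)) x) (srt S (F ∘ (true ∷_)) x)
    (pending-after (b ∷ S) P F (false ∷ x)) (pending-after (b ∷ S) P F (true ∷ x))
    (pending-after S (List.map (restrict false) P) (F ∘ (false ∷_)) x) (pending-after S (List.map (restrict true) P) (F ∘ (true ∷_)) x)
Dom-pending b S [] F x = Dom-0 b (srt S (F ∘ (false ∷_)) x) (srt S (F ∘ (true ∷_)) x)
Dom-pending b S (pending (a , a') G k ∷ P) F x = Dom-+ b _ _
  (Dom-tok a a' b _ _ (srt S (G ∘ (false ∷_)) x) (srt S (G ∘ (true ∷_)) x)
    (final-colour S x (F ∘ (false ∷_)) (G ∘ (false ∷_)) (k ∘ (false ∷_))) (final-colour S x (F ∘ (true ∷_)) (G ∘ (true ∷_)) (k ∘ (true ∷_)))) (Dom-pending b S P F x)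

open WeightedSum 1ℚ 1ℚ public renaming (W to ∑; W-cong to ∑-cong; W-lin to ∑-lin; W-+ to ∑-+; W-scale to ∑-scale) hiding (W-mono; W-nonneg)

∑-mono : ∀ {n} {φ χ : Cube n → ℚ} → (∀ x → φ x ≤ℚ χ x) → ∑ φ ≤ℚ ∑ χ
∑-mono = WeightedSum.W-mono 1ℚ 1ℚ dec≤ dec≤

∑-nonneg : ∀ {n} {φ : Cube n → ℚ} → (∀ x → 0ℚ ≤ℚ φ x) → 0ℚ ≤ℚ ∑ φ
∑-nonneg = WeightedSum.W-nonneg 1ℚ 1ℚ dec≤ dec≤

-- Sorting turns directed violations into sensitive edges of the tracker functions S ↦ srt (R ∩ S) F x
-- without increasing the potential.
potential : ∀ {d} (R S : Cube d) P (F : Cube d → Bool) k →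
  ∑ (λ x → ψ (pending-after (R ∩ S) P F x ℕ.+ ∑ℕ (λ i → bit (charge R S x F k i)))) ≤ℚ
  ∑ (λ x → ψ (pending-before P F x ℕ.+ violations R F k x))
potential [] [] P F k = ≤-reflexive (cong (λ n → ψ (n ℕ.+ 0)) (same P))
  where
  same : ∀ P → pending-after [] P F [] ≡ pending-before P F []
  same [] = refl
  same (pending a G k ∷ P) = cong (bit (tok a (F []) (G []) (k [])) ℕ.+_) (same P)
potential {suc d} (r ∷ R) (b ∷ S) P F (k , ks) = begin
  1ℚ * ∑ (new false) + 1ℚ * ∑ (new true) ≡⟨ ∑-lin 1ℚ 1ℚ (new false) (new true) ⟨
  ∑ (λ x → 1ℚ * new false x + 1ℚ * new true x) ≤⟨ ∑-mono pointwise ⟩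
  ∑ (λ x → 1ℚ * old false x + 1ℚ * old true x) ≡⟨ ∑-lin 1ℚ 1ℚ (old false) (old true) ⟩
  1ℚ * ∑ (old false) + 1ℚ * ∑ (old true) ≤⟨ +-mono-≤ (*-monoˡ-nn {1ℚ} dec≤ (half false)) (*-monoˡ-nn {1ℚ} dec≤ (half true)) ⟩
  ∑ (λ x → ψ (pending-before P F x ℕ.+ violations (r ∷ R) F (k , ks) x)) ∎
  where
  open ≤-Reasoning
  -- The head-direction edges join the pending list, once for each half; `violation` lets the lower
  -- half count only red violated edges and the upper half only blue ones.
  P' : Bool → List (Pending d)
  P' c = pending (violation r c) (F ∘ (not c ∷_)) k ∷ List.map (restrict c) P
  count : Bool → Cube d → ℕ
  count c x = pending-after (R ∩ S) (P' c) (F ∘ (c ∷_)) x ℕ.+ ∑ℕ (λ i → bit (charge R S x (F ∘ (c ∷_)) (ks c) i))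
  new old : Bool → Cube d → ℚ
  new c x = ψ (pending-after ((r ∷ R) ∩ (b ∷ S)) P F (c ∷ x) ℕ.+ ∑ℕ (λ i → bit (charge (r ∷ R) (b ∷ S) (c ∷ x) F (k , ks) i)))
  old c x = ψ (count c x)
  half : ∀ c → ∑ (old c) ≤ℚ ∑ (λ x → ψ (pending-before P F (c ∷ x) ℕ.+ violations (r ∷ R) F (k , ks) (c ∷ x)))
  half c = ≤-trans (potential R S (P' c) (F ∘ (c ∷_)) (ks c)) (≤-reflexive (∑-cong (λ x → cong ψ (regroup c x))))
    where
    regroup : ∀ c x → pending-before (P' c) (F ∘ (c ∷_)) x ℕ.+ violations R (F ∘ (c ∷_)) (ks c) x
      ≡ pending-before P F (c ∷ x) ℕ.+ violations (r ∷ R) F (k , ks) (c ∷ x)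
    regroup c x rewrite pending-before-restrict c P F x =
      trans (cong (ℕ._+ v) (ℕₚ.+-comm t p)) (ℕₚ.+-assoc p t v)
      where
      t p v : ℕ
      t = bit (tok (violation r c) (F (c ∷ x)) (F (not c ∷ x)) (k x))
      p = pending-before P F (c ∷ x)
      v = violations R (F ∘ (c ∷_)) (ks c) x
  pointwise : ∀ x → 1ℚ * new false x + 1ℚ * new true x ≤ℚ 1ℚ * old false x + 1ℚ * old true x
  pointwise x = subst₂ _≤ℚ_ (sym (cong₂ _+_ (*-identityˡ (new false x)) (*-identityˡ (new true x))))
      (sym (cong₂ _+_ (*-identityˡ (old false x)) (*-identityˡ (old true x))))
      (Dom⇒ψ (r ∧ b) p₀ p₁ {o₀ = count false x} {o₁ = count true x} (subst₂ (λ m₀ m₁ → Dom (r ∧ b) p₀ p₁ m₀ m₁ (count false x) (count true x)) (regroup (pa false) (z false) (inn false)) (regroup (pa true) (z true) (inn true)) dom))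
    where
    p₀ p₁ κ : Bool
    p₀ = srt (R ∩ S) (F ∘ (false ∷_)) x
    p₁ = srt (R ∩ S) (F ∘ (true ∷_)) x
    κ = final-colour (R ∩ S) x (F ∘ (false ∷_)) (F ∘ (true ∷_)) k
    pa z inn : Bool → ℕ
    pa c = pending-after ((r ∷ R) ∩ (b ∷ S)) P F (c ∷ x)
    z c = bit (charge (r ∷ R) (b ∷ S) (c ∷ x) F (k , ks) zero)
    inn c = ∑ℕ (λ i → bit (charge (r ∷ R) (b ∷ S) (c ∷ x) F (k , ks) (suc i)))
    regroup : ∀ p z i → (z ℕ.+ p) ℕ.+ i ≡ p ℕ.+ (z ℕ.+ i)
    regroup p z i = trans (cong (ℕ._+ i) (ℕₚ.+-comm z p)) (ℕₚ.+-assoc p z i)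
    -- The two halves compute the colour of the same edge with its sides exchanged;
    -- `final-colour-sym` identifies the results.
    dom-new : Dom (r ∧ b) p₀ p₁ (z false) (z true)
      (bit (tok (violation r false) p₀ p₁ κ)) (bit (tok (violation r true) p₁ p₀ (final-colour (R ∩ S) x (F ∘ (true ∷_)) (F ∘ (false ∷_)) k)))
    dom-new = subst (λ κ' → Dom (r ∧ b) p₀ p₁ (z false) (z true) (bit (tok (violation r false) p₀ p₁ κ)) (bit (tok (violation r true) p₁ p₀ κ')))
      (final-colour-sym (R ∩ S) x (F ∘ (false ∷_)) (F ∘ (true ∷_)) k) (Dom-new r b p₀ p₁ κ)
    dom : Dom (r ∧ b) p₀ p₁ ((z false ℕ.+ pa false) ℕ.+ inn false) ((z true ℕ.+ pa true) ℕ.+ inn true) (count false x) (count true x)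
    dom = Dom-+ (r ∧ b) p₀ p₁ (Dom-+ (r ∧ b) p₀ p₁ dom-new (Dom-pending (r ∧ b) (R ∩ S) P F x))
      (Dom-∑ (r ∧ b) p₀ p₁ (λ i → Dom-tok true true (r ∧ b) p₀ p₁ (srt (R ∩ flip i S) (F ∘ (false ∷_)) x) (srt (R ∩ flip i S) (F ∘ (true ∷_)) x)
         (tracker-colour R S x (F ∘ (false ∷_)) (ks false) i) (tracker-colour R S x (F ∘ (true ∷_)) (ks true) i)))

flip-set : ∀ {d} i b (S : Cube d) → flip i (S [ i ]≔ b) ≡ S [ i ]≔ not b
flip-set zero b (_ ∷ S) = refl
flip-set (suc i) b (c ∷ S) = cong (c ∷_) (flip-set i b S)

tracker-colour-indep : ∀ {d} (R S x : Cube d) F k i →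
  tracker-colour R (S [ i ]≔ false) x F k i ≡ tracker-colour R (S [ i ]≔ true) x F k i
tracker-colour-indep (r ∷ R) (b ∷ S) (c ∷ x) F (k , ks) zero = refl
tracker-colour-indep (r ∷ R) (b ∷ S) (c ∷ x) F (k , ks) (suc i)
  rewrite flip-set i false S | flip-set i true S
        | tracker-colour-indep R S x (F ∘ (false ∷_)) (ks false) i | tracker-colour-indep R S x (F ∘ (true ∷_)) (ks true) i
  = recolour-sym (r ∧ b) c _ _ _ _ _ _

tok-covers : ∀ f g k → f ≢ g → tok all f g k ≡ true ⊎ tok all g f k ≡ true
tok-covers true true k ne = ⊥-elim (ne refl)
tok-covers false false k ne = ⊥-elim (ne refl)
tok-covers true false true ne = inj₁ refl
tok-covers true false false ne = inj₂ refl
tok-covers false true true ne = inj₂ refl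
tok-covers false true false ne = inj₁ refl

ι-∑ℕ : ∀ {m} (c : Fin m → Bool) → ΣF (λ i → ⟦ c i ⟧) ≡ ι (∑ℕ (λ i → bit (c i)))
ι-∑ℕ {zero} c = refl
ι-∑ℕ {suc m} c = trans (cong₂ _+_ (head (c zero)) (ι-∑ℕ (c ∘ suc))) (sym (ι-+ (bit (c zero)) (∑ℕ (λ i → bit (c (suc i))))))
  where
  head : ∀ b → ⟦ b ⟧ ≡ ι (bit b)
  head true = refl
  head false = refl

spread : ∀ {d} → Cube d → (Cube d → Bool) → ℚ
spread R F = ∑ (λ x → 𝔼 (λ S → 𝔼 (λ S' → ⟦ srt (R ∩ S) F x xor srt (R ∩ S') F x ⟧)))

-- At each point `talagrand` applies to the tracker, with `ψ` of the charges as root. Since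
-- `potential` needs S fixed and x summed, the two are exchanged in between. 256 = 128 · 2, the 2
-- being the loss in `ψ≤2*`.
spread-bound : ∀ {d} (R : Cube d) F k (u : Cube d → ℚ) → (∀ x → 0ℚ ≤ℚ u x) → (∀ x → ι (violations R F k x) ≤ℚ u x * u x) →
  spread R F ≤ℚ 256ℚ * ∑ u
spread-bound {d} R F k u 0≤u h = begin
  spread R F ≤⟨ ∑-mono tracker ⟩
  ∑ (λ x → 128ℚ * 𝔼 (y x)) ≡⟨ ∑-scale 128ℚ (λ x → 𝔼 (y x)) ⟩
  128ℚ * ∑ (λ x → 𝔼 (y x)) ≡⟨ cong (128ℚ *_) (W-swap 1ℚ 1ℚ (1ℚ - 1/16) 1/16 y) ⟩
  128ℚ * 𝔼 (λ S → ∑ (λ x → y x S)) ≤⟨ *-monoˡ-nn {128ℚ} dec≤ (𝔼-mono (λ S → ≤-trans (potential R S [] F k) (∑-mono (λ x → ψ≤2* {violations R F k x} (0≤u x) (h x))))) ⟩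
  128ℚ * 𝔼 {d} (λ S → ∑ (λ x → 2ℚ * u x)) ≡⟨ cong (128ℚ *_) (trans (𝔼-const {d} (∑ (λ x → 2ℚ * u x))) (∑-scale 2ℚ u)) ⟩
  128ℚ * (2ℚ * ∑ u) ≡⟨ *-assoc 128ℚ 2ℚ (∑ u) ⟨
  256ℚ * ∑ u ∎
  where
  open ≤-Reasoning
  y : Cube d → Cube d → ℚ
  y x S = ψ (∑ℕ (λ i → bit (charge R S x F k i)))
  tracker : ∀ x → 𝔼 (λ S → 𝔼 (λ S' → ⟦ srt (R ∩ S) F x xor srt (R ∩ S') F x ⟧)) ≤ℚ 128ℚ * 𝔼 (y x)
  tracker x = talagrand (λ S → srt (R ∩ S) F x) (λ i S → charge R S x F k i) charged (y x) (λ S → 0≤ψ (∑ℕ (λ i → bit (charge R S x F k i))))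
    (λ S → ≤-trans (≤-reflexive (ι-∑ℕ (charge R S x F k))) (n≤ψ² (∑ℕ (λ i → bit (charge R S x F k i)))))
    where
    charged : ∀ i S → srt (R ∩ (S [ i ]≔ false)) F x ≢ srt (R ∩ (S [ i ]≔ true)) F x →
      charge R (S [ i ]≔ false) x F k i ≡ true ⊎ charge R (S [ i ]≔ true) x F k i ≡ true
    charged i S ne rewrite flip-set i false S | flip-set i true S | tracker-colour-indep R S x F k i = tok-covers _ _ _ ne

-- Distances and random partitions of the directions

∑-pair : ∀ {n} (φ : Cube (suc n) → ℚ) → ∑ φ ≡ ∑ (λ x → φ (false ∷ x) + φ (true ∷ x))
∑-pair φ = trans (cong₂ _+_ (*-identityˡ (∑ (φ ∘ (false ∷_)))) (*-identityˡ (∑ (φ ∘ (true ∷_))))) (sym (∑-+ (φ ∘ (false ∷_)) (φ ∘ (true ∷_))))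

dist : ∀ {d} → (Cube d → Bool) → (Cube d → Bool) → ℚ
dist F G = ∑ (λ x → ⟦ F x xor G x ⟧)

dist-sym : ∀ {d} (F G : Cube d → Bool) → dist F G ≡ dist G F
dist-sym F G = ∑-cong (λ x → cong ⟦_⟧ (Boolₚ.xor-comm (F x) (G x)))

dist-triangle : ∀ {d} (F G H : Cube d → Bool) → dist F H ≤ℚ dist F G + dist G H
dist-triangle F G H = ≤-trans (∑-mono (λ x → cases (F x) (G x) (H x))) (≤-reflexive (∑-+ (λ x → ⟦ F x xor G x ⟧) (λ x → ⟦ G x xor H x ⟧)))
  where
  cases : ∀ f g h → ⟦ f xor h ⟧ ≤ℚ ⟦ f xor g ⟧ + ⟦ g xor h ⟧
  cases = toWitness {a? = bool? λ f → bool? λ g → bool? λ h → ⟦ f xor h ⟧ ≤? ⟦ f xor g ⟧ + ⟦ g xor h ⟧} tt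

srt-contraction : ∀ {d} (S : Cube d) F G → dist (srt S F) (srt S G) ≤ℚ dist F G
srt-contraction [] F G = ≤-refl
srt-contraction (b ∷ S) F G = begin
  dist (srt (b ∷ S) F) (srt (b ∷ S) G) ≡⟨ ∑-pair (λ x → ⟦ srt (b ∷ S) F x xor srt (b ∷ S) G x ⟧) ⟩
  ∑ (λ x → ⟦ srt (b ∷ S) F (false ∷ x) xor srt (b ∷ S) G (false ∷ x) ⟧ + ⟦ srt (b ∷ S) F (true ∷ x) xor srt (b ∷ S) G (true ∷ x) ⟧)
    ≤⟨ ∑-mono (λ x → cases b (srt S (F ∘ (false ∷_)) x) (srt S (F ∘ (true ∷_)) x) (srt S (G ∘ (false ∷_)) x) (srt S (G ∘ (true ∷_)) x)) ⟩
  ∑ (λ x → ⟦ srt S (F ∘ (false ∷_)) x xor srt S (G ∘ (false ∷_)) x ⟧ + ⟦ srt S (F ∘ (true ∷_)) x xor srt S (G ∘ (true ∷_)) x ⟧)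
    ≡⟨ ∑-+ (λ x → ⟦ srt S (F ∘ (false ∷_)) x xor srt S (G ∘ (false ∷_)) x ⟧) (λ x → ⟦ srt S (F ∘ (true ∷_)) x xor srt S (G ∘ (true ∷_)) x ⟧) ⟩
  dist (srt S (F ∘ (false ∷_))) (srt S (G ∘ (false ∷_))) + dist (srt S (F ∘ (true ∷_))) (srt S (G ∘ (true ∷_)))
    ≤⟨ +-mono-≤ (srt-contraction S (F ∘ (false ∷_)) (G ∘ (false ∷_))) (srt-contraction S (F ∘ (true ∷_)) (G ∘ (true ∷_))) ⟩
  dist (F ∘ (false ∷_)) (G ∘ (false ∷_)) + dist (F ∘ (true ∷_)) (G ∘ (true ∷_))
    ≡⟨ cong₂ _+_ (*-identityˡ (dist (F ∘ (false ∷_)) (G ∘ (false ∷_)))) (*-identityˡ (dist (F ∘ (true ∷_)) (G ∘ (true ∷_)))) ⟨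
  dist F G ∎
  where
  open ≤-Reasoning
  cases : ∀ b p₀ p₁ q₀ q₁ → ⟦ sort₂ b false p₀ p₁ xor sort₂ b false q₀ q₁ ⟧ + ⟦ sort₂ b true p₀ p₁ xor sort₂ b true q₀ q₁ ⟧
    ≤ℚ ⟦ p₀ xor q₀ ⟧ + ⟦ p₁ xor q₁ ⟧
  cases = toWitness {a? = bool? λ b → bool? λ p₀ → bool? λ p₁ → bool? λ q₀ → bool? λ q₁ → _ ≤? ⟦ p₀ xor q₀ ⟧ + ⟦ p₁ xor q₁ ⟧} tt

-- Every violated edge is counted once, at its lower end if it is red and at its upper end if it is blue.
dist-srt≤violations : ∀ {d} (R : Cube d) F k → dist F (srt R F) ≤ℚ 2ℚ * ∑ (λ x → ι (violations R F k x))
dist-srt≤violations [] F k = ≤-reflexive (xor-self (F []))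
  where
  xor-self : ∀ b → ⟦ b xor b ⟧ ≡ 2ℚ * 0ℚ
  xor-self true = refl
  xor-self false = refl
dist-srt≤violations {suc d} (r ∷ R) F (k , ks) = begin
  dist F (srt (r ∷ R) F) ≡⟨ ∑-pair (λ x → ⟦ F x xor srt (r ∷ R) F x ⟧) ⟩
  ∑ (λ x → ⟦ F (false ∷ x) xor srt (r ∷ R) F (false ∷ x) ⟧ + ⟦ F (true ∷ x) xor srt (r ∷ R) F (true ∷ x) ⟧)
    ≤⟨ ∑-mono (λ x → cases r (F (false ∷ x)) (F (true ∷ x)) (srt R (F ∘ (false ∷_)) x) (srt R (F ∘ (true ∷_)) x) (k x)) ⟩
  ∑ (λ x → 2ℚ * (t false x + t true x) + (e false x + e true x))
    ≡⟨ ∑-+ (λ x → 2ℚ * (t false x + t true x)) (λ x → e false x + e true x) ⟩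
  ∑ (λ x → 2ℚ * (t false x + t true x)) + ∑ (λ x → e false x + e true x)
    ≡⟨ cong₂ _+_ (trans (∑-scale 2ℚ (λ x → t false x + t true x)) (cong (2ℚ *_) (∑-+ (t false) (t true)))) (∑-+ (e false) (e true)) ⟩
  2ℚ * (∑ (t false) + ∑ (t true)) + (∑ (e false) + ∑ (e true))
    ≤⟨ +-monoʳ-≤ (2ℚ * (∑ (t false) + ∑ (t true))) (+-mono-≤ (dist-srt≤violations R (F ∘ (false ∷_)) (ks false)) (dist-srt≤violations R (F ∘ (true ∷_)) (ks true))) ⟩
  2ℚ * (∑ (t false) + ∑ (t true)) + (2ℚ * ∑ (w false) + 2ℚ * ∑ (w true))
    ≡⟨ solve 4 (λ a b c d → con 2ℚ :* (a :+ b) :+ (con 2ℚ :* c :+ con 2ℚ :* d) := con 2ℚ :* (con 1ℚ :* (a :+ c) :+ con 1ℚ :* (b :+ d))) refl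
         (∑ (t false)) (∑ (t true)) (∑ (w false)) (∑ (w true)) ⟩
  2ℚ * (1ℚ * (∑ (t false) + ∑ (w false)) + 1ℚ * (∑ (t true) + ∑ (w true)))
    ≡⟨ cong₂ (λ u v → 2ℚ * (1ℚ * u + 1ℚ * v)) (collect false) (collect true) ⟨
  2ℚ * ∑ (λ x → ι (violations (r ∷ R) F (k , ks) x)) ∎
  where
  open ≤-Reasoning
  t e w : Bool → Cube d → ℚ
  t c x = ι (bit (tok (violation r c) (F (c ∷ x)) (F (not c ∷ x)) (k x)))
  e c x = ⟦ F (c ∷ x) xor srt R (F ∘ (c ∷_)) x ⟧
  w c x = ι (violations R (F ∘ (c ∷_)) (ks c) x)
  collect : ∀ c → ∑ (λ x → ι (violations (r ∷ R) F (k , ks) (c ∷ x))) ≡ ∑ (t c) + ∑ (w c)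
  collect c = trans (∑-cong (λ x → ι-+ (bit (tok (violation r c) (F (c ∷ x)) (F (not c ∷ x)) (k x))) (violations R (F ∘ (c ∷_)) (ks c) x))) (∑-+ (t c) (w c))
  cases : ∀ r p₀ p₁ q₀ q₁ k → ⟦ p₀ xor sort₂ r false q₀ q₁ ⟧ + ⟦ p₁ xor sort₂ r true q₀ q₁ ⟧
    ≤ℚ 2ℚ * (ι (bit (tok (violation r false) p₀ p₁ k)) + ι (bit (tok (violation r true) p₁ p₀ k))) + (⟦ p₀ xor q₀ ⟧ + ⟦ p₁ xor q₁ ⟧)
  cases = toWitness {a? = bool? λ r → bool? λ p₀ → bool? λ p₁ → bool? λ q₀ → bool? λ q₁ → bool? λ k → _ ≤?
    2ℚ * (ι (bit (tok (violation r false) p₀ p₁ k)) + ι (bit (tok (violation r true) p₁ p₀ k))) + (⟦ p₀ xor q₀ ⟧ + ⟦ p₁ xor q₁ ⟧)} tt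

-- Order properties of sorting

sort₂-mono : ∀ b c {p₀ p₁ q₀ q₁} → p₀ ≤ᵇ q₀ → p₁ ≤ᵇ q₁ → sort₂ b c p₀ p₁ ≤ᵇ sort₂ b c q₀ q₁
sort₂-mono false false h₀ h₁ = h₀
sort₂-mono false true h₀ h₁ = h₁
sort₂-mono true false f≤t h₁ = Boolₚ.≤-minimum _
sort₂-mono true false {false} b≤b h₁ = b≤b
sort₂-mono true false {true} b≤b h₁ = h₁
sort₂-mono true true {false} f≤t h₁ = Boolₚ.≤-maximum _
sort₂-mono true true {false} b≤b h₁ = h₁
sort₂-mono true true {true} b≤b h₁ = b≤b

sort₂-ordered : ∀ b {p₀ p₁} → p₀ ≤ᵇ p₁ → sort₂ b false p₀ p₁ ≤ᵇ sort₂ b true p₀ p₁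
sort₂-ordered false h = h
sort₂-ordered true f≤t = f≤t
sort₂-ordered true {false} b≤b = b≤b
sort₂-ordered true {true} b≤b = b≤b

srt-mono : ∀ {d} (S : Cube d) {F G} → (∀ x → F x ≤ᵇ G x) → ∀ x → srt S F x ≤ᵇ srt S G x
srt-mono [] h [] = h []
srt-mono (b ∷ S) h (c ∷ x) = sort₂-mono b c (srt-mono S (h ∘ (false ∷_)) x) (srt-mono S (h ∘ (true ∷_)) x)

IncreasingIn : ∀ {d} → Cube d → (Cube d → Bool) → Set
IncreasingIn [] h = ⊤
IncreasingIn (b ∷ S) h = (b ≡ true → ∀ x → h (false ∷ x) ≤ᵇ h (true ∷ x)) × (∀ c → IncreasingIn S (h ∘ (c ∷_)))

increasing-sort₂ : ∀ {d} (S : Cube d) b c {g h} → IncreasingIn S g → IncreasingIn S h → IncreasingIn S (λ x → sort₂ b c (g x) (h x))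
increasing-sort₂ [] b c _ _ = tt
increasing-sort₂ (_ ∷ S) b c (g₀ , gs) (h₀ , hs) = (λ e x → sort₂-mono b c (g₀ e x) (h₀ e x)) , (λ a → increasing-sort₂ S b c (gs a) (hs a))

srt-increasing : ∀ {d} (S : Cube d) F → IncreasingIn S (srt S F)
srt-increasing [] F = tt
srt-increasing (b ∷ S) F = ordered , λ c → increasing-sort₂ S b c (srt-increasing S (F ∘ (false ∷_))) (srt-increasing S (F ∘ (true ∷_)))
  where
  ∧≤∨ : ∀ p q → p ∧ q ≤ᵇ p ∨ q
  ∧≤∨ false q = Boolₚ.≤-minimum q
  ∧≤∨ true q = Boolₚ.≤-maximum q
  ordered : b ≡ true → ∀ x → srt (b ∷ S) F (false ∷ x) ≤ᵇ srt (b ∷ S) F (true ∷ x)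
  ordered refl x = ∧≤∨ (srt S (F ∘ (false ∷_)) x) (srt S (F ∘ (true ∷_)) x)

srt-preserves-increasing : ∀ {d} (S T : Cube d) F → IncreasingIn T F → IncreasingIn T (srt S F)
srt-preserves-increasing [] [] F h = tt
srt-preserves-increasing (b ∷ S) (t ∷ T) F (h₀ , hs) = (λ e x → sort₂-ordered b (srt-mono S (h₀ e) x)) ,
  λ c → increasing-sort₂ T b c (srt-preserves-increasing S T _ (hs false)) (srt-preserves-increasing S T _ (hs true))

srt-fixes-increasing : ∀ {d} (S : Cube d) F → IncreasingIn S F → ∀ x → srt S F x ≡ F x
srt-fixes-increasing [] F h [] = refl
srt-fixes-increasing (b ∷ S) F (h₀ , hs) (c ∷ x) = trans
  (cong₂ (sort₂ b c) (srt-fixes-increasing S _ (hs false) x) (srt-fixes-increasing S _ (hs true) x)) (sorted b c h₀)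
  where
  sorted : ∀ b c → (b ≡ true → ∀ x → F (false ∷ x) ≤ᵇ F (true ∷ x)) → sort₂ b c (F (false ∷ x)) (F (true ∷ x)) ≡ F (c ∷ x)
  sorted false false _ = refl
  sorted false true _ = refl
  sorted true c h with F (false ∷ x) in e₀ | F (true ∷ x) in e₁ | h refl x
  sorted true false h | false | true | f≤t = sym e₀
  sorted true true h | false | true | f≤t = sym e₁
  sorted true false h | false | false | b≤b = sym e₀
  sorted true true h | false | false | b≤b = sym e₁
  sorted true false h | true | true | b≤b = sym e₀
  sorted true true h | true | true | b≤b = sym e₁

srts : ∀ {d m} → (Fin m → Cube d) → (Cube d → Bool) → Cube d → Bool
srts {m = zero} S F = F
srts {m = suc m} S F = srt (S zero) (srts (S ∘ suc) F)

srts-increasing : ∀ {d m} (S : Fin m → Cube d) F i → IncreasingIn (S i) (srts S F)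
srts-increasing S F zero = srt-increasing (S zero) _
srts-increasing S F (suc i) = srt-preserves-increasing (S zero) (S (suc i)) _ (srts-increasing (S ∘ suc) F i)

dist-cong : ∀ {d} {F F' G G' : Cube d → Bool} → (∀ x → F x ≡ F' x) → (∀ x → G x ≡ G' x) → dist F G ≡ dist F' G'
dist-cong h h' = ∑-cong (λ x → cong₂ (λ f g → ⟦ f xor g ⟧) (h x) (h' x))

-- `srt T` fixes `srt T F` and is a contraction, so it moves `H` by at most twice the distance from
-- `H` to `srt T F`. Contraction also carries the displacements of the other sorts through unchanged
-- or smaller.
dist-srts : ∀ {d m} (S : Fin m → Cube d) (F H : Cube d → Bool) → dist H (srts S H) ≤ℚ ΣF (λ i → 2ℚ * dist H (srt (S i) F))
dist-srts {m = zero} S F H = ≤-reflexive (zero-dist H)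
  where
  xor-self : ∀ b → ⟦ b xor b ⟧ ≡ 0ℚ
  xor-self true = refl
  xor-self false = refl
  zero-dist : ∀ {d} (H : Cube d → Bool) → dist H H ≡ 0ℚ
  zero-dist {d} H = trans (∑-cong (λ x → trans (xor-self (H x)) (sym (*-zeroˡ 0ℚ)))) (trans (∑-scale {d} 0ℚ (λ _ → 0ℚ)) (*-zeroˡ (∑ {d} (λ _ → 0ℚ))))
dist-srts {m = suc m} S F H = begin
  dist H (srt T (srts (S ∘ suc) H)) ≤⟨ dist-triangle H (srt T H) (srt T (srts (S ∘ suc) H)) ⟩
  dist H (srt T H) + dist (srt T H) (srt T (srts (S ∘ suc) H)) ≤⟨ +-mono-≤ two (≤-trans (srt-contraction T H (srts (S ∘ suc) H)) (dist-srts (S ∘ suc) F H)) ⟩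
  2ℚ * dist H (srt T F) + ΣF (λ i → 2ℚ * dist H (srt (S (suc i)) F)) ∎
  where
  open ≤-Reasoning
  T : Cube _
  T = S zero
  idem : ∀ x → srt T (srt T F) x ≡ srt T F x
  idem = srt-fixes-increasing T (srt T F) (srt-increasing T F)
  two : dist H (srt T H) ≤ℚ 2ℚ * dist H (srt T F)
  two = begin
    dist H (srt T H) ≤⟨ dist-triangle H (srt T F) (srt T H) ⟩
    dist H (srt T F) + dist (srt T F) (srt T H) ≡⟨ cong (dist H (srt T F) +_) (dist-cong (λ x → sym (idem x)) (λ x → refl)) ⟩
    dist H (srt T F) + dist (srt T (srt T F)) (srt T H) ≤⟨ +-monoʳ-≤ (dist H (srt T F)) (srt-contraction T (srt T F) H) ⟩
    dist H (srt T F) + dist (srt T F) H ≡⟨ cong (dist H (srt T F) +_) (dist-sym (srt T F) H) ⟩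
    dist H (srt T F) + dist H (srt T F) ≡⟨ solve 1 (λ a → a :+ a := con 2ℚ :* a) refl (dist H (srt T F)) ⟩
    2ℚ * dist H (srt T F) ∎

_==_ : ∀ {m} → Fin m → Fin m → Bool
zero == zero = true
zero == suc j = false
suc i == zero = false
suc i == suc j = i == j

==-refl : ∀ {m} (i : Fin m) → (i == i) ≡ true
==-refl zero = refl
==-refl (suc i) = ==-refl i

ΣF-const : ∀ m k → ΣF {m} (λ _ → k) ≡ ι m * k
ΣF-const zero k = sym (*-zeroˡ k)
ΣF-const (suc m) k = trans (cong (k +_) (ΣF-const m k)) (trans (solve 2 (λ a k → k :+ a :* k := (con 1ℚ :+ a) :* k) refl (ι m) k) (cong (_* k) (sym (ι-suc m))))

ΣF-== : ∀ {m} (j : Fin (suc m)) (χ : Bool → ℚ) → ΣF (λ i → χ (j == i)) ≡ χ true + ι m * χ false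
ΣF-== {m} zero χ = cong (χ true +_) (ΣF-const m (χ false))
ΣF-== {suc m} (suc j) χ = trans (cong (χ false +_) (ΣF-== j χ)) (trans
  (solve 3 (λ a f t → f :+ (t :+ a :* f) := t :+ (con 1ℚ :+ a) :* f) refl (ι m) (χ false) (χ true)) (cong (λ u → χ true + u * χ false) (sym (ι-suc m))))

-- Random 16-colourings of the directions

Colouring : ℕ → Set
Colouring d = Vec (Fin 16) d

part : ∀ {d} → Fin 16 → Colouring d → Cube d
part j c = map (j ==_) c

A : ∀ {d} → (Colouring d → ℚ) → ℚ
A {zero} φ = φ []
A {suc d} φ = 1/16 * ΣF (λ b → A (φ ∘ (b ∷_)))

A-cong : ∀ {d} {φ χ : Colouring d → ℚ} → (∀ c → φ c ≡ χ c) → A φ ≡ A χ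
A-cong {zero} h = h []
A-cong {suc d} h = cong (1/16 *_) (ΣF-cong (λ b → A-cong (h ∘ (b ∷_))))

A-mono : ∀ {d} {φ χ : Colouring d → ℚ} → (∀ c → φ c ≤ℚ χ c) → A φ ≤ℚ A χ
A-mono {zero} h = h []
A-mono {suc d} h = *-monoˡ-nn 0≤1/16 (ΣF-mono (λ b → A-mono (h ∘ (b ∷_))))

A-lin : ∀ {d} k l (φ χ : Colouring d → ℚ) → A (λ c → k * φ c + l * χ c) ≡ k * A φ + l * A χ
A-lin {zero} k l φ χ = refl
A-lin {suc d} k l φ χ = trans (cong (1/16 *_) (trans (ΣF-cong (λ b → A-lin k l (φ ∘ (b ∷_)) (χ ∘ (b ∷_))))
    (ΣF-lin k l (λ b → A (φ ∘ (b ∷_))) (λ b → A (χ ∘ (b ∷_))))))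
  (solve 4 (λ k l u v → con 1/16 :* (k :* u :+ l :* v) := k :* (con 1/16 :* u) :+ l :* (con 1/16 :* v)) refl k l
    (ΣF (λ b → A (φ ∘ (b ∷_)))) (ΣF (λ b → A (χ ∘ (b ∷_)))))

A-const : ∀ d k → A {d} (λ _ → k) ≡ k
A-const zero k = refl
A-const (suc d) k = trans (cong (1/16 *_) (trans (ΣF-cong {16} (λ _ → A-const d k)) (ΣF-const 16 k)))
  (solve 1 (λ k → con 1/16 :* (con (ι 16) :* k) := k) refl k)

-- A direction gets colour j with probability 1/16, independently of the other directions. Each
-- single part thus has the law of `𝔼`, although different parts are dependent.
A-part : ∀ {d} j (φ : Cube d → ℚ) → A (λ c → φ (part j c)) ≡ 𝔼 φ
A-part {zero} j φ = refl
A-part {suc d} j φ = trans (cong (1/16 *_) (trans (ΣF-cong (λ b → A-part j (φ ∘ ((j == b) ∷_)))) (ΣF-== j (λ b → 𝔼 (φ ∘ (b ∷_))))))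
  (solve 2 (λ t f → con 1/16 :* (t :+ con (ι 15) :* f) := con (1ℚ - 1/16) :* f :+ con 1/16 :* t) refl (𝔼 (φ ∘ (true ∷_))) (𝔼 (φ ∘ (false ∷_))))

A-ΣF : ∀ {d m} (φ : Fin m → Colouring d → ℚ) → A (λ c → ΣF (λ i → φ i c)) ≡ ΣF (λ i → A (φ i))
A-ΣF {d} {zero} φ = A-const d 0ℚ
A-ΣF {d} {suc m} φ = trans (A-cong (λ c → sym (cong₂ _+_ (*-identityˡ (φ zero c)) (*-identityˡ (ΣF (λ i → φ (suc i) c))))))
  (trans (A-lin 1ℚ 1ℚ (φ zero) (λ c → ΣF (λ i → φ (suc i) c)))
    (cong₂ _+_ (*-identityˡ (A (φ zero))) (trans (*-identityˡ (A (λ c → ΣF (λ i → φ (suc i) c)))) (A-ΣF (φ ∘ suc)))))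

increasing-parts : ∀ {d} (R : Cube d) c F → (∀ j → IncreasingIn (R ∩ part j c) F) → IncreasingIn R F
increasing-parts [] [] F h = tt
increasing-parts (r ∷ R) (b ∷ c) F h = (λ e → proj₁ (h b) (cong₂ _∧_ e (==-refl b))) , (λ a → increasing-parts R c (F ∘ (a ∷_)) (λ j → proj₂ (h j) a))

module _ {d} (F : Cube d → Bool) where

  sorted-on : Cube d → Cube d → Cube d → Bool
  sorted-on R S = srt (R ∩ S) F

  -- `h`, which is `F₀` sorted along all parts, is increasing in all directions of R and so fixed by
  -- `srt R`; contraction bounds the left side by twice the distance from `F` to `h`. The way to `h`
  -- goes through `F₀`, where `dist-srts` applies.
  partition-bound : ∀ R c → dist F (srt R F) ≤ℚ
    2ℚ * dist F (sorted-on R (part zero c)) + ΣF (λ j → 4ℚ * dist (sorted-on R (part zero c)) (sorted-on R (part j c)))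
  partition-bound R c = begin
    dist F (srt R F) ≤⟨ dist-triangle F h (srt R F) ⟩
    dist F h + dist h (srt R F) ≡⟨ cong (dist F h +_) (dist-cong (λ x → sym (srt-fixes-increasing R h h-increasing x)) (λ x → refl)) ⟩
    dist F h + dist (srt R h) (srt R F) ≤⟨ +-monoʳ-≤ (dist F h) (≤-trans (srt-contraction R h F) (≤-reflexive (dist-sym h F))) ⟩
    dist F h + dist F h ≡⟨ solve 1 (λ a → a :+ a := con 2ℚ :* a) refl (dist F h) ⟩
    2ℚ * dist F h ≤⟨ *-monoˡ-nn {2ℚ} dec≤ (≤-trans (dist-triangle F F₀ h) (+-monoʳ-≤ (dist F F₀) (dist-srts parts F F₀))) ⟩
    2ℚ * (dist F F₀ + ΣF (λ j → 2ℚ * δ j)) ≡⟨ *-distribˡ-+ 2ℚ (dist F F₀) (ΣF (λ j → 2ℚ * δ j)) ⟩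
    2ℚ * dist F F₀ + 2ℚ * ΣF (λ j → 2ℚ * δ j) ≡⟨ cong (2ℚ * dist F F₀ +_) (trans (sym (ΣF-scale 2ℚ (λ j → 2ℚ * δ j))) (ΣF-cong (λ j → sym (*-assoc 2ℚ 2ℚ (δ j))))) ⟩
    2ℚ * dist F F₀ + ΣF (λ j → 4ℚ * δ j) ∎
    where
    open ≤-Reasoning
    parts : Fin 16 → Cube d
    parts j = R ∩ part j c
    F₀ h : Cube d → Bool
    F₀ = srt (parts zero) F
    h = srts parts F₀
    δ : Fin 16 → ℚ
    δ j = dist F₀ (srt (parts j) F)
    h-increasing : IncreasingIn R h
    h-increasing = increasing-parts R c h (srts-increasing parts F₀)

  discrepancy : Cube d → Cube d → ℚ
  discrepancy R S = 𝔼 (λ S' → dist (sorted-on R S) (sorted-on R S'))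

  𝔼-discrepancy : ∀ R → 𝔼 (discrepancy R) ≡ spread R F
  𝔼-discrepancy R = trans (𝔼-cong (λ S → sym (W-swap 1ℚ 1ℚ (1ℚ - 1/16) 1/16 (λ x S' → ⟦ sorted-on R S x xor sorted-on R S' x ⟧))))
    (sym (W-swap 1ℚ 1ℚ (1ℚ - 1/16) 1/16 (λ x S → 𝔼 (λ S' → ⟦ sorted-on R S x xor sorted-on R S' x ⟧))))

  -- Two parts of one colouring are not independent. Comparing each of them with an independent
  -- third set leaves only independent pairs, for which the mean is `spread`.
  dist≤discrepancy : ∀ R S T → dist (sorted-on R S) (sorted-on R T) ≤ℚ discrepancy R S + discrepancy R T
  dist≤discrepancy R S T = subst₂ _≤ℚ_ (𝔼-const {d} (dist (sorted-on R S) (sorted-on R T)))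
    (trans (𝔼-+ (λ S' → dist (sorted-on R S) (sorted-on R S')) (λ S' → dist (sorted-on R S') (sorted-on R T)))
      (cong (discrepancy R S +_) (𝔼-cong (λ S' → dist-sym (sorted-on R S') (sorted-on R T)))))
    (𝔼-mono (λ S' → dist-triangle (sorted-on R S) (sorted-on R S') (sorted-on R T)))

  recursion : ∀ R → dist F (srt R F) ≤ℚ 2ℚ * 𝔼 (λ S → dist F (sorted-on R S)) + 128ℚ * spread R F
  recursion R = begin
    dist F (srt R F) ≡⟨ A-const d (dist F (srt R F)) ⟨
    A {d} (λ c → dist F (srt R F)) ≤⟨ A-mono (λ c → ≤-trans (partition-bound R c)
        (+-monoʳ-≤ (2ℚ * D₀ (part zero c)) (ΣF-mono (λ j → ≤-trans (*-monoˡ-nn {4ℚ} dec≤ (dist≤discrepancy R (part zero c) (part j c)))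
           (≤-reflexive (*-distribˡ-+ 4ℚ (q (part zero c)) (q (part j c)))))))) ⟩
    A (λ c → 2ℚ * D₀ (part zero c) + X c) ≡⟨ A-cong (λ c → cong (2ℚ * D₀ (part zero c) +_) (*-identityˡ (X c))) ⟨
    A (λ c → 2ℚ * D₀ (part zero c) + 1ℚ * X c) ≡⟨ A-lin 2ℚ 1ℚ (λ c → D₀ (part zero c)) X ⟩
    2ℚ * A (λ c → D₀ (part zero c)) + 1ℚ * A X ≡⟨ cong₂ (λ u v → 2ℚ * u + 1ℚ * v) (A-part zero D₀) A-X ⟩
    2ℚ * 𝔼 D₀ + 1ℚ * (16ℚ * (4ℚ * spread R F + 4ℚ * spread R F)) ≡⟨ cong (2ℚ * 𝔼 D₀ +_)
        (solve 1 (λ s → con 1ℚ :* (con 16ℚ :* (con 4ℚ :* s :+ con 4ℚ :* s)) := con 128ℚ :* s) refl (spread R F)) ⟩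
    2ℚ * 𝔼 D₀ + 128ℚ * spread R F ∎
    where
    open ≤-Reasoning
    q D₀ : Cube d → ℚ
    q = discrepancy R
    D₀ S = dist F (sorted-on R S)
    X : Colouring d → ℚ
    X c = ΣF (λ j → 4ℚ * q (part zero c) + 4ℚ * q (part j c))
    A-X : A X ≡ 16ℚ * (4ℚ * spread R F + 4ℚ * spread R F)
    A-X = trans (A-ΣF (λ j c → 4ℚ * q (part zero c) + 4ℚ * q (part j c)))
      (trans (ΣF-cong (λ j → trans (A-lin 4ℚ 4ℚ (λ c → q (part zero c)) (λ c → q (part j c)))
          (cong₂ (λ u v → 4ℚ * u + 4ℚ * v) (trans (A-part zero q) (𝔼-discrepancy R)) (trans (A-part j q) (𝔼-discrepancy R)))))
        (ΣF-const 16 (4ℚ * spread R F + 4ℚ * spread R F)))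

bit≤1 : ∀ b → bit b ≤ 1
bit≤1 true = ℕₚ.≤-refl
bit≤1 false = ℕ.z≤n

violations≤d : ∀ {d} (R : Cube d) F k x → violations R F k x ≤ d
violations≤d [] F k [] = ℕ.z≤n
violations≤d (r ∷ R) F (k , ks) (c ∷ x) = ℕₚ.+-mono-≤ (bit≤1 _) (violations≤d R (F ∘ (c ∷_)) (ks c) x)

bit-violation : ∀ r b c f g k → ι (bit (tok (violation (r ∧ b) c) f g k)) ≡ ι (bit (tok (violation r c) f g k)) * ⟦ b ⟧
bit-violation = toWitness {a? = bool? λ r → bool? λ b → bool? λ c → bool? λ f → bool? λ g → bool? λ k →
  ι (bit (tok (violation (r ∧ b) c) f g k)) ≟ ι (bit (tok (violation r c) f g k)) * ⟦ b ⟧} tt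

bit-violation-∩ : ∀ r b c f g k → bit (tok (violation (r ∧ b) c) f g k) ≤ bit (tok (violation r c) f g k)
bit-violation-∩ = toWitness {a? = bool? λ r → bool? λ b → bool? λ c → bool? λ f → bool? λ g → bool? λ k →
  bit (tok (violation (r ∧ b) c) f g k) ℕₚ.≤? bit (tok (violation r c) f g k)} tt

violations-∩ : ∀ {d} (R S : Cube d) F k x → violations (R ∩ S) F k x ≤ violations R F k x
violations-∩ [] [] F k [] = ℕ.z≤n
violations-∩ (r ∷ R) (b ∷ S) F (k , ks) (c ∷ x) = ℕₚ.+-mono-≤ (bit-violation-∩ r b c (F (c ∷ x)) (F (not c ∷ x)) (k x)) (violations-∩ R S (F ∘ (c ∷_)) (ks c) x)

𝔼-violations : ∀ {d} (R : Cube d) F k x → 𝔼 (λ S → ι (violations (R ∩ S) F k x)) ≡ 1/16 * ι (violations R F k x)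
𝔼-violations [] F k [] = sym (*-zeroʳ 1/16)
𝔼-violations {suc d} (r ∷ R) F (k , ks) (c ∷ x) = trans (cong₂ (λ u v → (1ℚ - 1/16) * u + 1/16 * v) (half false) (half true))
  (trans (solve 2 (λ t w → con (1ℚ - 1/16) :* (t :* con 0ℚ :+ con 1/16 :* w) :+ con 1/16 :* (t :* con 1ℚ :+ con 1/16 :* w) := con 1/16 :* (t :+ w)) refl t w)
    (cong (1/16 *_) (sym (ι-+ (bit (tok (violation r c) (F (c ∷ x)) (F (not c ∷ x)) (k x))) (violations R (F ∘ (c ∷_)) (ks c) x)))))
  where
  t w : ℚ
  t = ι (bit (tok (violation r c) (F (c ∷ x)) (F (not c ∷ x)) (k x)))
  w = ι (violations R (F ∘ (c ∷_)) (ks c) x)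
  half : ∀ b → 𝔼 (λ S → ι (violations ((r ∷ R) ∩ (b ∷ S)) F (k , ks) (c ∷ x))) ≡ t * ⟦ b ⟧ + 1/16 * w
  half b = trans (𝔼-cong (λ S → trans (ι-+ (bit (tok (violation (r ∧ b) c) (F (c ∷ x)) (F (not c ∷ x)) (k x))) (violations (R ∩ S) (F ∘ (c ∷_)) (ks c) x))
      (cong (_+ ι (violations (R ∩ S) (F ∘ (c ∷_)) (ks c) x)) (bit-violation r b c (F (c ∷ x)) (F (not c ∷ x)) (k x)))))
    (trans (𝔼-+ {d} (λ _ → t * ⟦ b ⟧) (λ S → ι (violations (R ∩ S) (F ∘ (c ∷_)) (ks c) x)))
      (cong₂ _+_ (𝔼-const {d} (t * ⟦ b ⟧)) (𝔼-violations R (F ∘ (c ∷_)) (ks c) x)))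

-- Iterating the recursion

¼ℚ : ℚ
¼ℚ = (ℤ.+ 1) / 4

⅛ℚ : ℚ
⅛ℚ = (ℤ.+ 1) / 8

-- The solution of K = 2 · K / 4 + 128 · 256, the balance of the main terms in `iterate`.
K : ℚ
K = (ℤ.+ 65536) / 1

module _ {d} (F : Cube d → Bool) (k : EdgeColouring d) where

  IsRootBound : Cube d → (Cube d → ℚ) → Set
  IsRootBound R u = ∀ x → 0ℚ ≤ℚ u x × ι (violations R F k x) ≤ℚ u x * u x

  -- The arithmetic-geometric mean bound sqrt n ≤ (u / 4 + 4 n / u) / 2 for the root of the number n of violations in R ∩ S;
  -- on average over S the number n is at most u * u / 16.
  restricted : Cube d → (Cube d → ℚ) → Cube d → Cube d → ℚ
  restricted R u S x = ⅛ℚ * u x + 2ℚ * inv (u x) * ι (violations (R ∩ S) F k x)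

  restricted-bound : ∀ R u → IsRootBound R u → ∀ S → IsRootBound (R ∩ S) (restricted R u S)
  restricted-bound R u h S x = nonneg , root
    where
    v w i : ℚ
    v = ι (violations (R ∩ S) F k x)
    w = restricted R u S x
    i = inv (u x)
    0≤u = proj₁ (h x)
    nonneg : 0ℚ ≤ℚ w
    nonneg = +-nonneg (*-nonneg {⅛ℚ} dec≤ 0≤u) (*-nonneg (*-nonneg {2ℚ} dec≤ (inv-nonneg 0≤u)) (0≤ι (violations (R ∩ S) F k x)))
    v≤u² : v ≤ℚ u x * u x
    v≤u² = ≤-trans (ι-mono (violations-∩ R S F k x)) (proj₂ (h x))
    root-cases : Dec (u x ≡ 0ℚ) → v ≤ℚ w * w
    -- If the root bound vanishes at `x`, there are no violations to count, so the default value of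
    -- `inv` does no harm.
    root-cases (yes e) = ≤-trans v≤u² (≤-trans (≤-reflexive (trans (cong (_* u x) e) (*-zeroˡ (u x)))) (sq-nonneg w))
    root-cases (no ne) = subst (_≤ℚ w * w) (trans (cong (v *_) (*-inv ne)) (*-identityʳ v))
          (≤-by (sq-nonneg (⅛ℚ * u x - 2ℚ * i * v))
            (solve 3 (λ u i v → v :* (u :* i) :+ (con ⅛ℚ :* u :- con 2ℚ :* i :* v) :* (con ⅛ℚ :* u :- con 2ℚ :* i :* v)
              := (con ⅛ℚ :* u :+ con 2ℚ :* i :* v) :* (con ⅛ℚ :* u :+ con 2ℚ :* i :* v)) refl (u x) i v))
    root : v ≤ℚ w * w
    root = root-cases (u x ≟ 0ℚ)

  𝔼-restricted : ∀ R u → IsRootBound R u → ∀ x → 𝔼 (λ S → restricted R u S x) ≤ℚ ¼ℚ * u x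
  𝔼-restricted R u h x = begin
    𝔼 (λ S → ⅛ℚ * u x + 2ℚ * i * ι (violations (R ∩ S) F k x)) ≡⟨ 𝔼-+ {d} (λ _ → ⅛ℚ * u x) (λ S → 2ℚ * i * ι (violations (R ∩ S) F k x)) ⟩
    𝔼 {d} (λ _ → ⅛ℚ * u x) + 𝔼 (λ S → 2ℚ * i * ι (violations (R ∩ S) F k x))
      ≡⟨ cong₂ _+_ (𝔼-const {d} (⅛ℚ * u x)) (trans (𝔼-scale (2ℚ * i) (λ S → ι (violations (R ∩ S) F k x))) (cong (2ℚ * i *_) (𝔼-violations R F k x))) ⟩
    ⅛ℚ * u x + 2ℚ * i * (1/16 * v) ≡⟨ solve 3 (λ u i v → con ⅛ℚ :* u :+ con 2ℚ :* i :* (con 1/16 :* v) := con ⅛ℚ :* u :+ con ⅛ℚ :* (i :* v)) refl (u x) i v ⟩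
    ⅛ℚ * u x + ⅛ℚ * (i * v) ≤⟨ +-monoʳ-≤ (⅛ℚ * u x) (*-monoˡ-nn {⅛ℚ} dec≤ iv≤u) ⟩
    ⅛ℚ * u x + ⅛ℚ * u x ≡⟨ solve 1 (λ u → con ⅛ℚ :* u :+ con ⅛ℚ :* u := con ¼ℚ :* u) refl (u x) ⟩
    ¼ℚ * u x ∎
    where
    open ≤-Reasoning
    i v : ℚ
    i = inv (u x)
    v = ι (violations R F k x)
    iu²≤ : i * v ≤ℚ u x * i * u x
    iu²≤ = ≤-trans (*-monoˡ-nn (inv-nonneg (proj₁ (h x))) (proj₂ (h x))) (≤-reflexive (solve 2 (λ i u → i :* (u :* u) := u :* i :* u) refl i (u x)))
    cases : Dec (u x ≡ 0ℚ) → u x * i * u x ≡ u x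
    cases (no ne) = trans (cong (_* u x) (*-inv ne)) (*-identityˡ (u x))
    cases (yes e) = trans (cong (u x * i *_) e) (trans (*-zeroʳ (u x * i)) (sym e))
    iv≤u : i * v ≤ℚ u x
    iv≤u = ≤-trans iu²≤ (≤-reflexive (cases (u x ≟ 0ℚ)))

  -- Induction on the number of rounds, for all R and u at once. A round multiplies the remainder by
  -- 2 · 1/16, while only a factor 1/2 is claimed; the slack is the term with `¾`.
  iterate : ∀ l R u → IsRootBound R u →
    dist F (srt R F) ≤ℚ K * ∑ u + 2ℚ * half^ l * ∑ (λ x → ι (violations R F k x))
  iterate zero R u h = ≤-trans (dist-srt≤violations R F k)
    (≤-by (*-nonneg {K} dec≤ (∑-nonneg (λ x → proj₁ (h x))))
      (solve 2 (λ s v → con 2ℚ :* v :+ con K :* s := con K :* s :+ con 2ℚ :* con 1ℚ :* v) refl (∑ u) (∑ (λ x → ι (violations R F k x)))))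
  iterate (suc l) R u h = begin
    dist F (srt R F) ≤⟨ recursion F R ⟩
    2ℚ * 𝔼 (λ S → dist F (srt (R ∩ S) F)) + 128ℚ * spread R F
      ≤⟨ +-mono-≤ (*-monoˡ-nn {2ℚ} dec≤ (𝔼-mono (λ S → iterate l (R ∩ S) (restricted R u S) (restricted-bound R u h S))))
           (*-monoˡ-nn {128ℚ} dec≤ (spread-bound R F k u (λ x → proj₁ (h x)) (λ x → proj₂ (h x)))) ⟩
    2ℚ * 𝔼 (λ S → K * ∑ (restricted R u S) + 2ℚ * half^ l * V S) + 128ℚ * (256ℚ * ∑ u)
      ≡⟨ cong (λ e → 2ℚ * e + 128ℚ * (256ℚ * ∑ u)) (𝔼-lin K (2ℚ * half^ l) (λ S → ∑ (restricted R u S)) V) ⟩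
    2ℚ * (K * 𝔼 (λ S → ∑ (restricted R u S)) + 2ℚ * half^ l * 𝔼 V) + 128ℚ * (256ℚ * ∑ u)
      ≤⟨ +-monoˡ-≤ (128ℚ * (256ℚ * ∑ u)) (*-monoˡ-nn {2ℚ} dec≤ (+-mono-≤ (*-monoˡ-nn {K} dec≤ 𝔼-root) (≤-reflexive (cong (2ℚ * half^ l *_) 𝔼-V)))) ⟩
    2ℚ * (K * (¼ℚ * ∑ u) + 2ℚ * half^ l * (1/16 * ∑ v)) + 128ℚ * (256ℚ * ∑ u)
      ≤⟨ ≤-by (*-nonneg {¾} dec≤ (*-nonneg (0≤half^ l) (∑-nonneg (λ x → 0≤ι (violations R F k x)))))
           (solve 3 (λ s h v → con 2ℚ :* (con K :* (con ¼ℚ :* s) :+ con 2ℚ :* h :* (con 1/16 :* v)) :+ con 128ℚ :* (con 256ℚ :* s) :+ con ¾ :* (h :* v)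
             := con K :* s :+ con 2ℚ :* (con ½ :* h) :* v) refl (∑ u) (half^ l) (∑ v)) ⟩
    K * ∑ u + 2ℚ * half^ (suc l) * ∑ v ∎
    where
    open ≤-Reasoning
    ¾ : ℚ
    ¾ = (ℤ.+ 3) / 4
    v : Cube d → ℚ
    v x = ι (violations R F k x)
    V : Cube d → ℚ
    V S = ∑ (λ x → ι (violations (R ∩ S) F k x))
    𝔼-V : 𝔼 V ≡ 1/16 * ∑ v
    𝔼-V = trans (sym (W-swap 1ℚ 1ℚ (1ℚ - 1/16) 1/16 (λ x S → ι (violations (R ∩ S) F k x))))
      (trans (∑-cong (λ x → 𝔼-violations R F k x)) (∑-scale 1/16 v))
    𝔼-root : 𝔼 (λ S → ∑ (restricted R u S)) ≤ℚ ¼ℚ * ∑ u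
    𝔼-root = ≤-trans (≤-reflexive (sym (W-swap 1ℚ 1ℚ (1ℚ - 1/16) 1/16 (λ x S → restricted R u S x))))
      (≤-trans (∑-mono (𝔼-restricted R u h)) (≤-reflexive (∑-scale ¼ℚ u)))

  -- After d rounds the remainder is harmless: a count v is at most d and at most u², so v² ≤ (1 +
  -- d) u² and v ≤ (1 + d) u, and 2^-d (1 + d) ≤ 1. This adds the 2 to `K`.
  boolean-bound : ∀ R u → IsRootBound R u → dist F (srt R F) ≤ℚ (K + 2ℚ) * ∑ u
  boolean-bound R u h = ≤-trans (iterate d R u h) (begin
    K * ∑ u + 2ℚ * half^ d * ∑ v ≡⟨ cong (K * ∑ u +_) (trans (*-assoc 2ℚ (half^ d) (∑ v)) (cong (2ℚ *_) (sym (∑-scale (half^ d) v)))) ⟩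
    K * ∑ u + 2ℚ * ∑ (λ x → half^ d * v x) ≤⟨ +-monoʳ-≤ (K * ∑ u) (*-monoˡ-nn {2ℚ} dec≤ (∑-mono pointwise)) ⟩
    K * ∑ u + 2ℚ * ∑ u ≡⟨ *-distribʳ-+ (∑ u) K 2ℚ ⟨
    (K + 2ℚ) * ∑ u ∎)
    where
    open ≤-Reasoning
    v : Cube d → ℚ
    v x = ι (violations R F k x)
    pointwise : ∀ x → half^ d * v x ≤ℚ u x
    pointwise x = ≤-trans (*-monoˡ-nn (0≤half^ d) v≤) (≤-trans (≤-reflexive (sym (*-assoc (half^ d) (1ℚ + ι d) (u x))))
      (≤-trans (*-monoʳ-nn 0≤u (half^*suc≤1 d)) (≤-reflexive (*-identityˡ (u x)))))
      where
      0≤u = proj₁ (h x)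
      v≤1+d : v x ≤ℚ 1ℚ + ι d
      v≤1+d = ≤-trans (ι-mono (violations≤d R F k x)) (≤-by {r = 1ℚ} dec≤ (+-comm (ι d) 1ℚ))
      1≤1+d : 1ℚ ≤ℚ 1ℚ + ι d
      1≤1+d = ≤-by (0≤ι d) refl
      0≤1+d : 0ℚ ≤ℚ 1ℚ + ι d
      0≤1+d = +-nonneg {1ℚ} dec≤ (0≤ι d)
      v≤ : v x ≤ℚ (1ℚ + ι d) * u x
      v≤ = sq-cancel-≤ (*-nonneg 0≤1+d 0≤u) (≤-trans (*-mono-nn (0≤ι (violations R F k x)) (sq-nonneg (u x)) v≤1+d (proj₂ (h x)))
        (≤-trans (*-monoʳ-nn {b = 1ℚ + ι d} {c = (1ℚ + ι d) * (1ℚ + ι d)} (sq-nonneg (u x)) (≤-by (*-nonneg (0≤ι d) 0≤1+d)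
            (solve 1 (λ n → con 1ℚ :+ n :+ n :* (con 1ℚ :+ n) := (con 1ℚ :+ n) :* (con 1ℚ :+ n)) refl (ι d))))
          (≤-reflexive (solve 2 (λ n u → (con 1ℚ :+ n) :* (con 1ℚ :+ n) :* (u :* u) := (con 1ℚ :+ n) :* u :* ((con 1ℚ :+ n) :* u)) refl (ι d) (u x)))))

-- From Boolean to rational-valued functions

∑C : ∀ {d} → (Cube d → ℕ) → ℕ
∑C {zero} φ = φ []
∑C {suc d} φ = ∑C (φ ∘ (false ∷_)) ℕ.+ ∑C (φ ∘ (true ∷_))

∑C-mono : ∀ {d} {φ χ : Cube d → ℕ} → (∀ x → φ x ≤ χ x) → ∑C φ ≤ ∑C χ
∑C-mono {zero} h = h []
∑C-mono {suc d} h = ℕₚ.+-mono-≤ (∑C-mono (h ∘ (false ∷_))) (∑C-mono (h ∘ (true ∷_)))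

∑C-mono-< : ∀ {d} {φ χ : Cube d → ℕ} → (∀ x → φ x ≤ χ x) → ∀ x → φ x ℕ.< χ x → ∑C φ ℕ.< ∑C χ
∑C-mono-< {zero} h [] h< = h<
∑C-mono-< {suc d} h (false ∷ x) h< = ℕₚ.+-mono-<-≤ (∑C-mono-< (h ∘ (false ∷_)) x h<) (∑C-mono (h ∘ (true ∷_)))
∑C-mono-< {suc d} h (true ∷ x) h< = ℕₚ.+-mono-≤-< (∑C-mono (h ∘ (false ∷_))) (∑C-mono-< (h ∘ (true ∷_)) x h<)

≤-∑C : ∀ {d} (φ : Cube d → ℕ) x → φ x ≤ ∑C φ
≤-∑C φ [] = ℕₚ.≤-refl
≤-∑C φ (false ∷ x) = ℕₚ.≤-trans (≤-∑C (φ ∘ (false ∷_)) x) (ℕₚ.m≤m+n _ _)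
≤-∑C φ (true ∷ x) = ℕₚ.≤-trans (≤-∑C (φ ∘ (true ∷_)) x) (ℕₚ.m≤n+m _ _)

∑C-+ : ∀ {d} (φ χ : Cube d → ℕ) → ∑C (λ x → φ x ℕ.+ χ x) ≡ ∑C φ ℕ.+ ∑C χ
∑C-+ {zero} φ χ = refl
∑C-+ {suc d} φ χ = trans (cong₂ ℕ._+_ (∑C-+ (φ ∘ (false ∷_)) (χ ∘ (false ∷_))) (∑C-+ (φ ∘ (true ∷_)) (χ ∘ (true ∷_))))
  (interchange (∑C (φ ∘ (false ∷_))) (∑C (χ ∘ (false ∷_))) (∑C (φ ∘ (true ∷_))) (∑C (χ ∘ (true ∷_))))

ι-∑C : ∀ {d} (P : Cube d → Bool) → ι (∑C (bit ∘ P)) ≡ ∑ (λ x → ⟦ P x ⟧)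
ι-∑C {zero} P with P []
... | true = refl
... | false = refl
ι-∑C {suc d} P = trans (ι-+ (∑C (bit ∘ P ∘ (false ∷_))) (∑C (bit ∘ P ∘ (true ∷_))))
  (cong₂ _+_ (trans (ι-∑C (P ∘ (false ∷_))) (sym (*-identityˡ _))) (trans (ι-∑C (P ∘ (true ∷_))) (sym (*-identityˡ _))))

-- Well-founded induction on the cost refutes the absence of a minimiser. Neither finiteness of `X`
-- nor decidability of `P` enters, and the theorem's inequality is stable under double negation.
¬¬-minimum : {X : Set} (P : X → Set) (μ : X → ℕ) → Σ X P → ¬ ¬ Σ X (λ a → P a × (∀ b → P b → μ a ≤ μ b))
¬¬-minimum {X} P μ (a , pa) none = ℕᵢ.<-rec (λ n → ∀ a → P a → μ a ≡ n → ⊥) step (μ a) a pa refl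
  where
  step : ∀ n → (∀ {m} → m ℕ.< n → ∀ a → P a → μ a ≡ m → ⊥) → ∀ a → P a → μ a ≡ n → ⊥
  step n ih a pa refl = none (a , pa , λ b pb → ℕₚ.≮⇒≥ (λ lt → ih lt b pb refl))

IsMonotone : ∀ {d} → (Cube d → ℕ) → Set
IsMonotone {d} h = (x y : Cube d) → x ⪯ y → h x ≤ h y

edge-⪯ : ∀ {d} (i : Fin d) (x : Cube d) → (x [ i ]≔ false) ⪯ (x [ i ]≔ true)
edge-⪯ zero (_ ∷ x) = f≤t ∷ ⪯-refl x
  where
  ⪯-refl : ∀ {d} (x : Cube d) → x ⪯ x
  ⪯-refl [] = []
  ⪯-refl (c ∷ x) = b≤b ∷ ⪯-refl x
edge-⪯ (suc i) (c ∷ x) = b≤b ∷ edge-⪯ i x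

full : ∀ d → Cube d
full d = replicate d true

increasing⇒monotone : ∀ {d} (G : Cube d → Bool) → IncreasingIn (full d) G → ∀ {x y} → x ⪯ y → G x ≤ᵇ G y
increasing⇒monotone G h [] = b≤b
increasing⇒monotone G (h₀ , hs) (b≤b {c} ∷ le) = increasing⇒monotone (G ∘ (c ∷_)) (hs c) le
increasing⇒monotone G (h₀ , hs) (_∷_ {xs = x} {ys = y} f≤t le) = Boolₚ.≤-trans (h₀ refl x) (increasing⇒monotone (G ∘ (true ∷_)) (hs true) le)

-- Cutting and moving one level of the integer minimiser

passes : Bool → ℕ → ℕ → Bool
passes true t r = does (t ℕₚ.<? r)
passes false t r = does (t ℕₚ.≤? r)

cut : Bool → ℕ → ℕ → ℕ → Bool
cut σ t a r = does (t ℕₚ.<? a) ∨ (does (a ℕₚ.≟ t) ∧ passes σ t r)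

off : Bool → ℕ → ℕ → ℕ → Bool
off true t a r = does (a ℕₚ.≟ t) ∧ does (t ℕₚ.<? r)
off false t a r = does (a ℕₚ.≟ t) ∧ does (r ℕₚ.<? t)

shift : Bool → ℕ → ℕ → Bool → ℕ
shift true t a g = a ℕ.+ bit (does (a ℕₚ.≟ t) ∧ g)
shift false t a g = a ℕ.∸ bit (does (a ℕₚ.≟ t) ∧ not g)

-- If h is an ℓ₁-closest monotone function to ρ, moving its level t by one along a monotone G cannot lower the cost;
-- summed over the cube, the number of points of that level where h is off is thus at most the distance of the cut to G.
cost-shift : ∀ σ t a r g → ∣ r - shift σ t a g ∣ ℕ.+ bit (off σ t a r) ≤ ∣ r - a ∣ ℕ.+ bit (cut σ t a r xor g)
cost-shift true t a r g = cases (a ℕₚ.≟ t) (t ℕₚ.<? a) (t ℕₚ.<? r) g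
  where
  cases : (E : Dec (a ≡ t)) (L : Dec (t ℕ.< a)) (R : Dec (t ℕ.< r)) (g : Bool) →
    ∣ r - (a ℕ.+ bit (does E ∧ g)) ∣ ℕ.+ bit (does E ∧ does R) ≤ ∣ r - a ∣ ℕ.+ bit ((does L ∨ (does E ∧ does R)) xor g)
  cases (no _) L R g rewrite ℕₚ.+-identityʳ a | ℕₚ.+-identityʳ ∣ r - a ∣ = ℕₚ.m≤m+n _ _
  cases (yes refl) (yes t<t) R g = ⊥-elim (ℕₚ.<-irrefl refl t<t)
  cases (yes refl) (no _) (yes t<r) false rewrite ℕₚ.+-identityʳ t = ℕₚ.≤-refl
  cases (yes refl) (no _) (no _) false rewrite ℕₚ.+-identityʳ t = ℕₚ.≤-refl
  cases (yes refl) (no _) (yes t<r) true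
    rewrite ℕₚ.+-comm t 1 | ℕₚ.+-identityʳ ∣ r - t ∣ | ℕₚ.m≤n⇒∣n-m∣≡n∸m t<r | ℕₚ.m≤n⇒∣n-m∣≡n∸m (ℕₚ.<⇒≤ t<r) =
    ℕₚ.≤-reflexive (trans (ℕₚ.+-comm (r ℕ.∸ suc t) 1) (sym (ℕₚ.+-∸-assoc 1 t<r)))
  cases (yes refl) (no _) (no t≮r) true rewrite ℕₚ.+-identityʳ ∣ r - (t ℕ.+ 1) ∣ =
    ℕₚ.≤-trans (ℕₚ.∣-∣-triangle r t (t ℕ.+ 1)) (ℕₚ.+-monoʳ-≤ ∣ r - t ∣ (ℕₚ.≤-reflexive (ℕₚ.∣m-m+n∣≡n t 1)))
cost-shift false t a r g = cases (a ℕₚ.≟ t) (t ℕₚ.<? a) (r ℕₚ.<? t) (t ℕₚ.≤? r) g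
  where
  down : ∀ r t → r ℕ.< t → ∣ r - (t ℕ.∸ 1) ∣ ℕ.+ 1 ≤ ∣ r - t ∣ ℕ.+ 0
  down r (suc t) (ℕ.s≤s r≤t) rewrite ℕₚ.+-identityʳ ∣ r - suc t ∣ | ℕₚ.m≤n⇒∣m-n∣≡n∸m r≤t | ℕₚ.m≤n⇒∣m-n∣≡n∸m (ℕₚ.m≤n⇒m≤1+n r≤t) =
    ℕₚ.≤-reflexive (trans (ℕₚ.+-comm (t ℕ.∸ r) 1) (sym (ℕₚ.+-∸-assoc 1 r≤t)))
  up : ∀ r t → ∣ r - (t ℕ.∸ 1) ∣ ℕ.+ 0 ≤ ∣ r - t ∣ ℕ.+ 1
  -- At level 0 truncated subtraction leaves the value in place, which the inequality allows.
  up r zero rewrite ℕₚ.+-identityʳ ∣ r - 0 ∣ = ℕₚ.m≤m+n _ _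
  up r (suc t) rewrite ℕₚ.+-identityʳ ∣ r - t ∣ = ℕₚ.≤-trans (ℕₚ.∣-∣-triangle r (suc t) t)
    (ℕₚ.+-monoʳ-≤ ∣ r - suc t ∣ (ℕₚ.≤-reflexive (trans (ℕₚ.∣-∣-comm (suc t) t) (trans (cong (∣_-_∣ t) (ℕₚ.+-comm 1 t)) (ℕₚ.∣m-m+n∣≡n t 1)))))
  cases : (E : Dec (a ≡ t)) (L : Dec (t ℕ.< a)) (R : Dec (r ℕ.< t)) (R' : Dec (t ≤ r)) (g : Bool) →
    ∣ r - (a ℕ.∸ bit (does E ∧ not g)) ∣ ℕ.+ bit (does E ∧ does R) ≤ ∣ r - a ∣ ℕ.+ bit ((does L ∨ (does E ∧ does R')) xor g)
  cases (no _) L R R' g rewrite ℕₚ.+-identityʳ ∣ r - a ∣ = ℕₚ.m≤m+n _ _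
  cases (yes refl) (yes t<t) R R' g = ⊥-elim (ℕₚ.<-irrefl refl t<t)
  cases (yes refl) (no _) (yes r<t) (yes t≤r) g = ⊥-elim (ℕₚ.<⇒≱ r<t t≤r)
  cases (yes refl) (no _) (no r≮t) (no t≰r) g = ⊥-elim (r≮t (ℕₚ.≰⇒> t≰r))
  cases (yes refl) (no _) (yes r<t) (no _) true = ℕₚ.≤-refl
  cases (yes refl) (no _) (no _) (yes _) true = ℕₚ.≤-refl
  cases (yes refl) (no _) (yes r<t) (no _) false = down r t r<t
  cases (yes refl) (no _) (no _) (yes t≤r) false = up r t

bit-mono : ∀ {g g'} → g ≤ᵇ g' → bit g ≤ bit g'
bit-mono f≤t = ℕ.z≤n
bit-mono b≤b = ℕₚ.≤-refl

bit-anti : ∀ {g g'} → g ≤ᵇ g' → bit (not g') ≤ bit (not g)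
bit-anti f≤t = ℕ.z≤n
bit-anti b≤b = ℕₚ.≤-refl

shift-mono : ∀ σ t {a b g g'} → a ≤ b → g ≤ᵇ g' → shift σ t a g ≤ shift σ t b g'
shift-mono true t {a} {b} {g} {g'} a≤b g≤g' = cases (a ℕₚ.≟ t) (b ℕₚ.≟ t)
  where
  cases : (E : Dec (a ≡ t)) (E' : Dec (b ≡ t)) → a ℕ.+ bit (does E ∧ g) ≤ b ℕ.+ bit (does E' ∧ g')
  cases (yes refl) (yes refl) = ℕₚ.+-monoʳ-≤ a (bit-mono g≤g')
  cases (yes refl) (no ne) rewrite ℕₚ.+-identityʳ b = ℕₚ.≤-trans (ℕₚ.+-monoʳ-≤ a (bit≤1 g))
      (ℕₚ.≤-trans (ℕₚ.≤-reflexive (ℕₚ.+-comm a 1)) (ℕₚ.≤∧≢⇒< a≤b (λ e → ne (sym e))))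
  cases (no _) E' rewrite ℕₚ.+-identityʳ a = ℕₚ.≤-trans a≤b (ℕₚ.m≤m+n b _)
shift-mono false t {a} {b} {g} {g'} a≤b g≤g' = cases (a ℕₚ.≟ t) (b ℕₚ.≟ t)
  where
  below : ∀ {a b} → a ℕ.< b → a ≤ b ℕ.∸ 1
  below (ℕ.s≤s le) = le
  cases : (E : Dec (a ≡ t)) (E' : Dec (b ≡ t)) → a ℕ.∸ bit (does E ∧ not g) ≤ b ℕ.∸ bit (does E' ∧ not g')
  cases (yes refl) (yes refl) = ℕₚ.∸-monoʳ-≤ a (bit-anti g≤g')
  cases (no ne) (yes refl) = ℕₚ.≤-trans (below (ℕₚ.≤∧≢⇒< a≤b ne)) (ℕₚ.∸-monoʳ-≤ b (bit≤1 (not g')))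
  cases E (no _) = ℕₚ.≤-trans (ℕₚ.m∸n≤m a (bit (does E ∧ not g))) a≤b

-- Below the level the cut is false and above it true; as a ≤ b, a descent must start and end on the
-- level, where only the threshold can cause it.
cut-violated : ∀ σ t {a b r s} → a ≤ b → cut σ t a r ≡ true → cut σ t b s ≡ false → a ≡ t × b ≡ t × s ℕ.< r
cut-violated σ t {a} {b} {r} {s} a≤b = cases (t ℕₚ.<? b) (t ℕₚ.<? a) (a ℕₚ.≟ t) (b ℕₚ.≟ t)
  where
  below-strict : (R : Dec (t ℕ.< r)) (S : Dec (t ℕ.< s)) → does R ≡ true → does S ≡ false → s ℕ.< r
  below-strict (yes t<r) (no t≮s) e e' = ℕₚ.≤-<-trans (ℕₚ.≮⇒≥ t≮s) t<r
  below-weak : (R : Dec (t ≤ r)) (S : Dec (t ≤ s)) → does R ≡ true → does S ≡ false → s ℕ.< r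
  below-weak (yes t≤r) (no t≰s) e e' = ℕₚ.<-≤-trans (ℕₚ.≰⇒> t≰s) t≤r
  below : ∀ σ → passes σ t r ≡ true → passes σ t s ≡ false → s ℕ.< r
  below true = below-strict (t ℕₚ.<? r) (t ℕₚ.<? s)
  below false = below-weak (t ℕₚ.≤? r) (t ℕₚ.≤? s)
  cases : (L' : Dec (t ℕ.< b)) (L : Dec (t ℕ.< a)) (E : Dec (a ≡ t)) (E' : Dec (b ≡ t)) →
    does L ∨ (does E ∧ passes σ t r) ≡ true → does L' ∨ (does E' ∧ passes σ t s) ≡ false → a ≡ t × b ≡ t × s ℕ.< r
  cases (no t≮b) (yes t<a) E E' e e' = ⊥-elim (t≮b (ℕₚ.<-≤-trans t<a a≤b))
  cases (no t≮b) (no _) (yes refl) (no ne) e e' = ⊥-elim (t≮b (ℕₚ.≤∧≢⇒< a≤b (λ e → ne (sym e))))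
  cases (no t≮b) (no _) (yes refl) (yes refl) e e' = refl , refl , below σ e e'

∑ℕ-mono : ∀ {m} {φ χ : Fin m → ℕ} → (∀ i → φ i ≤ χ i) → ∑ℕ φ ≤ ∑ℕ χ
∑ℕ-mono {zero} h = ℕ.z≤n
∑ℕ-mono {suc m} h = ℕₚ.+-mono-≤ (h zero) (∑ℕ-mono (h ∘ suc))

∑ℕ-+ : ∀ {m} (φ χ : Fin m → ℕ) → ∑ℕ (λ i → φ i ℕ.+ χ i) ≡ ∑ℕ φ ℕ.+ ∑ℕ χ
∑ℕ-+ {zero} φ χ = refl
∑ℕ-+ {suc m} φ χ = trans (cong (φ zero ℕ.+ χ zero ℕ.+_) (∑ℕ-+ (φ ∘ suc) (χ ∘ suc)))
  (interchange (φ zero) (χ zero) (∑ℕ (φ ∘ suc)) (∑ℕ (χ ∘ suc)))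

∑ℕ-zero : ∀ {m} {φ : Fin m → ℕ} → (∀ i → φ i ≡ 0) → ∑ℕ φ ≡ 0
∑ℕ-zero {zero} h = refl
∑ℕ-zero {suc m} h = cong₂ ℕ._+_ (h zero) (∑ℕ-zero (h ∘ suc))

length-filterᵇ-tabulate : ∀ {A : Set} {m} (p : A → Bool) (g : Fin m → A) → length (filterᵇ p (tabulate g)) ≡ ∑ℕ (λ i → bit (p (g i)))
length-filterᵇ-tabulate {m = zero} p g = refl
length-filterᵇ-tabulate {m = suc m} p g with p (g zero)
... | true = cong suc (length-filterᵇ-tabulate p (g ∘ suc))
... | false = length-filterᵇ-tabulate p (g ∘ suc)

colouring : ∀ {d} → (Cube d → Cube d → Color) → EdgeColouring d
colouring {zero} col = tt
colouring {suc d} col = (λ x → isRed (col (false ∷ x) (true ∷ x))) , λ c → colouring (λ x y → col (c ∷ x) (c ∷ y))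

violation-at : ∀ {d} → (Cube d → Bool) → (Cube d → Cube d → Color) → Cube d → Fin d → Bool
violation-at F col x i = tok (violation true (lookup x i)) (F x) (F (x [ i ]≔ not (lookup x i))) (isRed (col (x [ i ]≔ false) (x [ i ]≔ true)))

violations-∑ℕ : ∀ {d} (F : Cube d → Bool) col x → violations (full d) F (colouring col) x ≡ ∑ℕ (λ i → bit (violation-at F col x i))
violations-∑ℕ F col [] = refl
violations-∑ℕ F col (c ∷ x) = cong (bit (violation-at F col (c ∷ x) zero) ℕ.+_) (violations-∑ℕ (F ∘ (c ∷_)) (λ x y → col (c ∷ x) (c ∷ y)) x)

bit-does-mono : ∀ {P Q : Set} (P? : Dec P) (Q? : Dec Q) → (P → Q) → bit (does P?) ≤ bit (does Q?)
bit-does-mono (no _) _ _ = ℕ.z≤n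
bit-does-mono (yes p) (yes q) _ = ℕₚ.≤-refl
bit-does-mono (yes p) (no ¬q) f = ⊥-elim (¬q (f p))

-- Ranks, and violated edges on a level

module Rank {d} (f : Cube d → ℚ) where

  -- Counting the points of strictly smaller value encodes the order of `f` in integers, so that
  -- moving a level by one is the smallest possible change.
  rank : Cube d → ℕ
  rank x = ∑C (λ w → bit (does (f w <? f x)))

  rank-mono : ∀ {x y} → f x ≤ℚ f y → rank x ≤ rank y
  rank-mono {x} {y} le = ∑C-mono (λ w → bit-does-mono (f w <? f x) (f w <? f y) (λ lt → <-≤-trans lt le))

  rank-mono-< : ∀ {x y} → f x < f y → rank x ℕ.< rank y
  rank-mono-< {x} {y} lt = ∑C-mono-< (λ w → bit-does-mono (f w <? f x) (f w <? f y) (λ lt' → <-trans lt' lt)) x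
    (subst₂ (λ a b → bit a ℕ.< bit b) (sym (dec-false (f x <? f x) (<-irrefl refl))) (sym (dec-true (f x <? f y) lt)) (ℕ.s≤s ℕ.z≤n))

  rank-cancel-≤ : ∀ {x y} → rank x ≤ rank y → f x ≤ℚ f y
  rank-cancel-≤ {x} {y} le = ≮⇒≥ (λ lt → ℕₚ.<⇒≱ (rank-mono-< lt) le)

  rank-cancel-< : ∀ {x y} → rank x ℕ.< rank y → f x < f y
  rank-cancel-< {x} {y} lt = ≰⇒> (λ le → ℕₚ.<⇒≱ lt (rank-mono le))

module _ {d} (f : Cube d → ℚ) (col : Cube d → Cube d → Color) where

  open Rank f

  red-at blue-at : Cube d → Fin d → Bool
  red-at x i = not (lookup x i) ∧ does (f (x [ i ]≔ true) <? f x) ∧ isRed (col x (x [ i ]≔ true))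
  blue-at y i = lookup y i ∧ does (f y <? f (y [ i ]≔ false)) ∧ isBlue (col (y [ i ]≔ false) y)

  Ired-∑ℕ : ∀ x → Ired f col x ≡ ∑ℕ (λ i → bit (red-at x i))
  Ired-∑ℕ x = length-filterᵇ-tabulate (red-at x) (λ i → i)

  Iblue-∑ℕ : ∀ x → Iblue f col x ≡ ∑ℕ (λ i → bit (blue-at x i))
  Iblue-∑ℕ x = length-filterᵇ-tabulate (blue-at x) (λ i → i)

  module Level (h : Cube d → ℕ) (h-mono : IsMonotone h) (σ : Bool) (t : ℕ) where

    F : Cube d → Bool
    F x = cut σ t (h x) (rank x)

    edge-violated : ∀ x i → F (x [ i ]≔ false) ≡ true → F (x [ i ]≔ true) ≡ false →
      h (x [ i ]≔ false) ≡ t × h (x [ i ]≔ true) ≡ t × f (x [ i ]≔ true) < f (x [ i ]≔ false)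
    edge-violated x i e e' with cut-violated σ t (h-mono _ _ (edge-⪯ i x)) e e'
    ... | p , q , r = p , q , rank-cancel-< r

    violation-at⇒ : ∀ x i → violation-at F col x i ≡ true → h x ≡ t × (red-at x i ≡ true ⊎ blue-at x i ≡ true)
    violation-at⇒ x i = cases (lookup x i) refl
      where
      self : ∀ b → lookup x i ≡ b → x [ i ]≔ b ≡ x
      self b e = trans (cong (x [ i ]≔_) (sym e)) ([]≔-lookup x i)
      lower : ∀ a b k → tok (violation true false) a b k ≡ true → a ≡ true × b ≡ false × k ≡ true
      lower true false true e = refl , refl , refl
      lower true true true ()
      lower true true false ()
      lower true false false ()
      lower false true true ()
      lower false true false ()
      lower false false true ()
      lower false false false ()
      upper : ∀ a b k → tok (violation true true) a b k ≡ true → a ≡ false × b ≡ true × k ≡ false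
      upper false true false e = refl , refl , refl
      upper false true true ()
      upper false false true ()
      upper false false false ()
      upper true true true ()
      upper true true false ()
      upper true false true ()
      upper true false false ()
      cases : ∀ b → lookup x i ≡ b → tok (violation true b) (F x) (F (x [ i ]≔ not b)) (isRed (col (x [ i ]≔ false) (x [ i ]≔ true))) ≡ true →
        h x ≡ t × (not b ∧ does (f (x [ i ]≔ true) <? f x) ∧ isRed (col x (x [ i ]≔ true)) ≡ true
                   ⊎ b ∧ does (f x <? f (x [ i ]≔ false)) ∧ isBlue (col (x [ i ]≔ false) x) ≡ true)
      cases false eq e with lower _ _ _ e
      ... | Fx , Fy , k with edge-violated x i (trans (cong F (self false eq)) Fx) Fy
      ...   | hx , _ , lt = trans (cong h (sym (self false eq))) hx ,
              inj₁ (cong₂ _∧_ (dec-true (f (x [ i ]≔ true) <? f x) (subst (λ z → f (x [ i ]≔ true) < f z) (self false eq) lt))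
                (trans (cong (λ z → isRed (col z (x [ i ]≔ true))) (sym (self false eq))) k))
      cases true eq e with upper _ _ _ e
      ... | Fx , Fy , k with edge-violated x i Fy (trans (cong F (self true eq)) Fx)
      ...   | _ , hx , lt = trans (cong h (sym (self true eq))) hx ,
              inj₂ (cong₂ _∧_ (dec-true (f x <? f (x [ i ]≔ false)) (subst (λ z → f z < f (x [ i ]≔ false)) (self true eq) lt))
                (trans (cong (λ z → isBlue (col (x [ i ]≔ false) z)) (sym (self true eq))) (cong not k)))

    violations-on-level : ∀ x → violations (full d) F (colouring col) x ≤ Ired f col x ℕ.+ Iblue f col x
    violations-on-level x rewrite violations-∑ℕ F col x | Ired-∑ℕ x | Iblue-∑ℕ x =
      ℕₚ.≤-trans (∑ℕ-mono (λ i → bound _ _ _ (proj₂ ∘ violation-at⇒ x i))) (ℕₚ.≤-reflexive (∑ℕ-+ (λ i → bit (red-at x i)) (λ i → bit (blue-at x i))))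
      where
      bound : ∀ a b c → (a ≡ true → b ≡ true ⊎ c ≡ true) → bit a ≤ bit b ℕ.+ bit c
      bound false b c h = ℕ.z≤n
      bound true b c h with h refl
      ... | inj₁ refl = ℕ.s≤s ℕ.z≤n
      ... | inj₂ refl = ℕₚ.m≤n+m 1 (bit b)

    violations-off-level : ∀ x → h x ≢ t → violations (full d) F (colouring col) x ≡ 0
    violations-off-level x ne = trans (violations-∑ℕ F col x) (∑ℕ-zero (λ i → none _ (λ e → ne (proj₁ (violation-at⇒ x i e)))))
      where
      none : ∀ a → (a ≡ true → ⊥) → bit a ≡ 0
      none true h = ⊥-elim (h refl)
      none false h = refl

    module _ (s r : Cube d → ℚ) (s-root : ∀ x → SqrtUpper (Ired f col x) (s x)) (r-root : ∀ x → SqrtUpper (Iblue f col x) (r x)) where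

      -- Both colours share one root bound, as s² + r² ≤ (s + r)². The indicator gives different
      -- levels disjoint supports, so summing over t loses nothing.
      level-root : Cube d → ℚ
      level-root x = ⟦ does (h x ℕₚ.≟ t) ⟧ * (s x + r x)

      level-root-bound : IsRootBound F (colouring col) (full d) level-root
      level-root-bound x = cases (h x ℕₚ.≟ t)
        where
        0≤s = proj₁ (s-root x)
        0≤r = proj₁ (r-root x)
        cases : (E : Dec (h x ≡ t)) → 0ℚ ≤ℚ ⟦ does E ⟧ * (s x + r x) × ι (violations (full d) F (colouring col) x) ≤ℚ ⟦ does E ⟧ * (s x + r x) * (⟦ does E ⟧ * (s x + r x))
        cases (no ne) = *-nonneg {0ℚ} ≤-refl (+-nonneg 0≤s 0≤r) , ≤-trans (≤-reflexive (cong ι (violations-off-level x ne))) (sq-nonneg (0ℚ * (s x + r x)))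
        cases (yes _) = *-nonneg {1ℚ} dec≤ (+-nonneg 0≤s 0≤r) ,
          ≤-trans (ι-mono (violations-on-level x)) (≤-trans (≤-reflexive (ι-+ (Ired f col x) (Iblue f col x)))
            (≤-trans (+-mono-≤ (proj₂ (s-root x)) (proj₂ (r-root x)))
              (≤-by (*-nonneg {2ℚ} dec≤ (*-nonneg 0≤s 0≤r))
                (solve 2 (λ s r → s :* s :+ r :* r :+ con 2ℚ :* (s :* r) := con 1ℚ :* (s :+ r) :* (con 1ℚ :* (s :+ r))) refl (s x) (r x)))))

      level-bound : (∀ h' → IsMonotone h' → ∑C (λ x → ∣ rank x - h x ∣) ≤ ∑C (λ x → ∣ rank x - h' x ∣)) →
        ∑ (λ x → ⟦ off σ t (h x) (rank x) ⟧) ≤ℚ (K + 2ℚ) * ∑ level-root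
      level-bound minimal = ≤-trans
          (≤-trans (≤-reflexive (sym (ι-∑C (λ x → off σ t (h x) (rank x))))) (≤-trans (ι-mono off≤dist) (≤-reflexive (ι-∑C (λ x → F x xor G x)))))
          (boolean-bound F (colouring col) (full d) level-root level-root-bound)
        where
        G : Cube d → Bool
        G = srt (full d) F
        h' : Cube d → ℕ
        h' x = shift σ t (h x) (G x)
        h'-mono : IsMonotone h'
        h'-mono x y le = shift-mono σ t (h-mono x y le) (increasing⇒monotone G (srt-increasing (full d) F) le)
        cost' cost miss gap : Cube d → ℕ
        cost' x = ∣ rank x - h' x ∣
        cost x = ∣ rank x - h x ∣
        miss x = bit (off σ t (h x) (rank x))
        gap x = bit (F x xor G x)
        off≤dist : ∑C miss ≤ ∑C gap
        off≤dist = ℕₚ.+-cancelˡ-≤ (∑C cost) (∑C miss) (∑C gap) (ℕₚ.≤-trans (ℕₚ.+-monoˡ-≤ (∑C miss) (minimal h' h'-mono))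
          (subst₂ _≤_ (∑C-+ cost' miss) (∑C-+ cost gap) (∑C-mono (λ x → cost-shift σ t (h x) (rank x) (G x)))))

ΣF-≥ : ∀ {m} {φ : Fin m → ℚ} → (∀ i → 0ℚ ≤ℚ φ i) → ∀ i → φ i ≤ℚ ΣF φ
ΣF-≥ {φ = φ} h zero = ≤-by (ΣF-nonneg (h ∘ suc)) refl
ΣF-≥ {φ = φ} h (suc i) = ≤-trans (ΣF-≥ (h ∘ suc) i) (≤-by (h zero) (+-comm (ΣF (φ ∘ suc)) (φ zero)))

ΣF-level≤1 : ∀ m a → ΣF {m} (λ t → ⟦ does (a ℕₚ.≟ toℕ t) ⟧) ≤ℚ 1ℚ
ΣF-level≤1 zero a = dec≤
ΣF-level≤1 (suc m) zero = ≤-by {r = 0ℚ} ≤-refl (trans (+-identityʳ _) (trans (cong (1ℚ +_) (zeros m)) (+-identityʳ 1ℚ)))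
  where
  zeros : ∀ m → ΣF {m} (λ t → ⟦ does (0 ℕₚ.≟ suc (toℕ t)) ⟧) ≡ 0ℚ
  zeros zero = refl
  zeros (suc m) = trans (+-identityˡ _) (zeros m)
ΣF-level≤1 (suc m) (suc a) = ≤-trans (≤-reflexive (+-identityˡ _)) (ΣF-level≤1 m a)

differs : ∀ {d} → (Cube d → ℕ) → (Cube d → ℕ) → ℚ
differs ρ h = ∑ (λ x → ⟦ not (does (ρ x ℕₚ.≟ h x)) ⟧)

off-level : ∀ a r → ⟦ not (does (r ℕₚ.≟ a)) ⟧ ≤ℚ ⟦ off true a a r ⟧ + ⟦ off false a a r ⟧
off-level a r = cases (r ℕₚ.≟ a) (a ℕₚ.≟ a) (a ℕₚ.<? r) (r ℕₚ.<? a)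
  where
  cases : (E : Dec (r ≡ a)) (E' : Dec (a ≡ a)) (L : Dec (a ℕ.< r)) (L' : Dec (r ℕ.< a)) →
    ⟦ not (does E) ⟧ ≤ℚ ⟦ does E' ∧ does L ⟧ + ⟦ does E' ∧ does L' ⟧
  cases (yes _) E' L L' = +-nonneg 0≤⟦ does E' ∧ does L ⟧ 0≤⟦ does E' ∧ does L' ⟧
  cases (no _) (no ne) L L' = ⊥-elim (ne refl)
  cases (no _) (yes _) (yes _) L' = ≤-by {p = 1ℚ} 0≤⟦ does L' ⟧ refl
  cases (no _) (yes _) (no _) (yes _) = dec≤
  cases (no ne) (yes _) (no a≮r) (no r≮a) = ⊥-elim (ne (ℕₚ.≤-antisym (ℕₚ.≮⇒≥ a≮r) (ℕₚ.≮⇒≥ r≮a)))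

module _ {d} (f : Cube d → ℚ) (col : Cube d → Cube d → Color)
  (s r : Cube d → ℚ) (s-root : ∀ x → SqrtUpper (Ired f col x) (s x)) (r-root : ∀ x → SqrtUpper (Iblue f col x) (r x)) where

  open Rank f

  differs-bound : (h : Cube d → ℕ) → IsMonotone h →
    (∀ h' → IsMonotone h' → ∑C (λ x → ∣ rank x - h x ∣) ≤ ∑C (λ x → ∣ rank x - h' x ∣)) →
    differs rank h ≤ℚ 2ℚ * (K + 2ℚ) * ∑ (λ x → s x + r x)
  differs-bound h h-mono minimal = begin
    differs rank h ≤⟨ ∑-mono (λ x → ≤-trans (off-level (h x) (rank x)) (some-level x)) ⟩
    ∑ (λ x → ΣF (λ t → both t x)) ≡⟨ W-ΣF 1ℚ 1ℚ both ⟨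
    ΣF (λ t → ∑ (both t)) ≤⟨ ΣF-mono each ⟩
    ΣF (λ t → 2ℚ * (K + 2ℚ) * ∑ (root t)) ≡⟨ ΣF-scale (2ℚ * (K + 2ℚ)) (λ t → ∑ (root t)) ⟩
    2ℚ * (K + 2ℚ) * ΣF (λ t → ∑ (root t)) ≡⟨ cong (2ℚ * (K + 2ℚ) *_) (W-ΣF 1ℚ 1ℚ root) ⟩
    2ℚ * (K + 2ℚ) * ∑ (λ x → ΣF (λ t → root t x)) ≤⟨ *-monoˡ-nn {2ℚ * (K + 2ℚ)} dec≤ (∑-mono disjoint) ⟩
    2ℚ * (K + 2ℚ) * ∑ (λ x → s x + r x) ∎
    where
    open ≤-Reasoning
    m : ℕ
    -- Any strict upper bound for the values of `h` would do; it makes the sum over levels finite.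
    m = suc (∑C h)
    both root : Fin m → Cube d → ℚ
    both t x = ⟦ off true (toℕ t) (h x) (rank x) ⟧ + ⟦ off false (toℕ t) (h x) (rank x) ⟧
    root t x = ⟦ does (h x ℕₚ.≟ toℕ t) ⟧ * (s x + r x)
    h<m : ∀ x → h x ℕ.< m
    h<m x = ℕ.s≤s (≤-∑C h x)
    some-level : ∀ x → ⟦ off true (h x) (h x) (rank x) ⟧ + ⟦ off false (h x) (h x) (rank x) ⟧ ≤ℚ ΣF (λ t → both t x)
    some-level x = subst (λ t → ⟦ off true t (h x) (rank x) ⟧ + ⟦ off false t (h x) (rank x) ⟧ ≤ℚ ΣF (λ t → both t x)) (Finₚ.toℕ-fromℕ< (h<m x))
      (ΣF-≥ (λ t → +-nonneg 0≤⟦ off true (toℕ t) (h x) (rank x) ⟧ 0≤⟦ off false (toℕ t) (h x) (rank x) ⟧) (fromℕ< (h<m x)))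
    each : ∀ t → ∑ (both t) ≤ℚ 2ℚ * (K + 2ℚ) * ∑ (root t)
    each t = ≤-trans (≤-reflexive (∑-+ (λ x → ⟦ off true (toℕ t) (h x) (rank x) ⟧) (λ x → ⟦ off false (toℕ t) (h x) (rank x) ⟧)))
      (≤-trans (+-mono-≤ (Level.level-bound f col h h-mono true (toℕ t) s r s-root r-root minimal) (Level.level-bound f col h h-mono false (toℕ t) s r s-root r-root minimal))
        (≤-reflexive (solve 1 (λ e → con (K + 2ℚ) :* e :+ con (K + 2ℚ) :* e := con (2ℚ * (K + 2ℚ)) :* e) refl (∑ (root t)))))
    disjoint : ∀ x → ΣF (λ t → root t x) ≤ℚ s x + r x
    disjoint x = ≤-trans (≤-reflexive (trans (ΣF-cong {m} (λ t → *-comm ⟦ does (h x ℕₚ.≟ toℕ t) ⟧ (s x + r x))) (ΣF-scale {m} (s x + r x) (λ t → ⟦ does (h x ℕₚ.≟ toℕ t) ⟧))))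
      (≤-trans (*-monoˡ-nn (+-nonneg (proj₁ (s-root x)) (proj₁ (r-root x))) (ΣF-level≤1 m (h x))) (≤-reflexive (*-identityʳ (s x + r x))))

-- Return to rational values and normalisation

maxC : ∀ {d} → (Cube d → ℚ) → ℚ
maxC {zero} φ = φ []
maxC {suc d} φ = maxC (φ ∘ (false ∷_)) ⊔ maxC (φ ∘ (true ∷_))

≤-maxC : ∀ {d} (φ : Cube d → ℚ) x → φ x ≤ℚ maxC φ
≤-maxC φ [] = ≤-refl
≤-maxC φ (false ∷ x) = ≤-trans (≤-maxC (φ ∘ (false ∷_)) x) (p≤p⊔q (maxC (φ ∘ (false ∷_))) (maxC (φ ∘ (true ∷_))))
≤-maxC φ (true ∷ x) = ≤-trans (≤-maxC (φ ∘ (true ∷_)) x) (p≤q⊔p (maxC (φ ∘ (false ∷_))) (maxC (φ ∘ (true ∷_))))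

maxC-≤ : ∀ {d} (φ : Cube d → ℚ) {b} → (∀ x → φ x ≤ℚ b) → maxC φ ≤ℚ b
maxC-≤ {zero} φ h = h []
maxC-≤ {suc d} φ h = ⊔-lub (maxC-≤ (φ ∘ (false ∷_)) (h ∘ (false ∷_))) (maxC-≤ (φ ∘ (true ∷_)) (h ∘ (true ∷_)))

-- Translates `h` back into values of `f`: `g z` is the largest value whose rank is at most `h z`,
-- which is `f z` where rank and `h` agree. The fallback `bottom` is the minimum of `f`, so it never
-- wins against an admissible value.
module Extend {d} (f : Cube d → ℚ) (h : Cube d → ℕ) (h-mono : IsMonotone h) where

  open Rank f

  bottom : ℚ
  bottom = - maxC (λ x → - f x)

  bottom≤ : ∀ x → bottom ≤ℚ f x
  bottom≤ x = subst (bottom ≤ℚ_) (solve 1 (λ a → :- (:- a) := a) refl (f x)) (neg-antimono-≤ (≤-maxC (λ x → - f x) x))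

  capped : ℕ → Cube d → ℚ
  capped a w = if does (rank w ℕₚ.≤? a) then f w else bottom

  g : Cube d → ℚ
  g z = maxC (capped (h z))

  capped-mono : ∀ {a b} → a ≤ b → ∀ w → capped a w ≤ℚ capped b w
  capped-mono {a} {b} a≤b w = cases (rank w ℕₚ.≤? a) (rank w ℕₚ.≤? b)
    where
    cases : (L : Dec (rank w ≤ a)) (L' : Dec (rank w ≤ b)) → (if does L then f w else bottom) ≤ℚ (if does L' then f w else bottom)
    cases (yes _) (yes _) = ≤-refl
    cases (yes l) (no ¬l) = ⊥-elim (¬l (ℕₚ.≤-trans l a≤b))
    cases (no _) (yes _) = bottom≤ w
    cases (no _) (no _) = ≤-refl

  g-mono : Monotone g
  g-mono x y le = maxC-≤ (capped (h x)) (λ w → ≤-trans (capped-mono (h-mono x y le) w) (≤-maxC (capped (h y)) w))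

  g-agrees : ∀ z → rank z ≡ h z → f z ≡ g z
  g-agrees z e = ≤-antisym (≤-trans (lower (rank z ℕₚ.≤? h z)) (≤-maxC (capped (h z)) z)) (maxC-≤ (capped (h z)) (λ w → upper w (rank w ℕₚ.≤? h z)))
    where
    lower : (L : Dec (rank z ≤ h z)) → f z ≤ℚ (if does L then f z else bottom)
    lower (yes _) = ≤-refl
    lower (no ¬l) = ⊥-elim (¬l (ℕₚ.≤-reflexive e))
    upper : ∀ w → (L : Dec (rank w ≤ h z)) → (if does L then f w else bottom) ≤ℚ f z
    upper w (yes l) = rank-cancel-≤ (subst (rank w ≤_) (sym e) l)
    upper w (no _) = bottom≤ z

sumℚ-++ : ∀ {X : Set} (xs ys : List X) φ → sumℚ (xs List.++ ys) φ ≡ sumℚ xs φ + sumℚ ys φ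
sumℚ-++ List.[] ys φ = sym (+-identityˡ _)
sumℚ-++ (x List.∷ xs) ys φ = trans (cong (φ x +_) (sumℚ-++ xs ys φ)) (sym (+-assoc (φ x) (sumℚ xs φ) (sumℚ ys φ)))

sumℚ-map : ∀ {X Y : Set} (g : X → Y) xs φ → sumℚ (List.map g xs) φ ≡ sumℚ xs (φ ∘ g)
sumℚ-map g List.[] φ = refl
sumℚ-map g (x List.∷ xs) φ = cong (φ (g x) +_) (sumℚ-map g xs φ)

sumℚ-allCube : ∀ d φ → sumℚ (allCube d) φ ≡ ∑ φ
sumℚ-allCube zero φ = +-identityʳ (φ [])
sumℚ-allCube (suc d) φ = trans (sumℚ-++ (List.map (false ∷_) (allCube d)) (List.map (true ∷_) (allCube d)) φ)
  (cong₂ _+_ (half false) (half true))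
  where
  half : ∀ c → sumℚ (List.map (c ∷_) (allCube d)) φ ≡ 1ℚ * ∑ (φ ∘ (c ∷_))
  half c = trans (sumℚ-map (c ∷_) (allCube d) φ) (trans (sumℚ-allCube d (φ ∘ (c ∷_))) (sym (*-identityˡ _)))

length-filter≤ : ∀ {X : Set} {P : X → Set} (P? : ∀ x → Dec (P x)) (χ : X → ℚ) → (∀ x → 0ℚ ≤ℚ χ x) → (∀ x → P x → 1ℚ ≤ℚ χ x) →
  ∀ xs → ι (length (List.filter P? xs)) ≤ℚ sumℚ xs χ
length-filter≤ P? χ 0≤χ 1≤χ List.[] = ≤-refl
length-filter≤ P? χ 0≤χ 1≤χ (x List.∷ xs) with P? x
... | yes p = ≤-trans (≤-reflexive (ι-suc (length (List.filter P? xs)))) (+-mono-≤ (1≤χ x p) (length-filter≤ P? χ 0≤χ 1≤χ xs))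
... | no _ = ≤-trans (length-filter≤ P? χ 0≤χ 1≤χ xs) (≤-by (0≤χ x) (+-comm (sumℚ xs χ) (χ x)))

n/m≡1/m*n : ∀ n m .{{_ : ℕ.NonZero m}} → (ℤ.+ n) / m ≡ (ℤ.+ 1) / m * ι n
n/m≡1/m*n n (suc m) = toℚᵘ-injective (ℚᵘₚ.≃-trans (toℚᵘ-fromℚᵘ (ℚᵘ.mkℚᵘ (ℤ.+ n) m)) (ℚᵘₚ.≃-trans
    (ℚᵘ.*≡* (cong₂ ℤ._*_ (sym (ℤₚ.*-identityˡ (ℤ.+ n))) (cong (λ k → ℤ.+ suc k) (ℕₚ.*-identityʳ m))))
    (ℚᵘₚ.≃-trans (ℚᵘₚ.*-cong (ℚᵘₚ.≃-sym (toℚᵘ-fromℚᵘ (ℚᵘ.mkℚᵘ (ℤ.+ 1) m))) (ℚᵘₚ.≃-sym (toℚᵘ-fromℚᵘ (ℚᵘ.mkℚᵘ (ℤ.+ n) 0))))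
      (ℚᵘₚ.≃-sym (toℚᵘ-homo-* ((ℤ.+ 1) / suc m) (ι n))))))

0≤1/m : ∀ m .{{_ : ℕ.NonZero m}} → 0ℚ ≤ℚ (ℤ.+ 1) / m
0≤1/m m = nonNegative⁻¹ ((ℤ.+ 1) / m) {{normalize-nonNeg 1 m}}

-- 131076 = 2 · (65536 + 2): `K + 2ℚ` from the Boolean case, once for each of the two cuts.
C : ℚ
C = (ℤ.+ 1) / 131076

theorem1p2 : Σ ℚ (λ C → 0ℚ < C ×
    ((d : ℕ) → 1 ≤ d → (f : Cube d → ℚ) → (col : Cube d → Cube d → Color) →
    (e : ℚ) → IsDistToMono f e →
    (s t : Cube d → ℚ) →
    ((x : Cube d) → SqrtUpper (Ired f col x) (s x)) →
    ((y : Cube d) → SqrtUpper (Iblue f col y) (t y)) →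
    C * e ≤ℚ E d s + E d t))
theorem1p2 = C , positive⁻¹ C , bound
  where
  bound : (d : ℕ) → 1 ≤ d → (f : Cube d → ℚ) → (col : Cube d → Cube d → Color) →
    (e : ℚ) → IsDistToMono f e → (s t : Cube d → ℚ) →
    ((x : Cube d) → SqrtUpper (Ired f col x) (s x)) → ((y : Cube d) → SqrtUpper (Iblue f col y) (t y)) →
    C * e ≤ℚ E d s + E d t
  bound d _ f col e (_ , closest) s t s-root t-root = decidable-stable (C * e ≤? E d s + E d t) (λ fails →
    ¬¬-minimum IsMonotone (λ h → ∑C (λ x → ∣ rank x - h x ∣)) ((λ _ → 0) , (λ _ _ _ → ℕ.z≤n)) (λ { (h , h-mono , minimal) → fails (conclude h h-mono minimal) }))
    where
    open Rank f
    δ : ℚ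
    δ = ((ℤ.+ 1) / (2 ℕ.^ d)) {{ℕₚ.m^n≢0 2 d}}
    0≤δ : 0ℚ ≤ℚ δ
    0≤δ = 0≤1/m (2 ℕ.^ d) {{ℕₚ.m^n≢0 2 d}}
    conclude : (h : Cube d → ℕ) → IsMonotone h → (∀ h' → IsMonotone h' → ∑C (λ x → ∣ rank x - h x ∣) ≤ ∑C (λ x → ∣ rank x - h' x ∣)) →
      C * e ≤ℚ E d s + E d t
    conclude h h-mono minimal = begin
      C * e ≤⟨ *-monoˡ-nn {C} dec≤ (closest g g-mono) ⟩
      C * distFrac f g ≡⟨ cong (C *_) (n/m≡1/m*n (disagree f g) (2 ℕ.^ d) {{ℕₚ.m^n≢0 2 d}}) ⟩
      C * (δ * ι (disagree f g)) ≤⟨ *-monoˡ-nn {C} dec≤ (*-monoˡ-nn 0≤δ (≤-trans disagree≤ (differs-bound f col s t s-root t-root h h-mono minimal))) ⟩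
      C * (δ * (2ℚ * (K + 2ℚ) * ∑ (λ x → s x + t x))) ≡⟨ solve 2 (λ δ u → con C :* (δ :* (con (2ℚ * (K + 2ℚ)) :* u)) := δ :* u) refl δ (∑ (λ x → s x + t x)) ⟩
      δ * ∑ (λ x → s x + t x) ≡⟨ cong (δ *_) (∑-+ s t) ⟩
      δ * (∑ s + ∑ t) ≡⟨ *-distribˡ-+ δ (∑ s) (∑ t) ⟩
      δ * ∑ s + δ * ∑ t ≡⟨ cong₂ (λ a b → δ * a + δ * b) (sumℚ-allCube d s) (sumℚ-allCube d t) ⟨
      E d s + E d t ∎
      where
      open ≤-Reasoning
      open Extend f h h-mono
      χ : Cube d → ℚ
      χ x = ⟦ not (does (rank x ℕₚ.≟ h x)) ⟧
      1≤χ : ∀ x → f x ≢ g x → (L : Dec (rank x ≡ h x)) → 1ℚ ≤ℚ ⟦ not (does L) ⟧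
      1≤χ x ne (yes p) = ⊥-elim (ne (g-agrees x p))
      1≤χ x ne (no _) = ≤-refl
      disagree≤ : ι (disagree f g) ≤ℚ differs rank h
      disagree≤ = ≤-trans (length-filter≤ (λ x → ¬? (f x ≟ g x)) χ (λ x → 0≤⟦ not (does (rank x ℕₚ.≟ h x)) ⟧) (λ x ne → 1≤χ x ne (rank x ℕₚ.≟ h x)) (allCube d))
        (≤-reflexive (sumℚ-allCube d χ))
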